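{- The decision problem $\mathrm{MSAT}_{\mathbb{N}}(\Box,\downarrow,@)$ (satisfiability over the frame $(\mathbb{N},<)$ of monotone hybrid formulae with the operators $\Box,\downarrow,@$) is hard for deterministic logarithmic space ($\mathrm{L}$-hard).
   Context: Syntax. Let SVAR be a countable set of state variables. The formulae considered are given by $$\varphi ::= x \mid \top \mid \bot \mid \varphi\wedge\varphi \mid \varphi\vee\varphi \mid \Box\varphi \mid \downarrow x.\varphi \mid @_x\varphi \qquad (x\in \mathrm{SVAR}),$$ with no negation, atomic propositions or nominals. A variable may be bound several times in a formula; by renaming bound variables apart one may assume that every state variable is bound at most once and that free state variables are never bound later. Semantics over $(\mathbb{N},<)$. For an assignment $g:\mathrm{SVAR}\to\mathbb{N}$ and $n\in\mathbb{N}$, $g^x_n$ maps $x$ to $n$ and agrees with $g$ elsewhere. Satisfaction: $g,n\models x$ iff $g(x)=n$; $\top,\bot,\wedge,\vee$ as usual; $g,n\models\Box\varphi$ iff $g,n'\models\varphi$ for all $n'>n$; $g,n\models @_x\varphi$ iff $g,g(x)\models\varphi$; $g,n\models\,\downarrow x.\varphi$ iff $g^x_n,n\models\varphi$. $\mathrm{MSAT}_{\mathbb{N}}(\Box,\downarrow,@)$: given such a formula $\varphi$, do there exist $g:\mathrm{SVAR}\to\mathbb{N}$ and $n\in\mathbb{N}$ with $g,n\models\varphi$? Hardness is with respect to constant-depth reductions: $A\leq_{cd}D$ iff there is a logtime-uniform $\mathrm{AC}^0$-circuit family with oracle gates for $D$ that decides membership in $A$. -}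

module Defs where

open import Data.Bool using (Bool; true; false; not)
import Data.Bool.ListAction as Bool
open import Data.Fin as Fin using (Fin; toℕ)
open import Data.List as List using (List; []; _∷_; _++_; [_]; length; concatMap)
open import Data.Nat using (ℕ; zero; suc; _+_; _*_; _^_; _≤_; _<_; pred; _≟_)
open import Data.Nat.Logarithm using (⌊log₂_⌋)
open import Data.Product using (Σ-syntax; ∃-syntax; _×_; _,_)
open import Data.Sum using (_⊎_; inj₁; inj₂)
open import Data.Unit using (⊤)
open import Data.Empty using (⊥)
open import Data.Vec as Vec using (Vec)
open import Data.Vec.Relation.Unary.All using (All)
open import Function using (_⇔_)
open import Level using (0ℓ)
open import Relation.Binary.PropositionalEquality using (_≡_)
open import Relation.Nullary using (does)
open import Relation.Unary using (Pred; _∈_)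

Language : Set₁
Language = Pred (List Bool) 0ℓ

-- Binary notation, least significant bit first and without trailing
-- `false`; in particular 0 is the empty word.

increment : List Bool → List Bool
increment []           = [ true ]
increment (false ∷ bs) = true ∷ bs
increment (true  ∷ bs) = false ∷ increment bs

bin : ℕ → List Bool
bin zero    = []
bin (suc n) = increment (bin n)

------------------------------------------------------------------------
-- Monotone hybrid formulae over (ℕ, <)

SVAR : Set
SVAR = ℕ

infixr 7 _∧′_
infixr 6 _∨′_
infix  8 □_

data Formula : Set where
  var       : SVAR → Formula
  ⊤′ ⊥′     : Formula
  _∧′_ _∨′_ : Formula → Formula → Formula
  □_        : Formula → Formula
  ↓ at      : SVAR → Formula → Formula

Assignment : Set
Assignment = SVAR → ℕ

_[_↦_] : Assignment → SVAR → ℕ → Assignment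
(g [ x ↦ n ]) y with does (y ≟ x)
... | true  = n
... | false = g y

infix 4 _,_⊨_

_,_⊨_ : Assignment → ℕ → Formula → Set
g , n ⊨ var x    = g x ≡ n
g , n ⊨ ⊤′       = ⊤
g , n ⊨ ⊥′       = ⊥
g , n ⊨ (φ ∧′ ψ) = (g , n ⊨ φ) × (g , n ⊨ ψ)
g , n ⊨ (φ ∨′ ψ) = (g , n ⊨ φ) ⊎ (g , n ⊨ ψ)
g , n ⊨ □ φ      = ∀ n′ → n < n′ → g , n′ ⊨ φ
g , n ⊨ ↓ x φ    = g [ x ↦ n ] , n ⊨ φ
g , n ⊨ at x φ   = g , g x ⊨ φ

Satisfiable : Formula → Set
Satisfiable φ = ∃[ g ] ∃[ n ] g , n ⊨ φ

-- Formulae as words: the usual linear notation, with binary connectives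
-- in parentheses, a variable being written as the letter `x` followed by
-- its index in binary, and every symbol being given a four-bit code.

data Symbol : Set where
  `x `0 `1 `⊤ `⊥ `∧ `∨ `□ `↓ `at `lp `rp : Symbol

symbolCode : Symbol → List Bool
symbolCode `x  = false ∷ false ∷ false ∷ false ∷ []
symbolCode `0  = false ∷ false ∷ false ∷ true  ∷ []
symbolCode `1  = false ∷ false ∷ true  ∷ false ∷ []
symbolCode `⊤  = false ∷ false ∷ true  ∷ true  ∷ []
symbolCode `⊥  = false ∷ true  ∷ false ∷ false ∷ []
symbolCode `∧  = false ∷ true  ∷ false ∷ true  ∷ []
symbolCode `∨  = false ∷ true  ∷ true  ∷ false ∷ []
symbolCode `□  = false ∷ true  ∷ true  ∷ true  ∷ []
symbolCode `↓  = true  ∷ false ∷ false ∷ false ∷ []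
symbolCode `at = true  ∷ false ∷ false ∷ true  ∷ []
symbolCode `lp = true  ∷ false ∷ true  ∷ false ∷ []
symbolCode `rp = true  ∷ false ∷ true  ∷ true  ∷ []

digit : Bool → Symbol
digit false = `0
digit true  = `1

writeVar : SVAR → List Symbol
writeVar x = `x ∷ List.map digit (bin x)

write : Formula → List Symbol
write (var x)  = writeVar x
write ⊤′       = [ `⊤ ]
write ⊥′       = [ `⊥ ]
write (φ ∧′ ψ) = `lp ∷ write φ ++ `∧ ∷ write ψ ++ [ `rp ]
write (φ ∨′ ψ) = `lp ∷ write φ ++ `∨ ∷ write ψ ++ [ `rp ]
write (□ φ)    = `□ ∷ write φ
write (↓ x φ)  = `↓ ∷ writeVar x ++ write φ
write (at x φ) = `at ∷ writeVar x ++ write φ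

encode : Formula → List Bool
encode φ = concatMap symbolCode (write φ)

MSAT : Language
MSAT w = ∃[ φ ] encode φ ≡ w × Satisfiable φ

------------------------------------------------------------------------
-- Deterministic Turing machines with a read-only two-way input tape and
-- finitely many two-way infinite work tapes

data Direction : Set where
  left stay right : Direction

-- An input word is delimited by two end markers.

data InputCell (Σ : Set) : Set where
  ⊢ ⊣    : InputCell Σ
  letter : Σ → InputCell Σ

-- In `move`, each work tape is given the symbol to be written and the
-- direction of the head.

data Action (states tapes symbols : ℕ) : Set where
  halt : Bool → Action states tapes symbols
  move : Fin states → Direction → Vec (Fin symbols × Direction) tapes →
         Action states tapes symbols

-- Work tape symbols are Fin (suc letters), with zero the blank.

record TM (Σ : Set) : Set where
  field
    states tapes letters : ℕ
    start : Fin states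
    δ     : Fin states → InputCell Σ → Vec (Fin (suc letters)) tapes →
            Action states tapes (suc letters)

-- The visited portion of a work tape: the cells left of the head (nearest
-- first), the scanned cell, and the cells right of it (nearest first).
-- All other cells are blank.

record Tape (letters : ℕ) : Set where
  constructor tape
  field
    before  : List (Fin (suc letters))
    scanned : Fin (suc letters)
    after   : List (Fin (suc letters))

  visited : ℕ
  visited = suc (length before + length after)

open Tape public using (scanned; visited)

blankTape : ∀ {l} → Tape l
blankTape = tape [] Fin.zero []

actOn : ∀ {l} → Tape l → Fin (suc l) × Direction → Tape l
actOn (tape ls       _ rs)       (a , stay)  = tape ls a rs
actOn (tape []       _ rs)       (a , left)  = tape [] Fin.zero (a ∷ rs)
actOn (tape (l ∷ ls) _ rs)       (a , left)  = tape ls l (a ∷ rs)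
actOn (tape ls       _ [])       (a , right) = tape (a ∷ ls) Fin.zero []
actOn (tape ls       _ (r ∷ rs)) (a , right) = tape (a ∷ ls) r rs

module _ {Σ : Set} where

  -- Position 0 carries the left marker and every position beyond the word
  -- the right marker.

  readInput : List Σ → ℕ → InputCell Σ
  readInput w       zero          = ⊢
  readInput []      (suc i)       = ⊣
  readInput (a ∷ w) (suc zero)    = letter a
  readInput (a ∷ w) (suc (suc i)) = readInput w (suc i)

  -- The input head does not pass the markers.

  moveInput : List Σ → Direction → ℕ → ℕ
  moveInput w left  i = pred i
  moveInput w stay  i = i
  moveInput w right i with readInput w i
  ... | ⊣     = i
  ... | ⊢     = suc i
  ... | letter _ = suc i

  module _ (M : TM Σ) where
    open TM M

    record Config : Set where
      constructor config
      field
        state     : Fin states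
        inputHead : ℕ
        workTapes : Vec (Tape letters) tapes

    initial : Config
    initial = config start 0 (Vec.replicate tapes blankTape)

    step : List Σ → Config → Bool ⊎ Config
    step w (config q i ts) with δ q (readInput w i) (Vec.map scanned ts)
    ... | halt b       = inj₁ b
    ... | move q′ d as = inj₂ (config q′ (moveInput w d i) (Vec.zipWith actOn ts as))

    -- Run w P c t b: on input w, started in configuration c, the machine
    -- halts after t moves with answer b, and all configurations on the way
    -- satisfy P.

    data Run (w : List Σ) (P : Pred Config 0ℓ) : Config → ℕ → Bool → Set where
      stop : ∀ {c b} → P c → step w c ≡ inj₁ b → Run w P c 0 b
      next : ∀ {c c′ t b} → P c → step w c ≡ inj₂ c′ →
             Run w P c′ t b → Run w P c (suc t) b

    UsesSpace≤ : ℕ → Pred Config 0ℓ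
    UsesSpace≤ s c = All (λ t → visited t ≤ s) (Config.workTapes c)

    AnswersInSpace : List Σ → ℕ → Bool → Set
    AnswersInSpace w s b = ∃[ t ] Run w (UsesSpace≤ s) initial t b

    AnswersInTime : List Σ → ℕ → Bool → Set
    AnswersInTime w s b = ∃[ t ] t ≤ s × Run w (λ _ → ⊤) initial t b

-- The class L

InL : Language → Set
InL A = Σ[ M ∈ TM Bool ] ∃[ c ] ∀ w →
  ∃[ b ] AnswersInSpace M w (c * suc ⌊log₂ length w ⌋) b × (b ≡ true ⇔ w ∈ A)

------------------------------------------------------------------------
-- Boolean circuits of unbounded fan-in with oracle gates

-- The constants are the conjunction and the disjunction of no gates.

data Gate (n size : ℕ) : Set where
  input         : Fin n → Gate n size
  neg           : Fin size → Gate n size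
  and or oracle : List (Fin size) → Gate n size

predecessors : ∀ {n s} → Gate n s → List (Fin s)
predecessors (input i)   = []
predecessors (neg h)     = [ h ]
predecessors (and hs)    = hs
predecessors (or hs)     = hs
predecessors (oracle hs) = hs

record Circuit (n : ℕ) : Set where
  field
    size   : ℕ
    gate   : Fin size → Gate n size
    output : Fin size

  -- A directed path with k edges, ending in g.

  data Path : Fin size → ℕ → Set where
    here  : ∀ {g} → Path g 0
    there : ∀ {g k} (p : Fin (length (predecessors (gate g)))) →
            Path (List.lookup (predecessors (gate g)) p) k → Path g (suc k)

  -- A bound on the lengths of paths also makes the circuit acyclic.

  Depth≤ : ℕ → Set
  Depth≤ d = ∀ {g k} → Path g k → k ≤ d

  -- Wires are bounded as well as gates, since a gate may occur repeatedly
  -- among the predecessors of another.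

  Size≤ : ℕ → Set
  Size≤ s = size ≤ s × (∀ g → length (predecessors (gate g)) ≤ s)

  module _ (D : Language) (x : Vec Bool n) (v : Fin size → Bool) where

    Correct : Bool → Gate n size → Set
    Correct b (input i)   = b ≡ Vec.lookup x i
    Correct b (neg h)     = b ≡ not (v h)
    Correct b (and hs)    = b ≡ Bool.and (List.map v hs)
    Correct b (or hs)     = b ≡ Bool.or (List.map v hs)
    Correct b (oracle hs) = b ≡ true ⇔ List.map v hs ∈ D

    IsEvaluation : Set
    IsEvaluation = ∀ g → Correct (v g) (gate g)

  -- For an acyclic circuit the evaluation is unique.

  Outputs : Language → Vec Bool n → Bool → Set
  Outputs D x b = ∃[ v ] IsEvaluation D x v × v output ≡ b

CircuitFamily : Set
CircuitFamily = ∀ n → Circuit n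

IsAC⁰ : CircuitFamily → Set
IsAC⁰ C = (∃[ d ] ∀ n → Circuit.Depth≤ (C n) d)
        × (∃[ k ] ∀ n → Circuit.Size≤ (C n) (n ^ k + k))

Decides : CircuitFamily → Language → Language → Set
Decides C D A = ∀ n (x : Vec Bool n) →
  ∃[ b ] Circuit.Outputs (C n) D x b × (b ≡ true ⇔ Vec.toList x ∈ A)

------------------------------------------------------------------------
-- Logtime uniformity (Ruzzo's U_D-uniformity): the direct connection
-- language, made up of tuples of binary numbers, is decidable in time
-- logarithmic in the number n of inputs of the circuit asked about. As n
-- itself is given in binary, sequential access to the tuple suffices.

data GateType : Set where
  input             : ℕ → GateType
  neg and or oracle : GateType

gateType : ∀ {n s} → Gate n s → GateType
gateType (input i)  = input (toℕ i)
gateType (neg _)    = neg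
gateType (and _)    = and
gateType (or _)     = or
gateType (oracle _) = oracle

-- What may be asked about gate number g: whether it is the output gate,
-- whether it has a given type, and whether its p-th predecessor (counting
-- from 0) is gate number h.

data Query : Set where
  isOutput : Query
  hasType  : GateType → Query
  wire     : (p h : ℕ) → Query

data TupleSymbol : Set where
  bit                                  : Bool → TupleSymbol
  `#                                   : TupleSymbol
  `output `input `neg `and `or `oracle : TupleSymbol

bits : ℕ → List TupleSymbol
bits n = List.map bit (bin n)

writeQuery : Query → List TupleSymbol
writeQuery isOutput            = [ `output ]
writeQuery (hasType (input i)) = `input ∷ bits i
writeQuery (hasType neg)       = [ `neg ]
writeQuery (hasType and)       = [ `and ]
writeQuery (hasType or)        = [ `or ]
writeQuery (hasType oracle)    = [ `oracle ]
writeQuery (wire p h)          = bits p ++ `# ∷ bits h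

⟨_,_,_⟩ : ℕ → ℕ → Query → List TupleSymbol
⟨ n , g , q ⟩ = bits n ++ `# ∷ bits g ++ `# ∷ writeQuery q

module _ (C : CircuitFamily) where

  HoldsOf : (n : ℕ) → Fin (Circuit.size (C n)) → Query → Set
  HoldsOf n g isOutput    = Circuit.output (C n) ≡ g
  HoldsOf n g (hasType τ) = gateType (Circuit.gate (C n) g) ≡ τ
  HoldsOf n g (wire p h)  =
    Σ[ i ∈ Fin (length hs) ] toℕ i ≡ p × toℕ (List.lookup hs i) ≡ h
    where hs = predecessors (Circuit.gate (C n) g)

  DirectConnection : ℕ → ℕ → Query → Set
  DirectConnection n g q = ∃[ g′ ] toℕ g′ ≡ g × HoldsOf n g′ q

  LogtimeUniform : Set
  LogtimeUniform = Σ[ M ∈ TM TupleSymbol ] ∃[ c ] ∀ n g q →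
    ∃[ b ] AnswersInTime M ⟨ n , g , q ⟩ (c * suc ⌊log₂ n ⌋) b
         × (b ≡ true ⇔ DirectConnection n g q)

------------------------------------------------------------------------
-- Constant-depth reductions and hardness

infix 4 _≤cd_

_≤cd_ : Language → Language → Set
A ≤cd D = Σ[ C ∈ CircuitFamily ] IsAC⁰ C × LogtimeUniform C × Decides C D A

L-hard : Language → Set₁
L-hard D = ∀ A → InL A → A ≤cd D

{-# OPTIONS --safe #-}

-- A formula built from ↓ and @ alone is a straight-line program over (ℕ, <),
-- as @ x ↓ y copies the value of x to y. Hence, for variables acc and init,
--   □ ↓ acc @ x₁ ↓ y₁ @ x₂ ↓ y₂ … @ init acc
-- is satisfiable iff the copies carry the value of acc to init: the □ lets
-- this value range over infinitely many numbers, so that it differs from what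
-- init held before. Take the configurations of a logarithmic space machine as
-- variables, acc standing for acceptance, and copy to every configuration c
-- the value of its successor, in as many rounds as there are configurations.
-- Where the successor is u₁ or u₀ according to the input letter 1 or 0, this
-- is done by @ u₁ ↓ c @ u₀ ⊙ c with ⊙ = @ or ⊙ = ↓, respectively. The codes
-- of @ and ↓ differ in a single bit, and no other bit of the formula depends
-- on the input, so an oracle gate above inputs and constants suffices.
--
-- A configuration is a fixed number of tracks of Θ(log n) bits, and its
-- variable is written in one-hot notation with a digit for each configuration
-- o. A position in the formula then is a tuple of fields (bit and symbol
-- within a group, o, quarter of a block, c, round), and the symbol there
-- depends on whether o is the successor of c, which one-bit automata decide
-- track by track. So a machine which sweeps a tape of Θ(log n) cells a
-- constant number of times decides the direct connection language.

module Submission where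

open import Defs
open import Data.Bool using (Bool; true; false; not; if_then_else_; _∧_)
import Data.Bool.Properties as Bool
open import Data.Empty using (⊥; ⊥-elim)
open import Data.Fin as Fin using (Fin; toℕ)
import Data.Fin.Properties as Fin
open import Data.Fin.Patterns using (0F; 1F; 2F; 3F; 4F; 5F; 6F)
open import Data.List as List using (List; []; _∷_; _++_; [_]; length; concatMap)
import Data.List.Properties as List
open import Data.List.Relation.Unary.All as All using (All; []; _∷_)
import Data.List.Relation.Unary.All.Properties as All
open import Data.List.Relation.Unary.Any using (here; there)
open import Data.List.Membership.Propositional using () renaming (_∈_ to _∈ₗ_)
import Data.List.Membership.Propositional.Properties as List
open import Data.Maybe using (Maybe; just; nothing)
open import Data.Nat
open import Data.Nat.GeneralisedArithmetic using (iterate)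
open import Data.Nat.Properties
open import Algebra.Properties.CommutativeSemigroup *-commutativeSemigroup using (x∙yz≈y∙xz)
open import Data.Nat.Logarithm using (⌊log₂_⌋; ⌊log₂⌋-mono-≤; ⌊log₂[2^n]⌋≡n)
open import Data.Product as Product using (Σ-syntax; ∃-syntax; _×_; _,_; proj₁; proj₂)
open import Data.Sum as Sum using (_⊎_; inj₁; inj₂)
open import Data.Unit using (⊤; tt)
open import Data.Vec as Vec using (Vec; []; _∷_)
open import Data.Vec.Relation.Unary.All as VecAll using ([]; _∷_)
import Data.Vec.Properties as Vec
open import Function using (_∘_; id; case_of_; _⇔_; mk⇔; Equivalence)
open import Relation.Binary.PropositionalEquality hiding ([_])
open import Relation.Nullary using (¬_; Dec; yes; no)

-- Binary notation

-- A gate computes one bit of the word from its position alone, so positions have to split into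
-- fields without any arithmetic. Hence every repetition is a power of two: digits are spread out to
-- groups of four symbols, the header of a prefix fills the group which belongs to the zero word, a
-- block has four quarters, and the last block of the last round is followed by nothing.
--
-- Both ends of the formula have to fit into this pattern. So acceptance is the word `zeros`, whose
-- first block makes room for the opening `□ ↓ acc`, and `ones` is a fictitious predecessor of the
-- initial configuration, whose last block ends at the point held by that configuration and there
-- tests acc.
--
-- In a block, `c` is overwritten with the value of `u₁ c` before that of `u₀ c` is read. This does
-- harm only if `c` is its own successor. Among the configurations that lead to a final one, only
-- this final one is, and it is fixed under either letter.

bit→ℕ : Bool → ℕ
bit→ℕ false = 0
bit→ℕ true  = 1

firstBit : List Bool → Bool
firstBit []      = false
firstBit (b ∷ _) = b

pad : ∀ k → List Bool → Vec Bool k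
pad zero    bs = []
pad (suc k) bs = firstBit bs ∷ pad k (List.drop 1 bs)

incV : ∀ {k} → Vec Bool k → Vec Bool k
incV []          = []
incV (false ∷ v) = true ∷ v
incV (true ∷ v)  = false ∷ incV v

val : ∀ {k} → Vec Bool k → ℕ
val []      = 0
val (b ∷ v) = bit→ℕ b + 2 * val v

valL : List Bool → ℕ
valL []       = 0
valL (b ∷ bs) = bit→ℕ b + 2 * valL bs

pad-increment : ∀ k bs → pad k (increment bs) ≡ incV (pad k bs)
pad-increment zero    _            = refl
pad-increment (suc k) []           = refl
pad-increment (suc k) (false ∷ bs) = refl
pad-increment (suc k) (true ∷ bs)  = cong (false ∷_) (pad-increment k bs)

valL-increment : ∀ bs → valL (increment bs) ≡ suc (valL bs)
valL-increment []           = refl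
valL-increment (false ∷ bs) = refl
valL-increment (true ∷ bs)  =
  trans (cong (2 *_) (valL-increment bs)) (*-suc 2 (valL bs))

valL-bin : ∀ n → valL (bin n) ≡ n
valL-bin zero    = refl
valL-bin (suc n) = trans (valL-increment (bin n)) (cong suc (valL-bin n))

val<2^ : ∀ {k} (v : Vec Bool k) → val v < 2 ^ k
val<2^ []      = s≤s z≤n
val<2^ {suc k} (b ∷ v) = begin-strict
  bit→ℕ b + 2 * val v <⟨ +-monoˡ-< (2 * val v) (bit<2 b) ⟩
  2 + 2 * val v       ≡⟨ *-suc 2 (val v) ⟨
  2 * suc (val v)     ≤⟨ *-monoʳ-≤ 2 (val<2^ v) ⟩
  2 * 2 ^ k           ∎
  where
  open ≤-Reasoning
  bit<2 : ∀ b → bit→ℕ b < 2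
  bit<2 false = s≤s z≤n
  bit<2 true  = s≤s (s≤s z≤n)

bit+2*-injective : ∀ b c m n → bit→ℕ b + 2 * m ≡ bit→ℕ c + 2 * n → b ≡ c × m ≡ n
bit+2*-injective false false m n eq = refl , *-cancelˡ-≡ m n 2 eq
bit+2*-injective true  true  m n eq = refl , *-cancelˡ-≡ m n 2 (suc-injective eq)
bit+2*-injective false true  m n eq = ⊥-elim (even≢odd m n eq)
bit+2*-injective true  false m n eq = ⊥-elim (even≢odd n m (sym eq))

val-injective : ∀ {k} (v w : Vec Bool k) → val v ≡ val w → v ≡ w
val-injective []      []      _  = refl
val-injective (b ∷ v) (c ∷ w) eq with bit+2*-injective b c (val v) (val w) eq
... | refl , eq′ = cong (b ∷_) (val-injective v w eq′)

val-pad-[] : ∀ k → val (pad k []) ≡ 0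
val-pad-[] zero    = refl
val-pad-[] (suc k) = cong (2 *_) (val-pad-[] k)

val-pad : ∀ k bs → length bs ≤ k → val (pad k bs) ≡ valL bs
val-pad k       []       _       = val-pad-[] k
val-pad (suc k) (b ∷ bs) (s≤s p) = cong (λ m → bit→ℕ b + 2 * m) (val-pad k bs p)

-- Words without a trailing `false`. On these `valL` is injective, and hence `bin` recovers them
-- from their values.
data Canonical : List Bool → Set where
  nil : Canonical []
  one : Canonical [ true ]
  add : ∀ b {c bs} → Canonical (c ∷ bs) → Canonical (b ∷ c ∷ bs)

increment-canonical : ∀ {bs} → Canonical bs → Canonical (increment bs)
increment-canonical nil = one
increment-canonical one = add false one
increment-canonical (add false c) = add true c
increment-canonical (add true {false} c) = add false (increment-canonical c)
increment-canonical (add true {true} {[]} c) = add false (add false one)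
increment-canonical (add true {true} {x ∷ bs} c) = add false (increment-canonical c)

bin-canonical : ∀ n → Canonical (bin n)
bin-canonical zero    = nil
bin-canonical (suc n) = increment-canonical (bin-canonical n)

∷ʳ-true-canonical : ∀ bs → Canonical (bs List.∷ʳ true)
∷ʳ-true-canonical []           = one
∷ʳ-true-canonical (b ∷ [])     = add b one
∷ʳ-true-canonical (b ∷ c ∷ bs) = add b (∷ʳ-true-canonical (c ∷ bs))

canonical-lower : ∀ {b bs} → Canonical (b ∷ bs) → 2 ^ length bs ≤ valL (b ∷ bs)
canonical-lower one = s≤s z≤n
canonical-lower (add b {c} {bs} k) =
  ≤-trans (*-monoʳ-≤ 2 (canonical-lower k)) (m≤n+m _ (bit→ℕ b))

canonical-injective : ∀ {bs cs} → Canonical bs → Canonical cs → valL bs ≡ valL cs → bs ≡ cs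
canonical-injective nil nil _ = refl
canonical-injective {cs = c ∷ cs} nil p eq =
  ⊥-elim (<⇒≢ (≤-trans (m^n>0 2 (length cs)) (canonical-lower p)) eq)
canonical-injective {bs = b ∷ bs} p nil eq =
  ⊥-elim (<⇒≢ (≤-trans (m^n>0 2 (length bs)) (canonical-lower p)) (sym eq))
canonical-injective {b ∷ bs} {c ∷ cs} p q eq
  with bit+2*-injective b c (valL bs) (valL cs) eq
... | refl , eq′ = cong (b ∷_) (canonical-injective (rest p) (rest q) eq′)
  where
  rest : ∀ {b bs} → Canonical (b ∷ bs) → Canonical bs
  rest one       = nil
  rest (add _ c) = c

bin-valL : ∀ {bs} → Canonical bs → bin (valL bs) ≡ bs
bin-valL {bs} c = canonical-injective (bin-canonical (valL bs)) c (valL-bin (valL bs))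

length-bin≤ : ∀ k {n} → n < 2 ^ k → length (bin n) ≤ k
length-bin≤ k {n} n<2^k with bin n | valL-bin n | bin-canonical n
... | []     | _  | _ = z≤n
... | b ∷ bs | eq | c = ≰⇒> λ k≤ → <⇒≱ n<2^k (begin
  2 ^ k         ≤⟨ ^-monoʳ-≤ 2 k≤ ⟩
  2 ^ length bs ≤⟨ canonical-lower c ⟩
  valL (b ∷ bs) ≡⟨ eq ⟩
  n             ∎)
  where open ≤-Reasoning

val-pad-bin : ∀ k n → n < 2 ^ k → val (pad k (bin n)) ≡ n
val-pad-bin k n p = trans (val-pad k (bin n) (length-bin≤ k p)) (valL-bin n)

pad-bin-val : ∀ {k} (v : Vec Bool k) → pad k (bin (val v)) ≡ v
pad-bin-val {k} v = val-injective _ v (val-pad-bin k (val v) (val<2^ v))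

valL<2^length : ∀ bs → valL bs < 2 ^ length bs
valL<2^length []       = s≤s z≤n
valL<2^length (b ∷ bs) = subst (_< 2 ^ suc (length bs)) (lemma (b ∷ bs)) (val<2^ (Vec.fromList (b ∷ bs)))
  where
  lemma : ∀ bs → val (Vec.fromList bs) ≡ valL bs
  lemma []       = refl
  lemma (b ∷ bs) = cong (λ m → bit→ℕ b + 2 * m) (lemma bs)

n<2^length-bin : ∀ n → n < 2 ^ length (bin n)
n<2^length-bin n = subst (_< 2 ^ length (bin n)) (valL-bin n) (valL<2^length (bin n))

length≤⇒<2^ : ∀ k n → length (bin n) ≤ k → n < 2 ^ k
length≤⇒<2^ k n p = ≤-trans (n<2^length-bin n) (^-monoʳ-≤ 2 p)

2^length-bin≤ : ∀ n → 2 ^ length (bin n) ≤ 1 + 2 * n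
2^length-bin≤ n with bin n | valL-bin n | bin-canonical n
... | []     | _    | _ = s≤s z≤n
... | b ∷ bs | refl | c = ≤-trans (*-monoʳ-≤ 2 (canonical-lower c)) (n≤1+n _)

⌊log₂⌋≤length-bin : ∀ n → ⌊log₂ n ⌋ ≤ length (bin n)
⌊log₂⌋≤length-bin n = begin
  ⌊log₂ n ⌋                  ≤⟨ ⌊log₂⌋-mono-≤ (<⇒≤ (n<2^length-bin n)) ⟩
  ⌊log₂ 2 ^ length (bin n) ⌋ ≡⟨ ⌊log₂[2^n]⌋≡n (length (bin n)) ⟩
  length (bin n)             ∎
  where open ≤-Reasoning

length-bin≤1+⌊log₂⌋ : ∀ n → length (bin n) ≤ suc ⌊log₂ n ⌋
length-bin≤1+⌊log₂⌋ n with bin n | valL-bin n | bin-canonical n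
... | []     | _    | _ = z≤n
... | b ∷ bs | refl | c = s≤s (begin
  length bs               ≡⟨ ⌊log₂[2^n]⌋≡n (length bs) ⟨
  ⌊log₂ 2 ^ length bs ⌋   ≤⟨ ⌊log₂⌋-mono-≤ (canonical-lower c) ⟩
  ⌊log₂ valL (b ∷ bs) ⌋   ∎)
  where open ≤-Reasoning

-- Enumeration of binary words

zeros ones : ∀ k → Vec Bool k
zeros k = Vec.replicate k false
ones k  = Vec.replicate k true

bothBits : ∀ {k} → Vec Bool k → List (Vec Bool (suc k))
bothBits v = (false ∷ v) ∷ (true ∷ v) ∷ []

-- In the order of their values, the least significant bit coming first.

allVecs : ∀ k → List (Vec Bool k)
allVecs zero    = [] ∷ []
allVecs (suc k) = concatMap bothBits (allVecs k)

-- The words other than `zeros` and `ones` number the blocks made up of four prefixes; the blocks of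
-- the two extreme words begin and end the formula. In the recursion each extreme word contributes
-- just one of its two extensions.
properVecs : ∀ k → List (Vec Bool (suc k))
properVecs zero    = []
properVecs (suc k) = (true ∷ zeros (suc k)) ∷ concatMap bothBits (properVecs k) ++ (false ∷ ones (suc k)) ∷ []

-- These are also the places of the digits in one-hot notation, since the group of the zero word is
-- needed for the header.
nonzeroVecs : ∀ k → List (Vec Bool (suc k))
nonzeroVecs k = properVecs k ++ ones (suc k) ∷ []

allVecs-suc : ∀ k → allVecs (suc k) ≡ zeros (suc k) ∷ nonzeroVecs k
allVecs-suc zero    = refl
allVecs-suc (suc k) = begin
  concatMap bothBits (allVecs (suc k))
    ≡⟨ cong (concatMap bothBits) (allVecs-suc k) ⟩
  zeros (2 + k) ∷ (true ∷ zeros (suc k)) ∷ concatMap bothBits (properVecs k ++ ones (suc k) ∷ [])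
    ≡⟨ cong (λ l → zeros (2 + k) ∷ (true ∷ zeros (suc k)) ∷ l)
         (List.concatMap-++ bothBits (properVecs k) _) ⟩
  zeros (2 + k) ∷ (true ∷ zeros (suc k)) ∷ concatMap bothBits (properVecs k) ++ (false ∷ ones (suc k)) ∷ ones (2 + k) ∷ []
    ≡⟨ cong (λ l → zeros (2 + k) ∷ (true ∷ zeros (suc k)) ∷ l)
         (List.++-assoc (concatMap bothBits (properVecs k)) ((false ∷ ones (suc k)) ∷ []) _) ⟨
  zeros (2 + k) ∷ nonzeroVecs (suc k) ∎
  where open ≡-Reasoning

Proper : ∀ {k} → Vec Bool k → Set
Proper {k} v = v ≢ zeros k × v ≢ ones k

properVecs-proper : ∀ k → All Proper (properVecs k)
properVecs-proper zero    = []
properVecs-proper (suc k) =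
  ((λ ()) , (λ ())) ∷
  All.++⁺ (All.concat⁺ (All.map⁺ (All.map step′ (properVecs-proper k)))) (((λ ()) , (λ ())) ∷ [])
  where
  step′ : ∀ {v : Vec Bool (suc k)} → Proper v → All Proper (bothBits v)
  step′ (p , q) = (p ∘ cong Vec.tail , (λ ())) ∷ ((λ ()) , q ∘ cong Vec.tail) ∷ []

nonzeroVecs-nonzero : ∀ k → All (_≢ zeros (suc k)) (nonzeroVecs k)
nonzeroVecs-nonzero k = All.++⁺ (All.map proj₁ (properVecs-proper k)) ((λ ()) ∷ [])

∈-allVecs : ∀ {k} (v : Vec Bool k) → v ∈ₗ allVecs k
∈-allVecs []      = here refl
∈-allVecs (b ∷ v) = List.∈-concat⁺′ (choose b) (List.∈-map⁺ bothBits (∈-allVecs v))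
  where
  choose : ∀ b → (b ∷ v) ∈ₗ bothBits v
  choose false = here refl
  choose true  = there (here refl)

∈-nonzeroVecs : ∀ {k} (v : Vec Bool (suc k)) → v ≢ zeros (suc k) → v ∈ₗ nonzeroVecs k
∈-nonzeroVecs {k} v v≢0 with subst (v ∈ₗ_) (allVecs-suc k) (∈-allVecs v)
... | here v≡0 = ⊥-elim (v≢0 v≡0)
... | there p  = p

concatMap-concatMap : ∀ {A B C : Set} (g : B → List C) (f : A → List B) xs →
                      concatMap g (concatMap f xs) ≡ concatMap (concatMap g ∘ f) xs
concatMap-concatMap g f []       = refl
concatMap-concatMap g f (x ∷ xs) =
  trans (List.concatMap-++ g (f x) (concatMap f xs)) (cong (concatMap g (f x) ++_) (concatMap-concatMap g f xs))

-- The low-order bits vary fastest, so the high part is the outer loop. This turns nested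
-- concatenations into one list indexed by positions.
allVecs-+ : ∀ a b → allVecs (a + b) ≡ concatMap (λ hi → List.map (Vec._++ hi) (allVecs a)) (allVecs b)
allVecs-+ zero    b = sym (List.concatMap-pure (allVecs b))
allVecs-+ (suc a) b = begin
  concatMap bothBits (allVecs (a + b))
    ≡⟨ cong (concatMap bothBits) (allVecs-+ a b) ⟩
  concatMap bothBits (concatMap (λ hi → List.map (Vec._++ hi) (allVecs a)) (allVecs b))
    ≡⟨ concatMap-concatMap bothBits _ (allVecs b) ⟩
  concatMap (λ hi → concatMap bothBits (List.map (Vec._++ hi) (allVecs a))) (allVecs b)
    ≡⟨ List.concatMap-cong (λ hi → trans (List.concatMap-map bothBits (Vec._++ hi) (allVecs a))
                                    (sym (List.map-concatMap (Vec._++ hi) bothBits (allVecs a)))) (allVecs b) ⟩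
  concatMap (λ hi → List.map (Vec._++ hi) (allVecs (suc a))) (allVecs b) ∎
  where open ≡-Reasoning

map-allVecs-+ : ∀ {A : Set} a b (f : Vec Bool (a + b) → A) →
  List.map f (allVecs (a + b)) ≡ concatMap (λ hi → List.map (λ lo → f (lo Vec.++ hi)) (allVecs a)) (allVecs b)
map-allVecs-+ a b f = begin
  List.map f (allVecs (a + b))
    ≡⟨ cong (List.map f) (allVecs-+ a b) ⟩
  List.map f (concatMap (λ hi → List.map (Vec._++ hi) (allVecs a)) (allVecs b))
    ≡⟨ List.map-concatMap f _ (allVecs b) ⟩
  concatMap (λ hi → List.map f (List.map (Vec._++ hi) (allVecs a))) (allVecs b)
    ≡⟨ List.concatMap-cong (λ hi → sym (List.map-∘ (allVecs a))) (allVecs b) ⟩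
  concatMap (λ hi → List.map (λ lo → f (lo Vec.++ hi)) (allVecs a)) (allVecs b) ∎
  where open ≡-Reasoning

concatMap-allVecs-+ : ∀ {A : Set} a b (f : Vec Bool (a + b) → List A) →
  concatMap f (allVecs (a + b)) ≡ concatMap (λ hi → concatMap (λ lo → f (lo Vec.++ hi)) (allVecs a)) (allVecs b)
concatMap-allVecs-+ a b f = begin
  concatMap f (allVecs (a + b))
    ≡⟨ cong (concatMap f) (allVecs-+ a b) ⟩
  concatMap f (concatMap (λ hi → List.map (Vec._++ hi) (allVecs a)) (allVecs b))
    ≡⟨ concatMap-concatMap f _ (allVecs b) ⟩
  concatMap (λ hi → concatMap f (List.map (Vec._++ hi) (allVecs a))) (allVecs b)
    ≡⟨ List.concatMap-cong (λ hi → List.concatMap-map f (Vec._++ hi) (allVecs a)) (allVecs b) ⟩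
  concatMap (λ hi → concatMap (λ lo → f (lo Vec.++ hi)) (allVecs a)) (allVecs b) ∎
  where open ≡-Reasoning

length-allVecs : ∀ k → length (allVecs k) ≡ 2 ^ k
length-allVecs zero    = refl
length-allVecs (suc k) = trans (double (allVecs k)) (cong (2 *_) (length-allVecs k))
  where
  double : ∀ {k} (vs : List (Vec Bool k)) → length (concatMap bothBits vs) ≡ 2 * length vs
  double []       = refl
  double (v ∷ vs) = trans (cong (2 +_) (double vs)) (sym (*-suc 2 (length vs)))

map-val-allVecs : ∀ k → List.map val (allVecs k) ≡ List.iterate suc 0 (2 ^ k)
map-val-allVecs zero    = refl
map-val-allVecs (suc k) = begin
  List.map val (concatMap bothBits (allVecs k))
    ≡⟨ List.map-concatMap val bothBits (allVecs k) ⟩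
  concatMap (dbl ∘ val) (allVecs k)
    ≡⟨ List.concatMap-map dbl val (allVecs k) ⟨
  concatMap dbl (List.map val (allVecs k))
    ≡⟨ cong (concatMap dbl) (map-val-allVecs k) ⟩
  concatMap dbl (List.iterate suc 0 (2 ^ k))
    ≡⟨ double 0 (2 ^ k) ⟩
  List.iterate suc 0 (2 * 2 ^ k) ∎
  where
  open ≡-Reasoning
  dbl : ℕ → List ℕ
  dbl m = 2 * m ∷ suc (2 * m) ∷ []
  double : ∀ a n → concatMap dbl (List.iterate suc a n) ≡ List.iterate suc (2 * a) (2 * n)
  double a zero    = refl
  double a (suc n) = begin
    2 * a ∷ suc (2 * a) ∷ concatMap dbl (List.iterate suc (suc a) n)
      ≡⟨ cong (λ l → 2 * a ∷ suc (2 * a) ∷ l) (double (suc a) n) ⟩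
    2 * a ∷ suc (2 * a) ∷ List.iterate suc (2 * suc a) (2 * n)
      ≡⟨ cong (λ m → 2 * a ∷ suc (2 * a) ∷ List.iterate suc m (2 * n)) (*-suc 2 a) ⟩
    List.iterate suc (2 * a) (2 + 2 * n)
      ≡⟨ cong (List.iterate suc (2 * a)) (*-suc 2 n) ⟨
    List.iterate suc (2 * a) (2 * suc n) ∎

eqV : ∀ {k} → Vec Bool k → Vec Bool k → Bool
eqV []          []          = true
eqV (false ∷ v) (false ∷ w) = eqV v w
eqV (true ∷ v)  (true ∷ w)  = eqV v w
eqV (_ ∷ v)     (_ ∷ w)     = false

eqV-refl : ∀ {k} (v : Vec Bool k) → eqV v v ≡ true
eqV-refl []          = refl
eqV-refl (false ∷ v) = eqV-refl v
eqV-refl (true ∷ v)  = eqV-refl v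

eqV-sound : ∀ {k} (v w : Vec Bool k) → eqV v w ≡ true → v ≡ w
eqV-sound []          []          _  = refl
eqV-sound (false ∷ v) (false ∷ w) eq = cong (false ∷_) (eqV-sound v w eq)
eqV-sound (true ∷ v)  (true ∷ w)  eq = cong (true ∷_) (eqV-sound v w eq)

eqV-≢ : ∀ {k} {v w : Vec Bool k} → v ≢ w → eqV v w ≡ false
eqV-≢ {v = v} {w} v≢w with eqV v w in eq
... | false = refl
... | true  = ⊥-elim (v≢w (eqV-sound v w eq))

-- Formulae as straight-line programs

update-same : ∀ g x n → (g [ x ↦ n ]) x ≡ n
update-same g x n with x ≡ᵇ x | ≡⇒≡ᵇ x x refl
... | true | _ = refl

update-other : ∀ g {x y} n → y ≢ x → (g [ x ↦ n ]) y ≡ g y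
update-other g {x} {y} n y≢x with y ≡ᵇ x | ≡ᵇ⇒≡ y x
... | true  | eq = ⊥-elim (y≢x (eq tt))
... | false | _  = refl

iterate-suc : ∀ {A : Set} (f : A → A) x k → iterate f (f x) k ≡ f (iterate f x k)
iterate-suc f x zero    = refl
iterate-suc f x (suc k) = iterate-suc f (f x) k

iterate-+ : ∀ {A : Set} (f : A → A) x i j → iterate f x (i + j) ≡ iterate f (iterate f x i) j
iterate-+ f x zero    j = refl
iterate-+ f x (suc i) j = iterate-+ f (f x) i j

iterate-fixed : ∀ {A : Set} (f : A → A) {x} → f x ≡ x → ∀ k → iterate f x k ≡ x
iterate-fixed f fx≡x zero    = refl
iterate-fixed f fx≡x (suc k) = trans (cong (λ y → iterate f y k) fx≡x) (iterate-fixed f fx≡x k)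

-- By the pigeonhole principle two of the first `2 ^ w + 1` points of the orbit coincide, and
-- cutting out the segment between them shortens a longer way to `y`. This limits the number of
-- rounds that a program needs.
early-visit : ∀ {w} (f : Vec Bool w → Vec Bool w) {x y} t → iterate f x t ≡ y →
              ∃[ t′ ] t′ < 2 ^ w × iterate f x t′ ≡ y
early-visit {w} f {x} {y} t = go t t ≤-refl
  where
  go : ∀ fuel t → t ≤ fuel → iterate f x t ≡ y → ∃[ t′ ] t′ < 2 ^ w × iterate f x t′ ≡ y
  go fuel t t≤fuel eq with t <? 2 ^ w
  ... | yes t< = t , t< , eq
  ... | no t≮ with fuel | Fin.pigeonhole (n<1+n (2 ^ w))
                            (λ i → Fin.fromℕ< (val<2^ (iterate f x (toℕ i))))
  ...   | zero     | _ = ⊥-elim (t≮ (≤-trans (s≤s t≤fuel) (m^n>0 2 w)))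
  ...   | suc fuel | i , j , i<j , same = go fuel (toℕ i + s) (≤-pred (≤-trans shorter t≤fuel)) (begin
      iterate f x (toℕ i + s)               ≡⟨ iterate-+ f x (toℕ i) s ⟩
      iterate f (iterate f x (toℕ i)) s     ≡⟨ cong (λ z → iterate f z s) (val-injective _ _ same′) ⟩
      iterate f (iterate f x (toℕ j)) s     ≡⟨ iterate-+ f x (toℕ j) s ⟨
      iterate f x (toℕ j + s)               ≡⟨ cong (iterate f x) j+s≡t ⟩
      iterate f x t                         ≡⟨ eq ⟩
      y                                     ∎)
    where
    open ≡-Reasoning
    s = t ∸ toℕ j
    j+s≡t : toℕ j + s ≡ t
    j+s≡t = m+[n∸m]≡n (≤-trans (≤-pred (Fin.toℕ<n j)) (≮⇒≥ t≮))
    shorter : toℕ i + s < t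
    shorter = subst (toℕ i + s <_) j+s≡t (+-monoˡ-< s i<j)
    same′ : val (iterate f x (toℕ i)) ≡ val (iterate f x (toℕ j))
    same′ = begin
      val (iterate f x (toℕ i))                       ≡⟨ Fin.toℕ-fromℕ< _ ⟨
      toℕ (Fin.fromℕ< (val<2^ (iterate f x (toℕ i)))) ≡⟨ cong toℕ same ⟩
      toℕ (Fin.fromℕ< (val<2^ (iterate f x (toℕ j)))) ≡⟨ Fin.toℕ-fromℕ< _ ⟩
      val (iterate f x (toℕ j))                       ∎

_≟V_ : ∀ {k} (v w : Vec Bool k) → Dec (v ≡ w)
_≟V_ = Vec.≡-dec Bool._≟_

opSymbol : Bool → Symbol
opSymbol true  = `at
opSymbol false = `↓

module _ {k : ℕ} where

  -- Three idle zeros extend each digit to four symbols, the length of the header of a prefix.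
  oneHot : Vec Bool (suc k) → List Bool
  oneHot u = concatMap (λ o → false ∷ false ∷ false ∷ eqV o u ∷ []) (nonzeroVecs k)

  abstract

    -- The final `true` makes the word canonical, so that the variable is written with exactly these
    -- digits; the initial `false` becomes the fourth symbol of the header.
    name : Vec Bool (suc k) → SVAR
    name u = valL (false ∷ oneHot u ++ [ true ])

    bin-name : ∀ u → bin (name u) ≡ false ∷ oneHot u ++ [ true ]
    bin-name u = bin-valL (∷ʳ-true-canonical (false ∷ oneHot u))

  oneHot-≡ : ∀ {u v o} → oneHot u ≡ oneHot v → o ≢ zeros (suc k) → eqV o u ≡ eqV o v
  oneHot-≡ {u} {v} {o} eq o≢0 = go (nonzeroVecs k) eq (∈-nonzeroVecs o o≢0)
    where
    go : ∀ os → concatMap (λ o → false ∷ false ∷ false ∷ eqV o u ∷ []) os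
              ≡ concatMap (λ o → false ∷ false ∷ false ∷ eqV o v ∷ []) os → o ∈ₗ os → eqV o u ≡ eqV o v
    go (o ∷ os) eq (here refl) = List.∷-injectiveˡ (cong (List.drop 3) eq)
    go (o ∷ os) eq (there p)   = go os (cong (List.drop 4) eq) p

  -- A nonzero word marks its own digit in its one-hot notation and is found by it; the zero word is
  -- the only one to mark none.
  name-injective : ∀ {u v} → name u ≡ name v → u ≡ v
  name-injective {u} {v} eq with u ≟V zeros (suc k) | v ≟V zeros (suc k)
  ... | yes p | yes q = trans p (sym q)
  ... | no p  | _     = eqV-sound u v (trans (sym (oneHot-≡ same p)) (eqV-refl u))
    where
    same : oneHot u ≡ oneHot v
    same = List.∷ʳ-injectiveˡ _ _ (List.∷-injectiveʳ (trans (sym (bin-name u)) (trans (cong bin eq) (bin-name v))))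
  ... | yes _ | no q  = sym (eqV-sound v u (trans (oneHot-≡ same q) (eqV-refl v)))
    where
    same : oneHot u ≡ oneHot v
    same = List.∷ʳ-injectiveˡ _ _ (List.∷-injectiveʳ (trans (sym (bin-name u)) (trans (cong bin eq) (bin-name v))))

  name-≢ : ∀ {u v} → u ≢ v → name u ≢ name v
  name-≢ u≢v = u≢v ∘ name-injective

  -- (true , u) stands for the prefix at u, and (false , u) for ↓ u.

  Prefix : Set
  Prefix = Bool × Vec Bool (suc k)

  prefixed : List Prefix → Formula → Formula
  prefixed []                 φ = φ
  prefixed ((true  , u) ∷ ps) φ = at (name u) (prefixed ps φ)
  prefixed ((false , u) ∷ ps) φ = ↓ (name u) (prefixed ps φ)

  run : List Prefix → Assignment → ℕ → Assignment × ℕ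
  run []                 g n = g , n
  run ((true  , u) ∷ ps) g n = run ps g (g (name u))
  run ((false , u) ∷ ps) g n = run ps (g [ name u ↦ n ]) n

  run-++ : ∀ ps qs g n → run (ps ++ qs) g n ≡ run qs (proj₁ (run ps g n)) (proj₂ (run ps g n))
  run-++ []                 qs g n = refl
  run-++ ((true  , u) ∷ ps) qs g n = run-++ ps qs g _
  run-++ ((false , u) ∷ ps) qs g n = run-++ ps qs _ n

  ⊨-prefixed : ∀ ps φ g n → (g , n ⊨ prefixed ps φ) ≡ (proj₁ (run ps g n) , proj₂ (run ps g n) ⊨ φ)
  ⊨-prefixed []                 φ g n = refl
  ⊨-prefixed ((true  , u) ∷ ps) φ g n = ⊨-prefixed ps φ g _
  ⊨-prefixed ((false , u) ∷ ps) φ g n = ⊨-prefixed ps φ _ n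

  -- The final `1 of a variable is moved to the beginning of the next prefix.

  prefixWord : Prefix → List Symbol
  prefixWord (b , u) = `1 ∷ opSymbol b ∷ `x ∷ `0 ∷ List.map digit (oneHot u)

  writeVar-name : ∀ u ss → writeVar (name u) ++ ss ≡ `x ∷ `0 ∷ List.map digit (oneHot u) ++ `1 ∷ ss
  writeVar-name u ss = begin
    `x ∷ List.map digit (bin (name u)) ++ ss
      ≡⟨ cong (λ bs → `x ∷ List.map digit bs ++ ss) (bin-name u) ⟩
    `x ∷ `0 ∷ List.map digit (oneHot u ++ [ true ]) ++ ss
      ≡⟨ cong (λ l → `x ∷ `0 ∷ l ++ ss) (List.map-++ digit (oneHot u) [ true ]) ⟩
    `x ∷ `0 ∷ (List.map digit (oneHot u) ++ [ `1 ]) ++ ss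
      ≡⟨ cong (λ l → `x ∷ `0 ∷ l) (List.++-assoc (List.map digit (oneHot u)) [ `1 ] ss) ⟩
    `x ∷ `0 ∷ List.map digit (oneHot u) ++ `1 ∷ ss ∎
    where open ≡-Reasoning

  write-prefixed : ∀ ps φ → `1 ∷ write (prefixed ps φ) ≡ concatMap prefixWord ps ++ `1 ∷ write φ
  write-prefixed []                 φ = refl
  write-prefixed ((true  , u) ∷ ps) φ = trans
    (cong (λ l → `1 ∷ `at ∷ l) (trans (writeVar-name u _)
      (cong (λ l → `x ∷ `0 ∷ List.map digit (oneHot u) ++ l) (write-prefixed ps φ))))
    (sym (List.++-assoc (prefixWord (true , u)) _ _))
  write-prefixed ((false , u) ∷ ps) φ = trans
    (cong (λ l → `1 ∷ `↓ ∷ l) (trans (writeVar-name u _)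
      (cong (λ l → `x ∷ `0 ∷ List.map digit (oneHot u) ++ l) (write-prefixed ps φ))))
    (sym (List.++-assoc (prefixWord (false , u)) _ _))

  module _ (u₁ u₀ : Vec Bool (suc k) → Vec Bool (suc k)) (choice : Vec Bool (suc k) → Bool) where

    private
      R : Set
      R = Vec Bool (suc k)

    follow : R → R
    follow c = if choice c then u₁ c else u₀ c

    -- The last prefix stores the value of u₀ c in c if `choice c` is
    -- false, and does nothing otherwise.

    copy : R → List Prefix
    copy c = (true , u₁ c) ∷ (false , c) ∷ (true , u₀ c) ∷ (choice c , c) ∷ []

    -- Here `↓` takes the place of `@ (u₁ zeros)`: it stores in acc, the variable of `zeros`, the
    -- point which `□` ranges over.
    firstCopy : List Prefix
    firstCopy = (false , zeros (suc k)) ∷ List.drop 1 (copy (zeros (suc k)))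

    -- The fourth prefix gives way to the final variable, which is evaluated at the value of
    -- `u₀ ones`, later the initial configuration.
    lastCopy : List Prefix
    lastCopy = List.take 3 (copy (ones (suc k)))

    prefixes : List R → List Prefix
    prefixes cs = firstCopy ++ concatMap copy cs ++ lastCopy

    programFormula : List R → Formula
    programFormula cs = □ prefixed (prefixes cs) (var (name (zeros (suc k))))

    copy-other : ∀ {c d} g n → d ≢ c → proj₁ (run (copy c) g n) (name d) ≡ g (name d)
    copy-other {c} {d} g n d≢c with choice c
    ... | true  = update-other g _ (name-≢ d≢c)
    ... | false = trans (update-other _ _ (name-≢ d≢c)) (update-other g _ (name-≢ d≢c))

    -- If `choice c` is false, `u₀ c` is read only after `c` has received the value of `u₁ c`. That
    -- matters only for `u₀ c ≡ c`, and then the hypothesis says that the value received was that of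
    -- `c` itself.
    copy-same : ∀ c g n → (follow c ≡ c → u₁ c ≡ c) → proj₁ (run (copy c) g n) (name c) ≡ g (name (follow c))
    copy-same c g n loop with choice c
    ... | true = update-same g (name c) (g (name (u₁ c)))
    ... | false with u₀ c ≟V c
    ...   | no p  = trans (update-same (g [ name c ↦ g (name (u₁ c)) ]) (name c) _)
                           (update-other g (g (name (u₁ c))) (name-≢ p))
    ...   | yes p = begin
      (_ [ name c ↦ (g [ name c ↦ g (name (u₁ c)) ]) (name (u₀ c)) ]) (name c)
        ≡⟨ update-same _ (name c) _ ⟩
      (g [ name c ↦ g (name (u₁ c)) ]) (name (u₀ c))
        ≡⟨ cong (λ d → (g [ name c ↦ g (name (u₁ c)) ]) (name d)) p ⟩
      (g [ name c ↦ g (name (u₁ c)) ]) (name c)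
        ≡⟨ update-same g (name c) _ ⟩
      g (name (u₁ c)) ≡⟨ cong (g ∘ name) (trans (loop p) (sym p)) ⟩
      g (name (u₀ c)) ∎
      where open ≡-Reasoning

    module Accepting (zeros-u₁ : u₁ (zeros (suc k)) ≡ zeros (suc k))
                     (zeros-u₀ : u₀ (zeros (suc k)) ≡ zeros (suc k)) (v : ℕ) where

      zeros-next : follow (zeros (suc k)) ≡ zeros (suc k)
      zeros-next with choice (zeros (suc k))
      ... | true  = zeros-u₁
      ... | false = zeros-u₀

      -- As `zeros` is a fixed point, being there after `r` steps is the same as arriving within `r`
      -- steps.
      Within : ℕ → R → Set
      Within r c = iterate follow c r ≡ zeros (suc k)

      Good : ℕ → Assignment → Set
      Good r g = ∀ c → Within r c → g (name c) ≡ v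

      within-next : ∀ r {c} → Within r c → Within r (follow c)
      within-next r {c} w = trans (iterate-suc follow c r) (trans (cong follow w) zeros-next)

      loop : ∀ r {c} → Within r c → follow c ≡ c → u₁ c ≡ c
      loop r {c} w eq with trans (sym (iterate-fixed follow eq r)) w
      ... | refl = zeros-u₁

      copy-step : ∀ r d {c} g n → Good r g → Within (suc r) c → g (name c) ≡ v ⊎ c ≡ d →
                  proj₁ (run (copy d) g n) (name c) ≡ v
      copy-step r d {c} g n good w p with c ≟V d | p
      ... | yes refl | _        = trans (copy-same c g n (loop (suc r) w)) (good (follow c) w)
      ... | no c≢d   | inj₁ q   = trans (copy-other g n c≢d) q
      ... | no c≢d   | inj₂ c≡d = ⊥-elim (c≢d c≡d)

      copy-good : ∀ r d g n → Good r g → Good r (proj₁ (run (copy d) g n))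
      copy-good r d g n good c w = copy-step r d g n good (within-next r w) (inj₁ (good c w))

      -- Each configuration in `ds` receives `v` if its successor arrives within `r` steps. What
      -- already holds `v` keeps it, because a configuration that arrives within `r` steps has a
      -- successor that does so too. Hence each complete round gains one step.
      copies-step : ∀ r ds g n → Good r g → let g′ = proj₁ (run (concatMap copy ds) g n) in
                    Good r g′ × (∀ c → Within (suc r) c → g (name c) ≡ v ⊎ c ∈ₗ ds → g′ (name c) ≡ v)
      copies-step r [] g n good = good , λ { c _ (inj₁ p) → p }
      copies-step r (d ∷ ds) g n good
        rewrite run-++ (copy d) (concatMap copy ds) g n
        with copies-step r ds (proj₁ (run (copy d) g n)) (proj₂ (run (copy d) g n)) (copy-good r d g n good)
      ... | good′ , rest = good′ , λ
        { c w (inj₁ p)         → rest c w (inj₁ (copy-step r d g n good w (inj₁ p)))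
        ; c w (inj₂ (here p))  → rest c w (inj₁ (copy-step r d g n good w (inj₂ p)))
        ; c w (inj₂ (there p)) → rest c w (inj₂ p) }

      rounds : ∀ {A : Set} (xs : List A) r g n → Good r g →
               Good (length xs + r) (proj₁ (run (concatMap copy (concatMap (λ _ → allVecs (suc k)) xs)) g n))
      rounds []       r g n good = good
      rounds (x ∷ xs) r g n good
        rewrite List.concatMap-++ copy (allVecs (suc k)) (concatMap (λ _ → allVecs (suc k)) xs)
              | run-++ (concatMap copy (allVecs (suc k))) (concatMap copy (concatMap (λ _ → allVecs (suc k)) xs)) g n
        = let s = run (concatMap copy (allVecs (suc k))) g n
              s′ = run (concatMap copy (concatMap (λ _ → allVecs (suc k)) xs)) (proj₁ s) (proj₂ s)
          in subst (λ l → Good l (proj₁ s′)) (+-suc (length xs) r)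
               (rounds xs (suc r) (proj₁ s) (proj₂ s)
                 λ c w → proj₂ (copies-step r (allVecs (suc k)) g n good) c w (inj₂ (∈-allVecs c)))

      afterFirst : Assignment → Assignment
      afterFirst g = proj₁ (run firstCopy g v)

      first-good : ∀ g → Good 0 (afterFirst g)
      -- As `u₁` fixes `zeros`, the missing `@ (u₁ zeros)` would lead to the point `v`, where the
      -- program already is. So the rest acts like a whole block started with `v` in `zeros`.
      first-good g c refl = subst (λ m → proj₁ (run (List.drop 1 (copy c)) g₀ m) (name c) ≡ v) value
        (copy-good 0 c g₀ v (λ { _ refl → update-same g (name c) v }) c refl)
        where
        g₀ = g [ name c ↦ v ]
        value : g₀ (name (u₁ c)) ≡ v
        value = trans (cong (g₀ ∘ name) zeros-u₁) (update-same g (name c) v)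

    module Rejecting (rej : R) (rej-u₁ : u₁ rej ≡ rej) (rej-u₀ : u₀ rej ≡ rej) where

      rej-next : follow rej ≡ rej
      rej-next with choice rej
      ... | true  = rej-u₁
      ... | false = rej-u₀

      Rejects : R → Set
      Rejects c = ∃[ r ] iterate follow c r ≡ rej

      rejects-next : ∀ {c} → Rejects c → Rejects (follow c)
      rejects-next {c} (r , eq) = r , trans (iterate-suc follow c r) (trans (cong follow eq) rej-next)

      loop : ∀ {c} → Rejects c → follow c ≡ c → u₁ c ≡ c
      loop (r , w) eq with trans (sym (iterate-fixed follow eq r)) w
      ... | refl = rej-u₁

      Agree : Assignment → Assignment → Set
      Agree g h = ∀ c → Rejects c → g (name c) ≡ h (name c)

      -- Values only flow from successors, and the successor of a rejecting configuration is
      -- rejecting. So what the rejecting configurations hold does not depend on the points `m` and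
      -- `n` at which the block is entered.
      copy-agree : ∀ d g h m n → Agree g h → Agree (proj₁ (run (copy d) g m)) (proj₁ (run (copy d) h n))
      copy-agree d g h m n agree c r with c ≟V d
      ... | yes refl = trans (copy-same c g m (loop r)) (trans (agree (follow c) (rejects-next r)) (sym (copy-same c h n (loop r))))
      ... | no c≢d   = trans (copy-other g m c≢d) (trans (agree c r) (sym (copy-other h n c≢d)))

      copies-agree : ∀ ds g h m n → Agree g h →
                     Agree (proj₁ (run (concatMap copy ds) g m)) (proj₁ (run (concatMap copy ds) h n))
      copies-agree []       g h m n agree = agree
      copies-agree (d ∷ ds) g h m n agree
        rewrite run-++ (copy d) (concatMap copy ds) g m | run-++ (copy d) (concatMap copy ds) h n
        = copies-agree ds (proj₁ (run (copy d) g m)) (proj₁ (run (copy d) h n)) _ _ (copy-agree d g h m n agree)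

    finalPoint : ∀ cs g n → Assignment
    finalPoint cs g n = proj₁ (run (concatMap copy cs) (proj₁ (run firstCopy g n)) (proj₂ (run firstCopy g n)))

    module _ (start-u₁ : u₁ (ones (suc k)) ≡ u₀ (ones (suc k))) where

      -- The last block leads to the point held by `u₀ ones`; there the variable acc is true iff it
      -- holds the same number.
      ⊨-programFormula : ∀ cs g n → let h = finalPoint cs g n in
        (g , n ⊨ prefixed (prefixes cs) (var (name (zeros (suc k))))) ≡
        (h (name (zeros (suc k))) ≡ h (name (u₀ (ones (suc k)))))
      ⊨-programFormula cs g n = begin
        (g , n ⊨ prefixed (prefixes cs) φ)
          ≡⟨ ⊨-prefixed (prefixes cs) φ g n ⟩
        Final (run (prefixes cs) g n)
          ≡⟨ cong Final (run-++ firstCopy (concatMap copy cs ++ lastCopy) g n) ⟩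
        Final (run (concatMap copy cs ++ lastCopy) _ _)
          ≡⟨ cong Final (run-++ (concatMap copy cs) lastCopy _ _) ⟩
        ((h [ name (ones (suc k)) ↦ h (name (u₁ (ones (suc k)))) ]) (name (zeros (suc k))) ≡
         (h [ name (ones (suc k)) ↦ h (name (u₁ (ones (suc k)))) ]) (name (u₀ (ones (suc k)))))
          ≡⟨ cong₂ _≡_ (update-other h _ (name-≢ λ ())) init-value ⟩
        (h (name (zeros (suc k))) ≡ h (name (u₀ (ones (suc k))))) ∎
        where
        open ≡-Reasoning
        φ = var (name (zeros (suc k)))
        h = finalPoint cs g n
        Final : Assignment × ℕ → Set
        Final (h , m) = h , m ⊨ φ
        init-value : (h [ name (ones (suc k)) ↦ h (name (u₁ (ones (suc k)))) ]) (name (u₀ (ones (suc k))))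
                     ≡ h (name (u₀ (ones (suc k))))
        v = h (name (u₁ (ones (suc k))))
        init-value with u₀ (ones (suc k)) ≟V ones (suc k)
        ... | no p  = update-other h _ (name-≢ p)
        -- If `u₀ ones` is `ones`, it has just been overwritten, but by `start-u₁` with its own
        -- value.
        ... | yes p = trans (cong (λ c → (h [ name (ones (suc k)) ↦ v ]) (name c)) p)
                        (trans (update-same h (name (ones (suc k))) v) (cong (h ∘ name) start-u₁))

      module _ (zeros-u₁ : u₁ (zeros (suc k)) ≡ zeros (suc k))
               (zeros-u₀ : u₀ (zeros (suc k)) ≡ zeros (suc k)) where

        -- The first round has no block for zeros, which is unnecessary, and
        -- the last one no block for ones.

        programFormula-sat : ∀ {A : Set} (xs : List A) r → r ≤ length xs →
          iterate follow (u₀ (ones (suc k))) r ≡ zeros (suc k) →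
          Satisfiable (programFormula
            (nonzeroVecs k ++ concatMap (λ _ → allVecs (suc k)) xs ++ zeros (suc k) ∷ properVecs k))
        programFormula-sat xs r r≤ w = (λ _ → 0) , 0 , λ v _ →
          let open Accepting zeros-u₁ zeros-u₀ v
              s  = run firstCopy (λ _ → 0) v
              s₁ = run (concatMap copy (nonzeroVecs k)) (proj₁ s) (proj₂ s)
              s₂ = run (concatMap copy L) (proj₁ s₁) (proj₂ s₁)
              good₁ : Good 0 (proj₁ s₁)
              good₁ = proj₁ (copies-step 0 (nonzeroVecs k) (proj₁ s) (proj₂ s) (first-good (λ _ → 0)))
              good₂ : Good (length xs) (proj₁ s₂)
              good₂ = subst (λ l → Good l (proj₁ s₂)) (+-identityʳ (length xs)) (rounds xs 0 (proj₁ s₁) (proj₂ s₁) good₁)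
              good : Good (length xs) (finalPoint cs (λ _ → 0) v)
              good = subst (Good (length xs)) (sym (split (λ _ → 0) v))
                (proj₁ (copies-step (length xs) (zeros (suc k) ∷ properVecs k) (proj₁ s₂) (proj₂ s₂) good₂))
          in subst id (sym (⊨-programFormula cs (λ _ → 0) v))
               (trans (good (zeros (suc k)) (iterate-fixed follow zeros-next (length xs)))
                 (sym (good (u₀ (ones (suc k))) (trans (cong (iterate follow (u₀ (ones (suc k)))) (sym (m+[n∸m]≡n r≤)))
                    (trans (iterate-+ follow _ r (length xs ∸ r))
                      (trans (cong (λ c → iterate follow c (length xs ∸ r)) w) (iterate-fixed follow zeros-next (length xs ∸ r))))))))
          where
          L = concatMap (λ _ → allVecs (suc k)) xs
          cs = nonzeroVecs k ++ L ++ zeros (suc k) ∷ properVecs k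
          split : ∀ g n → let s  = run firstCopy g n
                              s₁ = run (concatMap copy (nonzeroVecs k)) (proj₁ s) (proj₂ s)
                              s₂ = run (concatMap copy L) (proj₁ s₁) (proj₂ s₁) in
                  finalPoint cs g n ≡ proj₁ (run (concatMap copy (zeros (suc k) ∷ properVecs k)) (proj₁ s₂) (proj₂ s₂))
          split g n = cong proj₁ (trans
            (cong (λ l → run l _ (proj₂ s)) (trans (List.concatMap-++ copy (nonzeroVecs k) _)
              (cong (concatMap copy (nonzeroVecs k) ++_) (List.concatMap-++ copy L (zeros (suc k) ∷ properVecs k)))))
            (trans (run-++ (concatMap copy (nonzeroVecs k)) _ _ _) (run-++ (concatMap copy L) _ _ _)))
            where s = run firstCopy g n

        programFormula-unsat : ∀ cs {rej} → u₁ rej ≡ rej → u₀ rej ≡ rej → rej ≢ zeros (suc k) → ∀ r →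
          iterate follow (u₀ (ones (suc k))) r ≡ rej → ¬ Satisfiable (programFormula cs)
        programFormula-unsat cs {rej} rej-u₁ rej-u₀ rej≢0 r w (g , n , sat) =
          -- Two points suffice: started at `suc n` and at `2 + n`, the program ends with different
          -- numbers in acc, while the rejecting `u₀ ones` holds the same number after both runs.
          1+n≢n (sym (begin
            suc n ≡⟨ acc-value (suc n) ⟨
            h (suc n) (name (zeros (suc k))) ≡⟨ subst id (⊨-programFormula cs g (suc n)) (sat (suc n) ≤-refl) ⟩
            h (suc n) (name (u₀ (ones (suc k)))) ≡⟨ agree (u₀ (ones (suc k))) (r , w) ⟩
            h (2 + n) (name (u₀ (ones (suc k)))) ≡⟨ subst id (⊨-programFormula cs g (2 + n)) (sat (2 + n) (n≤1+n _)) ⟨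
            h (2 + n) (name (zeros (suc k))) ≡⟨ acc-value (2 + n) ⟩
            2 + n ∎))
          where
          open ≡-Reasoning
          open Rejecting rej rej-u₁ rej-u₀
          h : ℕ → Assignment
          h = finalPoint cs g
          acc-value : ∀ v → h v (name (zeros (suc k))) ≡ v
          acc-value v = proj₁ (copies-step 0 cs (afterFirst g) _ (first-good g)) (zeros (suc k)) refl
            where open Accepting zeros-u₁ zeros-u₀ v
          not-zeros : ∀ {c} → Rejects c → c ≢ zeros (suc k)
          not-zeros (s , eq) refl = rej≢0 (trans (sym eq) (iterate-fixed follow zeros-next s))
            where open Accepting zeros-u₁ zeros-u₀ 0
          first-agree : ∀ m n → Agree (proj₁ (run firstCopy g m)) (proj₁ (run firstCopy g n))
          first-agree m n c r = trans (first-other m) (sym (first-other n))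
            where
            first-other : ∀ m → proj₁ (run firstCopy g m) (name c) ≡ g (name c)
            first-other m = trans (copy-other′ (choice (zeros (suc k))))
                              (trans (update-other (g [ name (zeros (suc k)) ↦ m ]) m (name-≢ (not-zeros r)))
                                (update-other g m (name-≢ (not-zeros r))))
              where
              copy-other′ : ∀ b {h m} → proj₁ (run ((b , zeros (suc k)) ∷ []) h m) (name c) ≡ h (name c)
              copy-other′ true          = refl
              copy-other′ false {h} {m} = update-other h m (name-≢ (not-zeros r))
          agree : Agree (h (suc n)) (h (2 + n))
          agree = copies-agree cs (proj₁ (run firstCopy g (suc n))) (proj₁ (run firstCopy g (2 + n))) _ _
                    (first-agree (suc n) (2 + n))

-- The symbols of a program

take-++ : ∀ {A : Set} {m n} (xs : Vec A m) (ys : Vec A n) → Vec.take m (xs Vec.++ ys) ≡ xs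
take-++ []       ys = refl
take-++ (x ∷ xs) ys = cong (x ∷_) (take-++ xs ys)

drop-++ : ∀ {A : Set} {m n} (xs : Vec A m) (ys : Vec A n) → Vec.drop m (xs Vec.++ ys) ≡ ys
drop-++ []       ys = refl
drop-++ (x ∷ xs) ys = drop-++ xs ys

take-replicate : ∀ {A : Set} m n (x : A) → Vec.take m (Vec.replicate (m + n) x) ≡ Vec.replicate m x
take-replicate zero    n x = refl
take-replicate (suc m) n x = cong (x ∷_) (take-replicate m n x)

replicate-++ : ∀ {A : Set} m {k} (a : A) → Vec.replicate m a Vec.++ Vec.replicate k a ≡ Vec.replicate (m + k) a
replicate-++ zero    a = refl
replicate-++ (suc m) a = cong (a ∷_) (replicate-++ m a)

pick : ∀ {A : Set} → Bool → Bool → Vec A 4 → A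
pick false false (a ∷ b ∷ c ∷ d ∷ []) = a
pick true  false (a ∷ b ∷ c ∷ d ∷ []) = b
pick false true  (a ∷ b ∷ c ∷ d ∷ []) = c
pick true  true  (a ∷ b ∷ c ∷ d ∷ []) = d

code : Symbol → Vec Bool 4
code s = Vec.tabulate λ i → nth (toℕ i) (symbolCode s)
  where
  nth : ℕ → List Bool → Bool
  nth _       []       = false
  nth zero    (b ∷ _)  = b
  nth (suc i) (_ ∷ bs) = nth i bs

toList-code : ∀ s → Vec.toList (code s) ≡ symbolCode s
toList-code `x  = refl
toList-code `0  = refl
toList-code `1  = refl
toList-code `⊤  = refl
toList-code `⊥  = refl
toList-code `∧  = refl
toList-code `∨  = refl
toList-code `□  = refl
toList-code `↓  = refl
toList-code `at = refl
toList-code `lp = refl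
toList-code `rp = refl

-- The first four symbols of a quarter of a block. The very first quarter begins
-- the formula, and in the very last one a variable takes the place of a
-- prefix.

header : Vec Bool 2 → (first last op : Bool) → Vec Symbol 4
header (false ∷ false ∷ []) true  _     _  = `□ ∷ `↓ ∷ `x ∷ `0 ∷ []
header (false ∷ false ∷ []) false _     _  = `1 ∷ `at ∷ `x ∷ `0 ∷ []
header (true  ∷ false ∷ []) _     _     _  = `1 ∷ `↓ ∷ `x ∷ `0 ∷ []
header (false ∷ true  ∷ []) _     _     _  = `1 ∷ `at ∷ `x ∷ `0 ∷ []
header (true  ∷ true  ∷ []) _     false op = `1 ∷ opSymbol op ∷ `x ∷ `0 ∷ []
header (true  ∷ true  ∷ []) _     true  _  = `1 ∷ `x ∷ `0 ∷ `0 ∷ []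

group : (first last isZero isEqual : Bool) → Vec Bool 2 → Bool → Vec Symbol 4
group first last true  _  h op = header h first last op
group first last false eq h op = `0 ∷ `0 ∷ `0 ∷ digit eq ∷ []

wordBit : (first last isZero isEqual : Bool) → Vec Bool 2 → Vec Bool 4 → Bool → Bool
wordBit first last z eq h (s₀ ∷ s₁ ∷ e₀ ∷ e₁ ∷ []) op =
  pick s₀ s₁ (code (pick e₀ e₁ (group first last z eq h op)))

-- Of the codes of `↓` and `@`, the latter has the additional bit set, so raising `op` can only
-- raise a bit of the word. Hence the circuit needs no negated inputs.
wordBit-mono : ∀ first last z eq h lo →
               wordBit first last z eq h lo false ≡ true → wordBit first last z eq h lo true ≡ true
wordBit-mono first last false eq h (s₀ ∷ s₁ ∷ e₀ ∷ e₁ ∷ []) p = p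
wordBit-mono true  last  true eq (false ∷ false ∷ []) (s₀ ∷ s₁ ∷ e₀ ∷ e₁ ∷ []) p = p
wordBit-mono false last  true eq (false ∷ false ∷ []) (s₀ ∷ s₁ ∷ e₀ ∷ e₁ ∷ []) p = p
wordBit-mono first last  true eq (true  ∷ false ∷ []) (s₀ ∷ s₁ ∷ e₀ ∷ e₁ ∷ []) p = p
wordBit-mono first last  true eq (false ∷ true  ∷ []) (s₀ ∷ s₁ ∷ e₀ ∷ e₁ ∷ []) p = p
wordBit-mono first true  true eq (true  ∷ true  ∷ []) (s₀ ∷ s₁ ∷ e₀ ∷ e₁ ∷ []) p = p
wordBit-mono first false true eq (true  ∷ true  ∷ []) (s₀ ∷ s₁ ∷ false ∷ false ∷ []) p = p
wordBit-mono first false true eq (true  ∷ true  ∷ []) (s₀ ∷ s₁ ∷ false ∷ true  ∷ []) p = p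
wordBit-mono first false true eq (true  ∷ true  ∷ []) (s₀ ∷ s₁ ∷ true  ∷ true  ∷ []) p = p
wordBit-mono first false true eq (true  ∷ true  ∷ []) (false ∷ false ∷ true  ∷ false ∷ []) p = refl
wordBit-mono first false true eq (true  ∷ true  ∷ []) (s₀ ∷ true ∷ true  ∷ false ∷ []) p = ⊥-elim (low s₀ p)
  where
  low : ∀ s₀ → pick s₀ true (code `↓) ≢ true
  low false ()
  low true  ()

-- The fields of a position of the word, beginning with the low-order bits.

fields : ∀ w {A : Set} → (Vec Bool 4 → Vec Bool w → Vec Bool 2 → Vec Bool (w + w) → A) →
         Vec Bool (4 + (w + (2 + (w + w)))) → A
fields w f p = f (Vec.take 4 p) (Vec.take w p₁) (Vec.take 2 p₂) (Vec.drop 2 p₂)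
  where
  p₁ = Vec.drop 4 p
  p₂ = Vec.drop w p₁

fields-++ : ∀ w {A : Set} f lo o h b → fields w {A} f (lo Vec.++ (o Vec.++ (h Vec.++ b))) ≡ f lo o h b
fields-++ w f lo o h b
  rewrite take-++ lo (o Vec.++ (h Vec.++ b)) | drop-++ lo (o Vec.++ (h Vec.++ b))
        | take-++ o (h Vec.++ b) | drop-++ o (h Vec.++ b)
        | take-++ h b | drop-++ h b = refl

-- The number of a block is made up of a configuration, in the low half, and a round, in the high
-- half.
properBlocks : ∀ k → List (Vec Bool (suc k))
properBlocks k = List.map (Vec.take (suc k)) (properVecs (k + suc k))

module _ {k : ℕ} where

  private
    w : ℕ
    w = suc k
    R : Set
    R = Vec Bool w

  target : (u₁ u₀ : R → R) → Vec Bool 2 → R → R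
  target u₁ u₀ (false ∷ false ∷ []) c = u₁ c
  target u₁ u₀ (false ∷ true  ∷ []) c = u₀ c
  target u₁ u₀ (true  ∷ _     ∷ []) c = c

  module _ (u₁ u₀ : R → R) (choice : R → Bool) where

    groupAt : R → Vec Bool 2 → Vec Bool (w + w) → Vec Symbol 4
    groupAt o h b = group (eqV b (zeros (w + w))) (eqV b (ones (w + w))) (eqV o (zeros w))
                          (eqV o (target u₁ u₀ h (Vec.take w b))) h (choice (Vec.take w b))

    bitAt : Vec Bool 4 → R → Vec Bool 2 → Vec Bool (w + w) → Bool
    bitAt lo o h b = wordBit (eqV b (zeros (w + w))) (eqV b (ones (w + w))) (eqV o (zeros w))
                             (eqV o (target u₁ u₀ h (Vec.take w b))) h lo (choice (Vec.take w b))

    quarterWord : Vec Bool 2 → Vec Bool (w + w) → List Symbol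
    quarterWord h b = concatMap (λ o → Vec.toList (groupAt o h b)) (allVecs w)

    blockWord : Vec Bool (w + w) → List Symbol
    blockWord b = concatMap (λ h → quarterWord h b) (allVecs 2)

    -- Each level of the nesting, from the rounds down to the bits of a symbol, is one field of the
    -- position.
    encode-blocks : concatMap symbolCode (concatMap blockWord (allVecs (w + w))) ≡
                    List.map (fields w bitAt) (allVecs (4 + (w + (2 + (w + w)))))
    encode-blocks = begin
      concatMap symbolCode (concatMap blockWord (allVecs (w + w)))
        ≡⟨ concatMap-concatMap symbolCode blockWord (allVecs (w + w)) ⟩
      concatMap (concatMap symbolCode ∘ blockWord) (allVecs (w + w))
        ≡⟨ List.concatMap-cong (λ b → trans (concatMap-concatMap symbolCode (λ h → quarterWord h b) (allVecs 2))
             (List.concatMap-cong (λ h → trans (concatMap-concatMap symbolCode (λ o → Vec.toList (groupAt o h b)) (allVecs w))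
               (List.concatMap-cong (λ o → groupCode o h b) (allVecs w))) (allVecs 2))) (allVecs (w + w)) ⟩
      concatMap (λ b → concatMap (λ h → concatMap (λ o → List.map (λ lo → bitAt lo o h b) (allVecs 4)) (allVecs w))
                         (allVecs 2)) (allVecs (w + w))
        ≡⟨ List.concatMap-cong (λ b → List.concatMap-cong (λ h → List.concatMap-cong (λ o →
             List.map-cong (λ lo → sym (fields-++ w bitAt lo o h b)) (allVecs 4)) (allVecs w)) (allVecs 2)) (allVecs (w + w)) ⟩
      concatMap (λ b → concatMap (λ h → concatMap (λ o → List.map (λ lo → F (lo Vec.++ (o Vec.++ (h Vec.++ b)))) (allVecs 4))
                         (allVecs w)) (allVecs 2)) (allVecs (w + w))
        ≡⟨ concatMap-allVecs-+ 2 (w + w) (λ hb → concatMap (λ o → List.map (λ lo → F (lo Vec.++ (o Vec.++ hb))) (allVecs 4)) (allVecs w)) ⟨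
      concatMap (λ hb → concatMap (λ o → List.map (λ lo → F (lo Vec.++ (o Vec.++ hb))) (allVecs 4)) (allVecs w)) (allVecs (2 + (w + w)))
        ≡⟨ concatMap-allVecs-+ w (2 + (w + w)) (λ ohb → List.map (λ lo → F (lo Vec.++ ohb)) (allVecs 4)) ⟨
      concatMap (λ ohb → List.map (λ lo → F (lo Vec.++ ohb)) (allVecs 4)) (allVecs (w + (2 + (w + w))))
        ≡⟨ map-allVecs-+ 4 (w + (2 + (w + w))) F ⟨
      List.map F (allVecs (4 + (w + (2 + (w + w))))) ∎
      where
      open ≡-Reasoning
      F : Vec Bool (4 + (w + (2 + (w + w)))) → Bool
      F = fields w bitAt
      codes : ∀ (ss : Vec Symbol 4) →
        concatMap symbolCode (Vec.toList ss) ≡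
        List.map (λ { (s₀ ∷ s₁ ∷ e₀ ∷ e₁ ∷ []) → pick s₀ s₁ (code (pick e₀ e₁ ss)) }) (allVecs 4)
      codes (a ∷ b ∷ c ∷ d ∷ []) rewrite sym (toList-code a) | sym (toList-code b)
                                       | sym (toList-code c) | sym (toList-code d) = refl
      groupCode : ∀ o h b → concatMap symbolCode (Vec.toList (groupAt o h b)) ≡ List.map (λ lo → bitAt lo o h b) (allVecs 4)
      groupCode o h b = codes (groupAt o h b)

    module _ (zeros-u₁ : u₁ (zeros w) ≡ zeros w) where

      digits : R → List Symbol
      digits u = List.map digit (oneHot u)

      nonzeroGroups : ∀ first last op h u →
        concatMap (λ o → Vec.toList (group first last (eqV o (zeros w)) (eqV o u) h op)) (nonzeroVecs k) ≡ digits u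
      nonzeroGroups first last op h u = go (nonzeroVecs-nonzero k)
        where
        go : ∀ {os} → All (_≢ zeros w) os →
             concatMap (λ o → Vec.toList (group first last (eqV o (zeros w)) (eqV o u) h op)) os ≡
             List.map digit (concatMap (λ o → false ∷ false ∷ false ∷ eqV o u ∷ []) os)
        go []                = refl
        go (o≢0 ∷ os≢0) rewrite eqV-≢ o≢0 = cong (λ l → `0 ∷ `0 ∷ `0 ∷ _ ∷ l) (go os≢0)

      quarterWord-≡ : ∀ h b → quarterWord h b ≡
        Vec.toList (header h (eqV b (zeros (w + w))) (eqV b (ones (w + w))) (choice (Vec.take w b))) ++
        digits (target u₁ u₀ h (Vec.take w b))
      quarterWord-≡ h b rewrite allVecs-suc k | eqV-refl (zeros k) =
        cong (Vec.toList (header h _ _ _) ++_) (nonzeroGroups _ _ _ h _)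

      blockWord-≡ : ∀ b → blockWord b ≡
        let first = eqV b (zeros (w + w)); last = eqV b (ones (w + w)); c = Vec.take w b
            half = λ h → Vec.toList (header h first last (choice c)) ++ digits (target u₁ u₀ h c)
        in half (false ∷ false ∷ []) ++ half (true ∷ false ∷ []) ++ half (false ∷ true ∷ []) ++ half (true ∷ true ∷ [])
      blockWord-≡ b rewrite quarterWord-≡ (false ∷ false ∷ []) b | quarterWord-≡ (true ∷ false ∷ []) b
                          | quarterWord-≡ (false ∷ true ∷ []) b | quarterWord-≡ (true ∷ true ∷ []) b
                          | List.++-identityʳ (Vec.toList (header (true ∷ true ∷ []) (eqV b (zeros (w + w))) (eqV b (ones (w + w)))
                                                (choice (Vec.take w b))) ++ digits (Vec.take w b)) = refl

      blockWord-proper : ∀ {b} → Proper b → blockWord b ≡ concatMap prefixWord (copy u₁ u₀ choice (Vec.take w b))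
      blockWord-proper {b} (p , q) rewrite blockWord-≡ b | eqV-≢ p | eqV-≢ q =
        cong (λ l → prefixWord (true , u₁ c) ++ prefixWord (false , c) ++ prefixWord (true , u₀ c) ++ l)
          (sym (List.++-identityʳ (prefixWord (choice c , c))))
        where c = Vec.take w b

      -- With `□` replaced by the closing 1 of an imaginary variable before it, the first block is a
      -- sequence of prefix words like the others. As `u₁` fixes `zeros`, the digits in its first
      -- quarter are those of acc.
      blockWord-zeros : `1 ∷ List.drop 1 (blockWord (zeros (w + w))) ≡ concatMap prefixWord (firstCopy u₁ u₀ choice)
      blockWord-zeros rewrite blockWord-≡ (zeros (w + w)) | eqV-refl (zeros (w + w)) | take-replicate w w false
                            | zeros-u₁ | eqV-≢ {v = zeros (w + w)} {ones (w + w)} (λ ()) =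
        cong (λ l → prefixWord (false , zeros w) ++ prefixWord (false , zeros w) ++ prefixWord (true , u₀ (zeros w)) ++ l)
          (sym (List.++-identityʳ (prefixWord (choice (zeros w) , zeros w))))

      -- The final variable has no operator symbol, so it begins one place early and an additional 0
      -- fills the header. In exchange the last digit of `ones`, a 1, serves as the closing 1 of
      -- acc. All other digits of both words are 0.
      digits-ones : `0 ∷ digits (ones w) ≡ digits (zeros w) ++ [ `1 ]
      digits-ones = trans (cong (λ l → `0 ∷ List.map digit l)
                            (List.concatMap-++ _ (properVecs k) (ones w ∷ [])))
                      (trans (go (properVecs-proper k))
                        (cong (λ l → List.map digit l ++ [ `1 ]) (sym (List.concatMap-++ _ (properVecs k) (ones w ∷ [])))))
        where
        f : R → R → List Bool
        f u o = false ∷ false ∷ false ∷ eqV o u ∷ []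
        go : ∀ {os} → All Proper os → `0 ∷ List.map digit (concatMap (f (ones w)) os ++ f (ones w) (ones w) ++ []) ≡
             List.map digit (concatMap (f (zeros w)) os ++ f (zeros w) (ones w) ++ []) ++ [ `1 ]
        go [] rewrite eqV-refl (ones k) = refl
        go ((p , q) ∷ ps) rewrite eqV-≢ p | eqV-≢ q = cong (λ l → `0 ∷ `0 ∷ `0 ∷ `0 ∷ l) (go ps)

      blockWord-ones : blockWord (ones (w + w)) ≡
                       concatMap prefixWord (lastCopy u₁ u₀ choice) ++ `1 ∷ writeVar (name (zeros w))
      blockWord-ones rewrite blockWord-≡ (ones (w + w)) | eqV-refl (ones (w + w)) | take-replicate w w true = begin
        prefixWord (true , u₁ (ones w)) ++ prefixWord (false , ones w) ++ prefixWord (true , u₀ (ones w)) ++ `1 ∷ `x ∷ `0 ∷ `0 ∷ digits (ones w)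
          ≡⟨ cong (λ l → P₁ ++ P₂ ++ P₃ ++ `1 ∷ l) final ⟩
        P₁ ++ P₂ ++ P₃ ++ `1 ∷ writeVar (name (zeros w))
          ≡⟨ cong (λ l → P₁ ++ P₂ ++ l) (sym (List.++-assoc P₃ [] _)) ⟩
        P₁ ++ P₂ ++ (P₃ ++ []) ++ `1 ∷ writeVar (name (zeros w))
          ≡⟨ cong (P₁ ++_) (sym (List.++-assoc P₂ _ _)) ⟩
        P₁ ++ (P₂ ++ P₃ ++ []) ++ `1 ∷ writeVar (name (zeros w))
          ≡⟨ List.++-assoc P₁ _ _ ⟨
        (P₁ ++ P₂ ++ P₃ ++ []) ++ `1 ∷ writeVar (name (zeros w)) ∎
        where
        open ≡-Reasoning
        P₁ = prefixWord (true , u₁ (ones w))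
        P₂ = prefixWord {k} (false , ones w)
        P₃ = prefixWord (true , u₀ (ones w))
        final : `x ∷ `0 ∷ `0 ∷ digits (ones w) ≡ writeVar (name (zeros w))
        final = trans (cong (λ l → `x ∷ `0 ∷ l) digits-ones)
                  (trans (sym (writeVar-name (zeros w) [])) (List.++-identityʳ _))

      write-program : write (programFormula u₁ u₀ choice (properBlocks k)) ≡ concatMap blockWord (allVecs (w + w))
      write-program = trans (cong (`□ ∷_) (List.∷-injectiveʳ body)) (sym whole)
        where
        open ≡-Reasoning
        φ = var (name (zeros w))
        middle : ∀ {bs} → All Proper bs → concatMap blockWord bs ≡ concatMap prefixWord (concatMap (copy u₁ u₀ choice) (List.map (Vec.take w) bs))
        middle []       = refl
        middle {b ∷ bs} (p ∷ ps) = trans (cong₂ _++_ (blockWord-proper p) (middle ps))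
                            (sym (List.concatMap-++ prefixWord (copy u₁ u₀ choice (Vec.take w b)) (concatMap (copy u₁ u₀ choice) (List.map (Vec.take w) bs))))
        rest = concatMap blockWord (properVecs (k + w)) ++ blockWord (ones (w + w))
        whole : concatMap blockWord (allVecs (w + w)) ≡ `□ ∷ List.drop 1 (blockWord (zeros (w + w))) ++ rest
        whole = begin
          concatMap blockWord (allVecs (w + w))
            ≡⟨ cong (concatMap blockWord) (allVecs-suc (k + w)) ⟩
          blockWord (zeros (w + w)) ++ concatMap blockWord (properVecs (k + w) ++ ones (w + w) ∷ [])
            ≡⟨ cong (blockWord (zeros (w + w)) ++_) (trans (List.concatMap-++ blockWord (properVecs (k + w)) _)
                 (cong (concatMap blockWord (properVecs (k + w)) ++_) (List.++-identityʳ _))) ⟩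
          blockWord (zeros (w + w)) ++ rest
            ≡⟨ cong (_++ rest) first-symbol ⟩
          `□ ∷ List.drop 1 (blockWord (zeros (w + w))) ++ rest ∎
          where
          first-symbol : blockWord (zeros (w + w)) ≡ `□ ∷ List.drop 1 (blockWord (zeros (w + w)))
          first-symbol rewrite blockWord-≡ (zeros (w + w)) | eqV-refl (zeros (w + w)) = refl
        body : `1 ∷ write (prefixed (prefixes u₁ u₀ choice (properBlocks k)) φ) ≡
               `1 ∷ List.drop 1 (blockWord (zeros (w + w))) ++ rest
        body = begin
          `1 ∷ write (prefixed (prefixes u₁ u₀ choice (properBlocks k)) φ)
            ≡⟨ write-prefixed (prefixes u₁ u₀ choice (properBlocks k)) φ ⟩
          concatMap prefixWord (A ++ B ++ C) ++ `1 ∷ write φ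
            ≡⟨ cong (_++ `1 ∷ write φ) (trans (List.concatMap-++ prefixWord A (B ++ C))
                 (cong (concatMap prefixWord A ++_) (List.concatMap-++ prefixWord B C))) ⟩
          (concatMap prefixWord A ++ concatMap prefixWord B ++ concatMap prefixWord C) ++ `1 ∷ write φ
            ≡⟨ trans (List.++-assoc (concatMap prefixWord A) _ _)
                 (cong (concatMap prefixWord A ++_) (List.++-assoc (concatMap prefixWord B) _ _)) ⟩
          concatMap prefixWord A ++ concatMap prefixWord B ++ concatMap prefixWord C ++ `1 ∷ write φ
            ≡⟨ cong₂ _++_ (sym blockWord-zeros) (cong₂ _++_ (sym (middle (properVecs-proper (k + w)))) (sym blockWord-ones)) ⟩
          `1 ∷ List.drop 1 (blockWord (zeros (w + w))) ++ rest ∎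
          where
          A = firstCopy u₁ u₀ choice
          B = concatMap (copy u₁ u₀ choice) (properBlocks k)
          C = lastCopy u₁ u₀ choice

      encode-program : encode (programFormula u₁ u₀ choice (properBlocks k)) ≡
                       List.map (fields w bitAt) (allVecs (4 + (w + (2 + (w + w)))))
      encode-program = trans (cong (concatMap symbolCode) write-program) encode-blocks

-- With the first block `zeros` and the last block `ones` put back, both sides run through all words
-- once in each round.
properBlocks-≡ : ∀ k → properBlocks k ≡
  nonzeroVecs k ++ concatMap (λ _ → allVecs (suc k)) (properVecs k) ++ zeros (suc k) ∷ properVecs k
properBlocks-≡ k = List.∷-injectiveʳ (List.∷ʳ-injectiveˡ _ _ (begin
  (zeros w ∷ List.map (Vec.take w) (properVecs (k + w))) ++ ones w ∷ []
    ≡⟨ cong₂ (λ a b → (a ∷ List.map (Vec.take w) (properVecs (k + w))) ++ b ∷ []) (take-replicate w w false) (take-replicate w w true) ⟨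
  (Vec.take w (zeros (w + w)) ∷ List.map (Vec.take w) (properVecs (k + w))) ++ Vec.take w (ones (w + w)) ∷ []
    ≡⟨ cong (Vec.take w (zeros (w + w)) ∷_) (List.map-++ (Vec.take w) (properVecs (k + w)) (ones (w + w) ∷ [])) ⟨
  List.map (Vec.take w) (zeros (w + w) ∷ nonzeroVecs (k + w))
    ≡⟨ cong (List.map (Vec.take w)) (allVecs-suc (k + w)) ⟨
  List.map (Vec.take w) (allVecs (w + w))
    ≡⟨ map-allVecs-+ w w (Vec.take w) ⟩
  concatMap (λ hi → List.map (λ lo → Vec.take w (lo Vec.++ hi)) (allVecs w)) (allVecs w)
    ≡⟨ List.concatMap-cong (λ hi → trans (List.map-cong (λ lo → take-++ lo hi) (allVecs w)) (List.map-id (allVecs w))) (allVecs w) ⟩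
  concatMap (λ _ → allVecs w) (allVecs w)
    ≡⟨ cong (concatMap (λ _ → allVecs w)) (allVecs-suc k) ⟩
  allVecs w ++ concatMap (λ _ → allVecs w) (properVecs k ++ ones w ∷ [])
    ≡⟨ cong₂ _++_ (allVecs-suc k) (trans (List.concatMap-++ (λ _ → allVecs w) (properVecs k) _)
         (cong (L ++_) (trans (List.++-identityʳ (allVecs w)) (allVecs-suc k)))) ⟩
  (zeros w ∷ nonzeroVecs k) ++ L ++ zeros w ∷ properVecs k ++ ones w ∷ []
    ≡⟨ cong (λ l → zeros w ∷ nonzeroVecs k ++ l) (List.++-assoc L _ _) ⟨
  zeros w ∷ nonzeroVecs k ++ (L ++ zeros w ∷ properVecs k) ++ ones w ∷ []
    ≡⟨ cong (zeros w ∷_) (List.++-assoc (nonzeroVecs k) _ _) ⟨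
  (zeros w ∷ nonzeroVecs k ++ L ++ zeros w ∷ properVecs k) ++ ones w ∷ [] ∎))
  where
  open ≡-Reasoning
  w = suc k
  L = concatMap (λ _ → allVecs w) (properVecs k)

-- Unique readability

decodeSymbols : List Bool → List Symbol
decodeSymbols (a ∷ b ∷ c ∷ d ∷ bs) = symbol a b c d ∷ decodeSymbols bs
  where
  symbol : Bool → Bool → Bool → Bool → Symbol
  symbol false false false false = `x
  symbol false false false true  = `0
  symbol false false true  false = `1
  symbol false false true  true  = `⊤
  symbol false true  false false = `⊥
  symbol false true  false true  = `∧
  symbol false true  true  false = `∨
  symbol false true  true  true  = `□
  symbol true  false false false = `↓
  symbol true  false false true  = `at
  symbol true  false true  false = `lp
  symbol _     _     _     _     = `rp
decodeSymbols _ = []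

decodeSymbols-encode : ∀ ss → decodeSymbols (concatMap symbolCode ss) ≡ ss
decodeSymbols-encode []         = refl
decodeSymbols-encode (`x  ∷ ss) = cong (`x ∷_) (decodeSymbols-encode ss)
decodeSymbols-encode (`0  ∷ ss) = cong (`0 ∷_) (decodeSymbols-encode ss)
decodeSymbols-encode (`1  ∷ ss) = cong (`1 ∷_) (decodeSymbols-encode ss)
decodeSymbols-encode (`⊤  ∷ ss) = cong (`⊤ ∷_) (decodeSymbols-encode ss)
decodeSymbols-encode (`⊥  ∷ ss) = cong (`⊥ ∷_) (decodeSymbols-encode ss)
decodeSymbols-encode (`∧  ∷ ss) = cong (`∧ ∷_) (decodeSymbols-encode ss)
decodeSymbols-encode (`∨  ∷ ss) = cong (`∨ ∷_) (decodeSymbols-encode ss)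
decodeSymbols-encode (`□  ∷ ss) = cong (`□ ∷_) (decodeSymbols-encode ss)
decodeSymbols-encode (`↓  ∷ ss) = cong (`↓ ∷_) (decodeSymbols-encode ss)
decodeSymbols-encode (`at ∷ ss) = cong (`at ∷_) (decodeSymbols-encode ss)
decodeSymbols-encode (`lp ∷ ss) = cong (`lp ∷_) (decodeSymbols-encode ss)
decodeSymbols-encode (`rp ∷ ss) = cong (`rp ∷_) (decodeSymbols-encode ss)

-- In a formula a variable is never followed by a digit, so that its index has a recognisable end.
NoDigit : List Symbol → Set
NoDigit (`0 ∷ _) = ⊥
NoDigit (`1 ∷ _) = ⊥
NoDigit _        = ⊤

digits-injective : ∀ bs cs {xs ys} → NoDigit xs → NoDigit ys →
                   List.map digit bs ++ xs ≡ List.map digit cs ++ ys → bs ≡ cs × xs ≡ ys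
digits-injective []           []           _  _  eq   = refl , eq
digits-injective []           (false ∷ cs) () _  refl
digits-injective []           (true ∷ cs)  () _  refl
digits-injective (false ∷ bs) []           _  () refl
digits-injective (true ∷ bs)  []           _  () refl
digits-injective (false ∷ bs) (false ∷ cs) p  q  eq with digits-injective bs cs p q (List.∷-injectiveʳ eq)
... | refl , eq′ = refl , eq′
digits-injective (true ∷ bs)  (true ∷ cs)  p  q  eq with digits-injective bs cs p q (List.∷-injectiveʳ eq)
... | refl , eq′ = refl , eq′

bin-injective : ∀ {m n} → bin m ≡ bin n → m ≡ n
bin-injective {m} {n} eq = trans (sym (valL-bin m)) (trans (cong valL eq) (valL-bin n))

writeVar-injective : ∀ {x y xs ys} → NoDigit xs → NoDigit ys →
                     writeVar x ++ xs ≡ writeVar y ++ ys → x ≡ y × xs ≡ ys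
writeVar-injective {x} {y} p q eq with digits-injective (bin x) (bin y) p q (List.∷-injectiveʳ eq)
... | eq₁ , eq₂ = bin-injective eq₁ , eq₂

write-noDigit : ∀ φ {xs} → NoDigit (write φ ++ xs)
write-noDigit (var _)  = tt
write-noDigit ⊤′       = tt
write-noDigit ⊥′       = tt
write-noDigit (_ ∧′ _) = tt
write-noDigit (_ ∨′ _) = tt
write-noDigit (□ _)    = tt
write-noDigit (↓ _ _)  = tt
write-noDigit (at _ _) = tt

binary-++ : ∀ (as bs : List Symbol) s xs → (as ++ s ∷ bs ++ [ `rp ]) ++ xs ≡ as ++ s ∷ bs ++ `rp ∷ xs
binary-++ as bs s xs = trans (List.++-assoc as _ xs) (cong (λ l → as ++ s ∷ l) (List.++-assoc bs _ xs))

write-injective : ∀ φ ψ {xs ys} → NoDigit xs → NoDigit ys →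
                  write φ ++ xs ≡ write ψ ++ ys → φ ≡ ψ × xs ≡ ys
write-injective (var x) (var y) p q eq with writeVar-injective {x} {y} p q eq
... | refl , eq′ = refl , eq′
write-injective ⊤′ ⊤′ p q refl = refl , refl
write-injective ⊥′ ⊥′ p q refl = refl , refl
write-injective (φ ∧′ φ′) (ψ ∧′ ψ′) {xs} {ys} p q eq
  with write-injective φ ψ tt tt (trans (sym (binary-++ (write φ) (write φ′) `∧ xs))
         (trans (List.∷-injectiveʳ eq) (binary-++ (write ψ) (write ψ′) `∧ ys)))
... | refl , eq₁ with write-injective φ′ ψ′ tt tt (List.∷-injectiveʳ eq₁)
... | refl , eq₂ = refl , List.∷-injectiveʳ eq₂
write-injective (φ ∨′ φ′) (ψ ∨′ ψ′) {xs} {ys} p q eq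
  with write-injective φ ψ tt tt (trans (sym (binary-++ (write φ) (write φ′) `∨ xs))
         (trans (List.∷-injectiveʳ eq) (binary-++ (write ψ) (write ψ′) `∨ ys)))
... | refl , eq₁ with write-injective φ′ ψ′ tt tt (List.∷-injectiveʳ eq₁)
... | refl , eq₂ = refl , List.∷-injectiveʳ eq₂
write-injective (φ ∧′ φ′) (ψ ∨′ ψ′) {xs} {ys} p q eq
  with write-injective φ ψ tt tt (trans (sym (binary-++ (write φ) (write φ′) `∧ xs))
         (trans (List.∷-injectiveʳ eq) (binary-++ (write ψ) (write ψ′) `∨ ys)))
... | refl , ()
write-injective (φ ∨′ φ′) (ψ ∧′ ψ′) {xs} {ys} p q eq
  with write-injective φ ψ tt tt (trans (sym (binary-++ (write φ) (write φ′) `∨ xs))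
         (trans (List.∷-injectiveʳ eq) (binary-++ (write ψ) (write ψ′) `∧ ys)))
... | refl , ()
write-injective (□ φ) (□ ψ) p q eq with write-injective φ ψ p q (List.∷-injectiveʳ eq)
... | refl , eq′ = refl , eq′
write-injective (↓ x φ) (↓ y ψ) {xs} {ys} p q eq
  with writeVar-injective {x} {y} (write-noDigit φ) (write-noDigit ψ)
         (trans (sym (List.++-assoc (writeVar x) (write φ) xs))
           (trans (List.∷-injectiveʳ eq) (List.++-assoc (writeVar y) (write ψ) ys)))
... | refl , eq₁ with write-injective φ ψ p q eq₁
... | refl , eq₂ = refl , eq₂
write-injective (at x φ) (at y ψ) {xs} {ys} p q eq
  with writeVar-injective {x} {y} (write-noDigit φ) (write-noDigit ψ)
         (trans (sym (List.++-assoc (writeVar x) (write φ) xs))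
           (trans (List.∷-injectiveʳ eq) (List.++-assoc (writeVar y) (write ψ) ys)))
... | refl , eq₁ with write-injective φ ψ p q eq₁
... | refl , eq₂ = refl , eq₂

encode-injective : ∀ {φ ψ} → encode φ ≡ encode ψ → φ ≡ ψ
encode-injective {φ} {ψ} eq = proj₁ (write-injective φ ψ {[]} {[]} tt tt (cong (_++ [])
  (trans (sym (decodeSymbols-encode (write φ))) (trans (cong decodeSymbols eq) (decodeSymbols-encode (write ψ))))))

MSAT-encode : ∀ φ → MSAT (encode φ) ⇔ Satisfiable φ
MSAT-encode φ = mk⇔ (λ { (ψ , eq , sat) → subst Satisfiable (encode-injective {ψ} {φ} eq) sat }) (λ sat → φ , refl , sat)

module _ {k : ℕ} (u₁ u₀ : Vec Bool (suc k) → Vec Bool (suc k)) (choice : Vec Bool (suc k) → Bool) where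

  programWord : List Bool
  programWord = List.map (fields (suc k) (bitAt u₁ u₀ choice)) (allVecs (4 + (suc k + (2 + (suc k + suc k)))))

  MSAT-programWord : u₁ (zeros (suc k)) ≡ zeros (suc k) →
                     MSAT programWord ⇔ Satisfiable (programFormula u₁ u₀ choice (properBlocks k))
  MSAT-programWord zeros-u₁ = subst (λ w → MSAT w ⇔ Satisfiable (programFormula u₁ u₀ choice (properBlocks k)))
    (encode-program u₁ u₀ choice zeros-u₁) (MSAT-encode (programFormula u₁ u₀ choice (properBlocks k)))

-- Tracks

decV : ∀ {k} → Vec Bool k → Vec Bool k
decV []          = []
decV (false ∷ v) = true ∷ decV v
decV (true ∷ v)  = false ∷ v

decV-incV : ∀ {k} (v : Vec Bool k) → decV (incV v) ≡ v
decV-incV []          = refl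
decV-incV (false ∷ v) = refl
decV-incV (true ∷ v)  = cong (true ∷_) (decV-incV v)

shiftIn : ∀ {k} → Bool → Vec Bool k → Vec Bool k
shiftIn b []      = []
shiftIn b (x ∷ v) = b ∷ shiftIn x v

-- The changes which a machine step can make to a track: `inc` and `dec` move the input head, `push`
-- and `pop` act on the stacks that form a work tape, and `set` writes a track with one significant
-- bit.
data Mode : Set where
  keep pop inc dec : Mode
  set push         : Bool → Mode

apply : ∀ {k} → Mode → Vec Bool (suc k) → Vec Bool (suc k)
apply keep     v = v
apply pop      v = Vec.tail v Vec.∷ʳ false
apply inc      v = incV v
apply dec      v = decV v
apply (set b)  v = b ∷ zeros _
apply (push b) v = shiftIn b v

-- The automaton with one bit of memory which compares a track `o` with the
-- result of applying a mode to a track `c`.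

start : Mode → Bool → Bool
start keep     _ = false
start pop      c = c
start inc      _ = true
start dec      _ = true
start (set b)  _ = b
start (push b) _ = b

compare? : Bool → Bool → Bool
compare? true  b = b
compare? false b = not b

-- For `pop` the comparison lags one cell behind, since the result at a cell is the content of the
-- next one: the bit in memory is the previous bit of `o`. In the first cell, where there is none,
-- `start` lets `c` be compared with itself, and `final` requires the last bit of `o` to be the
-- `false` shifted in.
ok : Mode → (carry c o : Bool) → Bool
ok keep     s c o = compare? o c
ok pop      s c o = compare? c s
ok inc      s c o = compare? o (if s then not c else c)
ok dec      s c o = compare? o (if s then not c else c)
ok (set b)  s c o = compare? o s
ok (push b) s c o = compare? o s

carry : Mode → (carry c o : Bool) → Bool
carry keep     s c o = false
carry pop      s c o = o
carry inc      s c o = s ∧ c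
carry dec      s c o = s ∧ not c
carry (set b)  s c o = false
carry (push b) s c o = c

final : Mode → Bool → Bool
final pop s = not s
final _   s = true

check : ∀ {k} → Mode → Bool → (c o : Vec Bool k) → Bool
check m s []      []      = final m s
check m s (c ∷ v) (o ∷ w) = ok m s c o ∧ check m (carry m s c o) v w

eqV-∷ : ∀ {k} a b (v w : Vec Bool k) → eqV (a ∷ v) (b ∷ w) ≡ compare? a b ∧ eqV v w
eqV-∷ false false v w = refl
eqV-∷ false true  v w = refl
eqV-∷ true  false v w = refl
eqV-∷ true  true  v w = refl

eqV-sym : ∀ {k} (v w : Vec Bool k) → eqV v w ≡ eqV w v
eqV-sym []          []          = refl
eqV-sym (false ∷ v) (false ∷ w) = eqV-sym v w
eqV-sym (false ∷ v) (true ∷ w)  = refl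
eqV-sym (true ∷ v)  (false ∷ w) = refl
eqV-sym (true ∷ v)  (true ∷ w)  = eqV-sym v w

check-apply : ∀ {k} m (c o : Vec Bool (suc k)) → check m (start m (Vec.head c)) c o ≡ eqV o (apply m c)
check-apply keep c o = keeps false c o
  where
  keeps : ∀ {k} s (c o : Vec Bool k) → check keep s c o ≡ eqV o c
  keeps s []      []      = refl
  keeps s (c ∷ v) (o ∷ w) = trans (cong (_ ∧_) (keeps _ v w)) (sym (eqV-∷ o c w v))
check-apply pop (c ∷ v) o = trans (pops c (c ∷ v) o) (trans (trans (eqV-∷ c c _ o) (same c)) (eqV-sym (v Vec.∷ʳ false) o))
  where
  pops : ∀ {k} s (c o : Vec Bool k) → check pop s c o ≡ eqV (c Vec.∷ʳ false) (s ∷ o)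
  pops false []      []      = refl
  pops true  []      []      = refl
  pops s     (c ∷ v) (o ∷ w) = trans (cong (_ ∧_) (pops _ v w)) (sym (eqV-∷ c s _ _))
  same : ∀ c {b} → compare? c c ∧ b ≡ b
  same false = refl
  same true  = refl
check-apply inc c o = incs true c o
  where
  incs : ∀ {k} s (c o : Vec Bool k) → check inc s c o ≡ eqV o (if s then incV c else c)
  incs false []          []      = refl
  incs true  []          []      = refl
  incs false (c ∷ v)     (o ∷ w) = trans (cong (_ ∧_) (incs _ v w)) (sym (eqV-∷ o c w v))
  incs true  (false ∷ v) (o ∷ w) = trans (cong (_ ∧_) (incs _ v w)) (sym (eqV-∷ o true w v))
  incs true  (true ∷ v)  (o ∷ w) = trans (cong (_ ∧_) (incs _ v w)) (sym (eqV-∷ o false w (incV v)))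
check-apply dec c o = decs true c o
  where
  decs : ∀ {k} s (c o : Vec Bool k) → check dec s c o ≡ eqV o (if s then decV c else c)
  decs false []          []      = refl
  decs true  []          []      = refl
  decs false (c ∷ v)     (o ∷ w) = trans (cong (_ ∧_) (decs _ v w)) (sym (eqV-∷ o c w v))
  decs true  (false ∷ v) (o ∷ w) = trans (cong (_ ∧_) (decs _ v w)) (sym (eqV-∷ o true w (decV v)))
  decs true  (true ∷ v)  (o ∷ w) = trans (cong (_ ∧_) (decs _ v w)) (sym (eqV-∷ o false w v))
check-apply (set b) (c ∷ v) (o ∷ w) = trans (cong (compare? o b ∧_) (clears v w)) (sym (eqV-∷ o b w _))
  where
  clears : ∀ {k} (c o : Vec Bool k) → check (set b) false c o ≡ eqV o (zeros k)
  clears []      []      = refl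
  clears (c ∷ v) (o ∷ w) = trans (cong (_ ∧_) (clears v w)) (sym (eqV-∷ o false w _))
check-apply (push b) c o = pushes b c o
  where
  pushes : ∀ {k} s (c o : Vec Bool k) → check (push b) s c o ≡ eqV o (shiftIn s c)
  pushes s []      []      = refl
  pushes s (c ∷ v) (o ∷ w) = trans (cong (_ ∧_) (pushes _ v w)) (sym (eqV-∷ o s w _))

-- The code of zero, the blank, is the padding of a track.

codeFin : ∀ {l} → Fin (suc l) → Vec Bool l
codeFin {l}     0F                    = zeros l
codeFin {suc l} 1F                    = true ∷ zeros l
codeFin {suc l} (Fin.suc (Fin.suc i)) = false ∷ codeFin (Fin.suc i)

decodeFin : ∀ {l} → Vec Bool l → Fin (suc l)
decodeFin []          = 0F
decodeFin (true ∷ v)  = 1F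
decodeFin (false ∷ v) with decodeFin v
... | 0F  = 0F
... | Fin.suc i = Fin.suc (Fin.suc i)

decodeFin-zeros : ∀ l → decodeFin (zeros l) ≡ 0F
decodeFin-zeros zero    = refl
decodeFin-zeros (suc l) rewrite decodeFin-zeros l = refl

decodeFin-codeFin : ∀ {l} (i : Fin (suc l)) → decodeFin (codeFin i) ≡ i
decodeFin-codeFin {l}     0F                    = decodeFin-zeros l
decodeFin-codeFin {suc l} 1F                    = refl
decodeFin-codeFin {suc l} (Fin.suc (Fin.suc i)) rewrite decodeFin-codeFin {l} (Fin.suc i) = refl

pad-[] : ∀ k → pad k [] ≡ zeros k
pad-[] zero    = refl
pad-[] (suc k) = cong (false ∷_) (pad-[] k)

pad-bin-suc : ∀ k i → pad k (bin (suc i)) ≡ incV (pad k (bin i))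
pad-bin-suc k i = pad-increment k (bin i)

single : ∀ {k m} → Vec Bool m → Vec (Vec Bool (suc k)) m
single {k} = Vec.map (λ b → b ∷ zeros k)

-- The tracks of a stack, one for each bit of the codes of its symbols.

stackTracks : ∀ {l} k → List (Fin (suc l)) → Vec (Vec Bool k) l
stackTracks zero    xs       = Vec.replicate _ []
stackTracks (suc k) []       = Vec.zipWith _∷_ (codeFin 0F) (stackTracks k [])
stackTracks (suc k) (x ∷ xs) = Vec.zipWith _∷_ (codeFin x) (stackTracks k xs)

stackTracks-[] : ∀ l k → stackTracks {l} k [] ≡ Vec.replicate l (zeros k)
stackTracks-[] l zero    = refl
stackTracks-[] l (suc k) = trans (cong (Vec.zipWith _∷_ (zeros l)) (stackTracks-[] l k))
                                 (Vec.zipWith-replicate _∷_ false (zeros k))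

map-head-∷ : ∀ {A : Set} {k l} (x : Vec A l) (t : Vec (Vec A k) l) → Vec.map Vec.head (Vec.zipWith _∷_ x t) ≡ x
map-head-∷ []      []      = refl
map-head-∷ (x ∷ v) (t ∷ w) = cong (x ∷_) (map-head-∷ v w)

popped : ∀ {l} → List (Fin (suc l)) → Fin (suc l)
popped []      = 0F
popped (x ∷ _) = x

head-stackTracks : ∀ {l} k (xs : List (Fin (suc l))) → Vec.map Vec.head (stackTracks (suc k) xs) ≡ codeFin (popped xs)
head-stackTracks k []       = map-head-∷ _ _
head-stackTracks k (x ∷ xs) = map-head-∷ _ _

head-single : ∀ {k m} (v : Vec Bool m) → Vec.map Vec.head (single {k} v) ≡ v
head-single []      = refl
head-single (b ∷ v) = cong (b ∷_) (head-single v)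

applyAll : ∀ {k m} → Vec Mode m → Vec (Vec Bool (suc k)) m → Vec (Vec Bool (suc k)) m
applyAll = Vec.zipWith apply

apply-set : ∀ {k m} (v : Vec Bool m) (t : Vec (Vec Bool (suc k)) m) → applyAll (Vec.map set v) t ≡ single v
apply-set []      []      = refl
apply-set (b ∷ v) (t ∷ w) = cong ((b ∷ zeros _) ∷_) (apply-set v w)

apply-keep : ∀ {k m} (t : Vec (Vec Bool (suc k)) m) → applyAll (Vec.replicate m keep) t ≡ t
apply-keep []      = refl
apply-keep (t ∷ w) = cong (t ∷_) (apply-keep w)

apply-push : ∀ {k l} a (xs : List (Fin (suc l))) →
             applyAll (Vec.map push (codeFin a)) (stackTracks (suc k) xs) ≡ stackTracks (suc k) (a ∷ xs)
apply-push {k} a xs = trans (Vec.zipWith-map₁ apply push (codeFin a) (stackTracks (suc k) xs)) (shift (suc k) a xs)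
  where
  step′ : ∀ {k l} (a x : Vec Bool l) (t : Vec (Vec Bool k) l) →
          Vec.zipWith shiftIn a (Vec.zipWith _∷_ x t) ≡ Vec.zipWith _∷_ a (Vec.zipWith shiftIn x t)
  step′ []      []      []      = refl
  step′ (a ∷ v) (x ∷ u) (t ∷ w) = cong ((a ∷ shiftIn x t) ∷_) (step′ v u w)
  none : ∀ {l} (a : Vec Bool l) → Vec.zipWith shiftIn a (Vec.replicate l []) ≡ Vec.replicate l []
  none []      = refl
  none (_ ∷ v) = cong ([] ∷_) (none v)
  shift : ∀ {l} k a (xs : List (Fin (suc l))) →
          Vec.zipWith shiftIn (codeFin a) (stackTracks k xs) ≡ stackTracks k (a ∷ xs)
  shift zero    a xs       = none (codeFin a)
  shift (suc k) a []       = trans (step′ (codeFin a) _ _) (cong (Vec.zipWith _∷_ (codeFin a))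
    (trans (shift k 0F []) (blank k)))
    where
    blank : ∀ {l} k → stackTracks {l} k (0F ∷ []) ≡ stackTracks k []
    blank zero    = refl
    blank (suc k) = refl
  shift (suc k) a (x ∷ xs) = trans (step′ (codeFin a) _ _) (cong (Vec.zipWith _∷_ (codeFin a)) (shift k x xs))

-- Tracks truncate a stack. Pushing is compatible with that, but popping shifts in a blank at the
-- bottom, where a truncated symbol would have to reappear; hence the bound on the length.
apply-pop : ∀ {k l} (xs : List (Fin (suc l))) → length xs ≤ suc k →
            applyAll (Vec.replicate l pop) (stackTracks (suc k) xs) ≡ stackTracks (suc k) (List.drop 1 xs)
apply-pop {k} xs p = trans (Vec.zipWith-replicate₁ apply pop (stackTracks (suc k) xs)) (pops xs p)
  where
  tail-∷ : ∀ {k l} (x : Vec Bool l) (t : Vec (Vec Bool k) l) →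
           Vec.map (apply pop) (Vec.zipWith _∷_ x t) ≡ Vec.map (Vec._∷ʳ false) t
  tail-∷ []      []      = refl
  tail-∷ (x ∷ v) (t ∷ w) = cong ((t Vec.∷ʳ false) ∷_) (tail-∷ v w)
  snoc-∷ : ∀ {k l} (x : Vec Bool l) (t : Vec (Vec Bool k) l) →
           Vec.map (Vec._∷ʳ false) (Vec.zipWith _∷_ x t) ≡ Vec.zipWith _∷_ x (Vec.map (Vec._∷ʳ false) t)
  snoc-∷ []      []      = refl
  snoc-∷ (x ∷ v) (t ∷ w) = cong ((x ∷ (t Vec.∷ʳ false)) ∷_) (snoc-∷ v w)
  none : ∀ l → Vec.map (Vec._∷ʳ false) (Vec.replicate l []) ≡ Vec.zipWith _∷_ (zeros l) (Vec.replicate l [])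
  none zero    = refl
  none (suc l) = cong (_ ∷_) (none l)
  snoc : ∀ {l} k (xs : List (Fin (suc l))) → length xs ≤ k →
         Vec.map (Vec._∷ʳ false) (stackTracks k xs) ≡ stackTracks (suc k) xs
  snoc {l} zero []      _ = none l
  snoc (suc k) []       _ = trans (snoc-∷ _ (stackTracks k [])) (cong (Vec.zipWith _∷_ (zeros _)) (snoc k [] z≤n))
  snoc (suc k) (x ∷ xs) (s≤s p) = trans (snoc-∷ _ (stackTracks k xs)) (cong (Vec.zipWith _∷_ (codeFin x)) (snoc k xs p))
  pops : ∀ xs → length xs ≤ suc k → Vec.map (apply pop) (stackTracks (suc k) xs) ≡ stackTracks (suc k) (List.drop 1 xs)
  pops []       _       = trans (tail-∷ _ (stackTracks k [])) (snoc k [] z≤n)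
  pops (x ∷ xs) (s≤s p) = trans (tail-∷ _ (stackTracks k xs)) (snoc k xs p)

-- Configurations as tracks

-- For each work tape, in this order: the scanned symbol, the cells left of the head, and the cells
-- right of it.
Triple : Set → Set
Triple A = A × A × A

flatTriple : ∀ {A : Set} {l} → Triple (Vec A l) → Vec A (l + (l + l))
flatTriple (x , y , z) = x Vec.++ (y Vec.++ z)

flatTriples : ∀ {A : Set} {l k} → Vec (Triple (Vec A l)) k → Vec A (k * (l + (l + l)))
flatTriples []       = []
flatTriples (t ∷ ts) = flatTriple t Vec.++ flatTriples ts

unflatTriple : ∀ {A : Set} l → Vec A (l + (l + l)) → Triple (Vec A l)
unflatTriple l v = Vec.take l v , Vec.take l (Vec.drop l v) , Vec.drop l (Vec.drop l v)

unflatTriples : ∀ {A : Set} l k → Vec A (k * (l + (l + l))) → Vec (Triple (Vec A l)) k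
unflatTriples l zero    v = []
unflatTriples l (suc k) v = unflatTriple l (Vec.take (l + (l + l)) v) ∷ unflatTriples l k (Vec.drop (l + (l + l)) v)

unflatTriples-flat : ∀ {A : Set} {l k} (ts : Vec (Triple (Vec A l)) k) → unflatTriples l k (flatTriples ts) ≡ ts
unflatTriples-flat []                   = refl
unflatTriples-flat {l = l} (t@(x , y , z) ∷ ts)
  rewrite take-++ (flatTriple t) (flatTriples ts) | drop-++ (flatTriple t) (flatTriples ts)
        | take-++ x (y Vec.++ z) | drop-++ x (y Vec.++ z) | take-++ y z | drop-++ y z
  = cong ((x , y , z) ∷_) (unflatTriples-flat ts)

mapTriple : ∀ {A B : Set} {l} → (A → B) → Triple (Vec A l) → Triple (Vec B l)
mapTriple f (x , y , z) = Vec.map f x , Vec.map f y , Vec.map f z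

zipTriple : ∀ {A B C : Set} {l} → (A → B → C) → Triple (Vec A l) → Triple (Vec B l) → Triple (Vec C l)
zipTriple f (x , y , z) (x′ , y′ , z′) = Vec.zipWith f x x′ , Vec.zipWith f y y′ , Vec.zipWith f z z′

map-flatTriples : ∀ {A B : Set} {l k} (f : A → B) (ts : Vec (Triple (Vec A l)) k) →
                  Vec.map f (flatTriples ts) ≡ flatTriples (Vec.map (mapTriple f) ts)
map-flatTriples f []                   = refl
map-flatTriples f (t@(x , y , z) ∷ ts) = trans (Vec.map-++ f (flatTriple t) (flatTriples ts))
  (cong₂ Vec._++_ (trans (Vec.map-++ f x _) (cong (Vec.map f x Vec.++_) (Vec.map-++ f y z))) (map-flatTriples f ts))

zip-flatTriples : ∀ {A B C : Set} {l k} (f : A → B → C) (ts : Vec (Triple (Vec A l)) k) us →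
                  Vec.zipWith f (flatTriples ts) (flatTriples us) ≡ flatTriples (Vec.zipWith (zipTriple f) ts us)
zip-flatTriples f [] []                                         = refl
zip-flatTriples f (t@(x , y , z) ∷ ts) (u@(x′ , y′ , z′) ∷ us) =
  trans (Vec.zipWith-++ f (flatTriple t) (flatTriples ts) (flatTriple u) (flatTriples us))
    (cong₂ Vec._++_ (trans (Vec.zipWith-++ f x (y Vec.++ z) x′ (y′ Vec.++ z′))
      (cong (Vec.zipWith f x x′ Vec.++_) (Vec.zipWith-++ f y z y′ z′))) (zip-flatTriples f ts us))

module Simulation (M : TM Bool) where

  open TM M using (states; tapes; letters; δ) renaming (start to startState)

  -- Codes of control states: 0 and 1 are final, for acceptance (and junk)
  -- and rejection.

  controls : ℕ
  controls = 2 + states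

  tracks′ tracks : ℕ
  tracks′ = suc ((1 + states) + tapes * (letters + (letters + letters)))
  tracks  = suc tracks′

  -- The track `flag` is zero in the configurations of the machine. Beginning with `true`, as in
  -- `ones`, it marks a fictitious configuration followed by the initial one. The track `pos` is the
  -- position of the input head.
  layout : ∀ {A : Set} → A → A → Vec A (1 + states) → Vec (Triple (Vec A letters)) tapes → Vec A tracks
  layout flag pos ctl work = flag ∷ pos ∷ (ctl Vec.++ flatTriples work)

  blankWork : Vec (Triple (Vec Bool letters)) tapes
  blankWork = Vec.replicate tapes (zeros letters , zeros letters , zeros letters)

  controlBits : Fin controls → Vec Bool tracks
  controlBits i = layout false false (codeFin i) blankWork

  running : Fin states → Fin controls
  running q = Fin.suc (Fin.suc q)

  -- The symbol which comes under the head is the top of the stack that is popped, and so is known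
  -- from the first cells of the tracks.
  tapeMode : Triple (Vec Bool letters) → Fin (suc letters) × Direction → Triple (Vec Mode letters)
  tapeMode (scan , bef , aft) (a , left)  = Vec.map set bef , Vec.replicate letters pop , Vec.map push (codeFin a)
  tapeMode (scan , bef , aft) (a , stay)  = Vec.map set (codeFin a) , Vec.replicate letters keep , Vec.replicate letters keep
  tapeMode (scan , bef , aft) (a , right) = Vec.map set aft , Vec.map push (codeFin a) , Vec.replicate letters pop

  posMode : InputCell Bool → Direction → Mode
  posMode ⊢ left  = keep
  posMode s left  = dec
  posMode s stay  = keep
  posMode ⊣ right = keep
  posMode s right = inc

  modesOf : InputCell Bool → Vec (Triple (Vec Bool letters)) tapes → Action states tapes (suc letters) → Vec Mode tracks
  modesOf s work (halt true)    = Vec.map set (controlBits 0F)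
  modesOf s work (halt false)   = Vec.map set (controlBits 1F)
  modesOf s work (move q d as)  = layout keep (posMode s d) (Vec.map set (codeFin (running q))) (Vec.zipWith tapeMode work as)

  modesFor : InputCell Bool → Bool → Fin controls → Vec (Triple (Vec Bool letters)) tapes → Vec Mode tracks
  modesFor s true  _                     work = Vec.map set (controlBits (running startState))
  modesFor s false 0F              work = Vec.replicate tracks keep
  modesFor s false 1F    work = Vec.replicate tracks keep
  modesFor s false (Fin.suc (Fin.suc q)) work = modesOf s work (δ q s (Vec.map (decodeFin ∘ proj₁) work))

  -- The first cells of the tracks, together with the scanned input cell, determine the whole step.
  -- So a program that has looked at the first column knows the mode of each track.
  modes : InputCell Bool → Vec Bool tracks → Vec Mode tracks
  modes s (flag ∷ pos ∷ bits) =
    modesFor s flag (decodeFin (Vec.take (1 + states) bits)) (unflatTriples letters tapes (Vec.drop (1 + states) bits))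

  map-layout : ∀ {A B : Set} (f : A → B) flag pos ctl work →
    Vec.map f (layout flag pos ctl work) ≡ layout (f flag) (f pos) (Vec.map f ctl) (Vec.map (mapTriple f) work)
  map-layout f flag pos ctl work = cong (λ v → f flag ∷ f pos ∷ v)
    (trans (Vec.map-++ f ctl (flatTriples work)) (cong (Vec.map f ctl Vec.++_) (map-flatTriples f work)))

  modes-layout : ∀ s flag pos ctl work → modes s (layout flag pos ctl work) ≡ modesFor s flag (decodeFin ctl) work
  modes-layout s flag pos ctl work = cong₂ (λ a b → modesFor s flag (decodeFin a) b)
    (take-++ ctl (flatTriples work))
    (trans (cong (unflatTriples letters tapes) (drop-++ ctl (flatTriples work))) (unflatTriples-flat work))

  module _ {k : ℕ} where

    nextTracks : InputCell Bool → Vec (Vec Bool (suc k)) tracks → Vec (Vec Bool (suc k)) tracks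
    nextTracks s c = applyAll (modes s (Vec.map Vec.head c)) c

    repTape : Tape letters → Triple (Vec (Vec Bool (suc k)) letters)
    repTape (tape bef a aft) = single (codeFin a) , stackTracks (suc k) bef , stackTracks (suc k) aft

    represent : Config M → Vec (Vec Bool (suc k)) tracks
    represent (config q i ts) =
      layout (zeros (suc k)) (pad (suc k) (bin i)) (single (codeFin (running q))) (Vec.map repTape ts)

    finalTracks : Fin controls → Vec (Vec Bool (suc k)) tracks
    finalTracks i = single (controlBits i)

    headBits : Tape letters → Triple (Vec Bool letters)
    headBits (tape bef a aft) = codeFin a , codeFin (popped bef) , codeFin (popped aft)

    scanned-headBits : ∀ {n} (ts : Vec (Tape letters) n) → Vec.map (decodeFin ∘ proj₁) (Vec.map headBits ts) ≡ Vec.map scanned ts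
    scanned-headBits ts = trans (sym (Vec.map-∘ (decodeFin ∘ proj₁) headBits ts))
      (Vec.map-cong (λ { (tape bef a aft) → decodeFin-codeFin a }) ts)

    modes-represent : ∀ s q i ts → modes s (Vec.map Vec.head (represent (config q i ts))) ≡
                      modesOf s (Vec.map headBits ts) (δ q s (Vec.map scanned ts))
    modes-represent s q i ts = begin
      modes s (Vec.map Vec.head (represent (config q i ts)))
        ≡⟨ cong (modes s) (map-layout Vec.head (zeros (suc k)) (pad (suc k) (bin i)) (single (codeFin (running q))) (Vec.map repTape ts)) ⟩
      modes s (layout false (Vec.head (pad (suc k) (bin i))) (Vec.map Vec.head (single {k} (codeFin (running q))))
                (Vec.map (mapTriple Vec.head) (Vec.map repTape ts)))
        ≡⟨ modes-layout s false (Vec.head (pad (suc k) (bin i))) (Vec.map Vec.head (single {k} (codeFin (running q)))) _ ⟩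
      modesFor s false (decodeFin (Vec.map Vec.head (single {k} (codeFin (running q))))) (Vec.map (mapTriple Vec.head) (Vec.map repTape ts))
        ≡⟨ cong₂ (modesFor s false)
             (trans (cong decodeFin (head-single {k} (codeFin (running q)))) (decodeFin-codeFin (running q)))
             (trans (sym (Vec.map-∘ (mapTriple Vec.head) repTape ts)) (Vec.map-cong (λ { (tape bef a aft) →
                cong₂ _,_ (head-single (codeFin a)) (cong₂ _,_ (head-stackTracks k bef) (head-stackTracks k aft)) }) ts)) ⟩
      modesOf s (Vec.map headBits ts) (δ q s (Vec.map (decodeFin ∘ proj₁) (Vec.map headBits ts)))
        ≡⟨ cong (λ v → modesOf s (Vec.map headBits ts) (δ q s v)) (scanned-headBits ts) ⟩
      modesOf s (Vec.map headBits ts) (δ q s (Vec.map scanned ts)) ∎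
      where open ≡-Reasoning

    apply-tapeMode : ∀ t a → visited t ≤ suc k →
                     zipTriple apply (tapeMode (headBits t) a) (repTape t) ≡ repTape (actOn t a)
    apply-tapeMode (tape bef b aft) (a , stay)  v = cong₂ _,_ (apply-set (codeFin a) (single (codeFin b)))
      (cong₂ _,_ (apply-keep (stackTracks (suc k) bef)) (apply-keep (stackTracks (suc k) aft)))
    apply-tapeMode (tape [] b aft) (a , left) v = cong₂ _,_ (apply-set (zeros letters) (single (codeFin b)))
      (cong₂ _,_ (apply-pop {k} {letters} [] z≤n) (apply-push a aft))
    apply-tapeMode (tape (x ∷ bef) b aft) (a , left) v = cong₂ _,_ (apply-set (codeFin x) (single (codeFin b)))
      (cong₂ _,_ (apply-pop {k} (x ∷ bef) (≤-trans (m≤m+n _ (length aft)) (≤-trans (n≤1+n _) v))) (apply-push a aft))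
    apply-tapeMode (tape bef b []) (a , right) v = cong₂ _,_ (apply-set (zeros letters) (single (codeFin b)))
      (cong₂ _,_ (apply-push a bef) (apply-pop {k} {letters} [] z≤n))
    apply-tapeMode (tape bef b (x ∷ aft)) (a , right) v = cong₂ _,_ (apply-set (codeFin x) (single (codeFin b)))
      (cong₂ _,_ (apply-push a bef) (apply-pop {k} (x ∷ aft) (≤-trans (m≤n+m _ (length bef)) (≤-trans (n≤1+n _) v))))

    apply-posMode : ∀ (w : List Bool) d i →
      apply (posMode (readInput w i) d) (pad (suc k) (bin i)) ≡ pad (suc k) (bin (moveInput w d i))
    apply-posMode w left  zero = refl
    apply-posMode w left  (suc i) = trans (cong (λ m → apply m (pad (suc k) (bin (suc i)))) (mode i w))
      (trans (cong decV (pad-bin-suc (suc k) i)) (decV-incV (pad (suc k) (bin i))))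
      where
      mode : ∀ i w → posMode (readInput w (suc i)) left ≡ dec
      mode i       []      = refl
      mode zero    (a ∷ w) = refl
      mode (suc i) (a ∷ w) = mode i w
    apply-posMode w stay  i with readInput w i
    ... | ⊢        = refl
    ... | ⊣        = refl
    ... | letter _ = refl
    apply-posMode w right i with readInput w i
    ... | ⊢        = sym (pad-bin-suc (suc k) i)
    ... | ⊣        = refl
    ... | letter _ = sym (pad-bin-suc (suc k) i)

    UsesSpace : Config M → Set
    UsesSpace = UsesSpace≤ M (suc k)

    next-move : ∀ w c {c′} → UsesSpace c → step M w c ≡ inj₂ c′ →
                nextTracks (readInput w (Config.inputHead c)) (represent c) ≡ represent c′
    next-move w (config q i ts) space eq
      rewrite modes-represent (readInput w i) q i ts
      with δ q (readInput w i) (Vec.map scanned ts)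
    next-move w (config q i ts) space refl | move q′ d as =
      cong₂ _∷_ refl (cong₂ _∷_ (apply-posMode w d i)
        (trans (Vec.zipWith-++ apply (Vec.map set (codeFin (running q′))) (flatTriples (Vec.zipWith tapeMode (Vec.map headBits ts) as))
                  (single (codeFin (running q))) (flatTriples (Vec.map repTape ts)))
          (cong₂ Vec._++_ (apply-set (codeFin (running q′)) (single (codeFin (running q))))
            (trans (zip-flatTriples apply (Vec.zipWith tapeMode (Vec.map headBits ts) as) (Vec.map repTape ts))
              (cong flatTriples (work ts as space))))))
      where
      work : ∀ {n} (ts : Vec (Tape letters) n) as → VecAll.All (λ t → visited t ≤ suc k) ts →
             Vec.zipWith (zipTriple apply) (Vec.zipWith tapeMode (Vec.map headBits ts) as) (Vec.map repTape ts) ≡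
             Vec.map repTape (Vec.zipWith actOn ts as)
      work []       []       _        = refl
      work (t ∷ ts) (a ∷ as) (p ∷ ps) = cong₂ _∷_ (apply-tapeMode t a p) (work ts as ps)

    finalOf : Bool → Fin controls
    finalOf true  = 0F
    finalOf false = 1F

    next-halt : ∀ w c {b} → step M w c ≡ inj₁ b →
                nextTracks (readInput w (Config.inputHead c)) (represent c) ≡ finalTracks (finalOf b)
    next-halt w (config q i ts) eq
      rewrite modes-represent (readInput w i) q i ts
      with δ q (readInput w i) (Vec.map scanned ts)
    next-halt w (config q i ts) refl | halt true  = apply-set (controlBits 0F) (represent (config q i ts))
    next-halt w (config q i ts) refl | halt false = apply-set (controlBits 1F) (represent (config q i ts))

    represent-initial : represent (initial M) ≡ single (controlBits (running startState))
    represent-initial = cong₂ _∷_ refl (cong₂ _∷_ (cong (false ∷_) (pad-[] k))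
      (trans (cong (single (codeFin (running startState)) Vec.++_)
               (trans (cong flatTriples (trans (Vec.map-replicate repTape blankTape tapes)
                  (trans (cong (Vec.replicate tapes) blank) (sym (Vec.map-replicate (mapTriple (λ b → b ∷ zeros k)) (zeros letters , zeros letters , zeros letters) tapes)))))
                 (sym (map-flatTriples (λ b → b ∷ zeros k) blankWork))))
        (sym (Vec.map-++ (λ b → b ∷ zeros k) (codeFin (running startState)) (flatTriples blankWork)))))
      where
      empty : stackTracks {letters} (suc k) [] ≡ single (zeros letters)
      empty = trans (stackTracks-[] letters (suc k)) (sym (Vec.map-replicate (λ b → b ∷ zeros k) false letters))
      blank : repTape blankTape ≡ mapTriple (λ b → b ∷ zeros k) (zeros letters , zeros letters , zeros letters)
      blank = cong₂ _,_ refl (cong₂ _,_ empty empty)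

    next-start : ∀ s (c : Vec (Vec Bool (suc k)) tracks) → Vec.head (Vec.head c) ≡ true →
                 nextTracks s c ≡ represent (initial M)
    next-start s c@((true ∷ _) ∷ _ ∷ _) refl = trans (apply-set (controlBits (running startState)) c) (sym represent-initial)

    next-final : ∀ s b → nextTracks s (finalTracks (finalOf b)) ≡ finalTracks (finalOf b)
    next-final s b = trans (cong (λ ms → applyAll ms (finalTracks (finalOf b))) (lemma b)) (apply-keep (finalTracks (finalOf b)))
      where
      lemma : ∀ b → modes s (Vec.map Vec.head (finalTracks (finalOf b))) ≡ Vec.replicate tracks keep
      lemma b = trans (cong (modes s) (head-single (controlBits (finalOf b))))
        (trans (modes-layout s false false (codeFin (finalOf b)) blankWork)
          (trans (cong (λ i → modesFor s false i blankWork) (decodeFin-codeFin (finalOf b))) (keeps b)))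
        where
        keeps : ∀ b → modesFor s false (finalOf b) blankWork ≡ Vec.replicate tracks keep
        keeps true  = refl
        keeps false = refl

-- Configurations as variables

cut : ∀ {A : Set} m k → Vec A (m * k) → Vec (Vec A k) m
cut zero    k v = []
cut (suc m) k v = Vec.take k v ∷ cut m k (Vec.drop k v)

cut-concat : ∀ {A : Set} {m k} (vs : Vec (Vec A k) m) → cut m k (Vec.concat vs) ≡ vs
cut-concat []       = refl
cut-concat (v ∷ vs) = cong₂ _∷_ (take-++ v (Vec.concat vs))
  (trans (cong (cut _ _) (drop-++ v (Vec.concat vs))) (cut-concat vs))

concat-cut : ∀ {A : Set} m k (v : Vec A (m * k)) → Vec.concat (cut m k v) ≡ v
concat-cut zero    k [] = refl
concat-cut (suc m) k v  = trans (cong (Vec.take k v Vec.++_) (concat-cut m k (Vec.drop k v))) (Vec.take++drop≡id k v)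

-- What the head position and the length of the input tell about the scanned cell, without the input
-- itself; the circuit for length `n` may depend on this much.
data Kind (n : ℕ) : Set where
  atLeft atRight : Kind n
  atLetter       : Fin n → Kind n

kindOf : ∀ n → ℕ → Kind n
kindOf n zero    = atLeft
kindOf n (suc i) with i <? n
... | yes i<n = atLetter (Fin.fromℕ< i<n)
... | no  _   = atRight

cellOf : ∀ {n} → Kind n → Bool → InputCell Bool
cellOf atLeft       b = ⊢
cellOf atRight      b = ⊣
cellOf (atLetter _) b = letter b

-- At a marker the two successors coincide, and `true` simply selects the first.
letterOf : ∀ {n} → Vec Bool n → Kind n → Bool
letterOf x (atLetter i) = Vec.lookup x i
letterOf x _            = true

readInput-letter : ∀ {n} (x : Vec Bool n) i → readInput (Vec.toList x) (suc (toℕ i)) ≡ letter (Vec.lookup x i)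
readInput-letter (a ∷ x) 0F    = refl
readInput-letter (a ∷ x) (Fin.suc i) = readInput-letter x i

readInput-⊣ : ∀ {n} (x : Vec Bool n) i → n ≤ i → readInput (Vec.toList x) (suc i) ≡ ⊣
readInput-⊣ []      i       _       = refl
readInput-⊣ (a ∷ x) (suc i) (s≤s p) = readInput-⊣ x i p

readInput-kind : ∀ {n} (x : Vec Bool n) i → readInput (Vec.toList x) i ≡ cellOf (kindOf n i) (letterOf x (kindOf n i))
readInput-kind {n} x zero    = refl
readInput-kind {n} x (suc i) with i <? n
... | yes i<n = trans (cong (λ j → readInput (Vec.toList x) (suc j)) (sym (Fin.toℕ-fromℕ< i<n)))
                  (readInput-letter x (Fin.fromℕ< i<n))
... | no i≮n  = readInput-⊣ x i (≮⇒≥ i≮n)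

moveInput-bound : ∀ {n} (x : Vec Bool n) d i → i ≤ suc n → moveInput (Vec.toList x) d i ≤ suc n
moveInput-bound x left  i p = ≤-trans pred[n]≤n p
moveInput-bound x stay  i p = p
moveInput-bound {n} x right i p with i ≤? n
moveInput-bound {n} x right i p | yes i≤n with readInput (Vec.toList x) i
... | ⊢        = s≤s i≤n
... | ⊣        = p
... | letter _ = s≤s i≤n
moveInput-bound {n} x right zero    p | no i≰n = ⊥-elim (i≰n z≤n)
moveInput-bound {n} x right (suc i) p | no i≰n rewrite readInput-⊣ x i (≤-pred (≰⇒> i≰n)) = p

length-properVecs : ∀ k → 2 + length (properVecs k) ≡ 2 ^ suc k
length-properVecs k = begin
  2 + length (properVecs k)        ≡⟨ cong suc (+-comm 1 (length (properVecs k))) ⟩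
  suc (length (properVecs k) + 1)  ≡⟨ cong suc (List.length-++ (properVecs k)) ⟨
  suc (length (nonzeroVecs k))     ≡⟨ cong length (allVecs-suc k) ⟨
  length (allVecs (suc k))         ≡⟨ length-allVecs (suc k) ⟩
  2 ^ suc k                        ∎
  where open ≡-Reasoning

module Registers (M : TM Bool) (l : ℕ) where

  open Simulation M

  dim : ℕ
  dim = l + tracks′ * suc l

  private
    R : Set
    R = Vec Bool (suc dim)

  toTracks : R → Vec (Vec Bool (suc l)) tracks
  toTracks = cut tracks (suc l)

  position : R → ℕ
  position c = val (Vec.head (Vec.tail (toTracks c)))

  kind : ∀ n → R → Kind n
  kind n c = kindOf n (position c)

  successor : ℕ → Bool → R → R
  successor n b c = Vec.concat (nextTracks (cellOf (kind n c) b) (toTracks c))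

  finalReg : Bool → R
  finalReg b = Vec.concat (finalTracks (finalOf {l} b))

  successor-final : ∀ n a b → successor n a (finalReg b) ≡ finalReg b
  successor-final n a b = cong Vec.concat (trans (cong (nextTracks s) (cut-concat (finalTracks (finalOf {l} b)))) (next-final s b))
    where s = cellOf (kind n (finalReg b)) a

  controlBits-zero : controlBits 0F ≡ zeros tracks
  controlBits-zero = cong (λ v → false ∷ false ∷ v)
    (trans (cong (zeros (1 + TM.states M) Vec.++_) (blanks (TM.tapes M))) (replicate-++ (1 + TM.states M) false))
    where
    m = TM.letters M
    blanks : ∀ t → flatTriples {l = m} (Vec.replicate t (zeros m , zeros m , zeros m)) ≡ zeros (t * (m + (m + m)))
    blanks zero    = refl
    blanks (suc t) = trans (cong₂ Vec._++_ (trans (cong (zeros m Vec.++_) (replicate-++ m false)) (replicate-++ m false)) (blanks t))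
                       (replicate-++ (m + (m + m)) false)

  concat-zeros : ∀ m k → Vec.concat (single {k} (zeros m)) ≡ zeros (m * suc k)
  concat-zeros zero    k = refl
  concat-zeros (suc m) k = trans (cong (zeros (suc k) Vec.++_) (concat-zeros m k)) (replicate-++ (suc k) false)

  -- The control code 0 and the blank both consist of zeros. So acc is the variable of the first
  -- block.
  accept≡zeros : finalReg true ≡ zeros (suc dim)
  accept≡zeros = trans (cong (Vec.concat ∘ single) controlBits-zero) (concat-zeros tracks l)

  reject≢zeros : finalReg false ≢ zeros (suc dim)
  reject≢zeros eq with trans (sym (head-single {l} (controlBits 1F)))
    (trans (cong (Vec.map Vec.head) (trans (sym (cut-concat (finalTracks (finalOf {l} false))))
      (trans (cong toTracks (trans eq (sym accept≡zeros))) (cut-concat (finalTracks (finalOf {l} true))))))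
      (head-single {l} (controlBits 0F)))
  ... | ()

  initialReg : R
  initialReg = Vec.concat (represent (initial M))

  -- The flag is the first bit of a word, and where it is set the modes write the initial
  -- configuration.
  successor-ones : ∀ n b → successor n b (ones (suc dim)) ≡ initialReg
  successor-ones n b = cong Vec.concat (next-start (cellOf (kind n (ones (suc dim))) b) (toTracks (ones (suc dim))) refl)

  module _ {n : ℕ} (x : Vec Bool n) where

    choice : R → Bool
    choice c = letterOf x (kind n c)

    succ : R → R
    succ = follow (successor n true) (successor n false) choice

    next-≡ : ∀ c → succ c ≡ Vec.concat (nextTracks (readInput (Vec.toList x) (position c)) (toTracks c))
    next-≡ c rewrite readInput-kind x (position c) with letterOf x (kindOf n (position c))
    ... | true  = refl
    ... | false = refl

    module _ (small : suc n < 2 ^ suc l) where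

      position-represent : ∀ c → Config.inputHead c ≤ suc n → position (Vec.concat (represent c)) ≡ Config.inputHead c
      position-represent (config q i ts) p = trans {j = val (pad (suc l) (bin i))}
        (cong (λ c → val (Vec.head (Vec.tail c))) (cut-concat (represent {l} (config q i ts))))
        (val-pad-bin (suc l) i (≤-trans (s≤s p) small))

      next-represent : ∀ c → Config.inputHead c ≤ suc n → succ (Vec.concat (represent c)) ≡
                       Vec.concat (nextTracks (readInput (Vec.toList x) (Config.inputHead c)) (represent c))
      next-represent c p = trans (next-≡ (Vec.concat (represent c))) (cong Vec.concat
        (cong₂ (λ i t → nextTracks (readInput (Vec.toList x) i) t) (position-represent c p) (cut-concat (represent c))))

      step-bound : ∀ c {c′} → Config.inputHead c ≤ suc n → step M (Vec.toList x) c ≡ inj₂ c′ → Config.inputHead c′ ≤ suc n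
      step-bound (config q i ts) p eq
        with TM.δ M q (readInput (Vec.toList x) i) (Vec.map scanned ts)
      step-bound (config q i ts) p refl | move q′ d as = moveInput-bound x d i p

      -- The additional step leads from the halting configuration to the final one.
      run-final : ∀ {s c t b} → s ≤ suc l → Config.inputHead c ≤ suc n → Run M (Vec.toList x) (UsesSpace≤ M s) c t b →
                  iterate succ (Vec.concat (represent c)) (suc t) ≡ finalReg b
      run-final {c = c} s≤ p (stop space eq) =
        trans (next-represent c p) (cong Vec.concat (next-halt (Vec.toList x) c eq))
      run-final {c = c} {t = suc t} s≤ p (next {c′ = c′} space eq run) = trans
        (cong (λ r → iterate succ r (suc t)) (trans (next-represent c p)
          (cong Vec.concat (next-move (Vec.toList x) c (VecAll.map (λ q → ≤-trans q s≤) space) eq))))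
        (run-final s≤ (step-bound c p eq) run)

      formula : Formula
      formula = programFormula (successor n true) (successor n false) choice (properBlocks dim)

      formula-correct : ∀ {s b} → s ≤ suc l → AnswersInSpace M (Vec.toList x) s b → Satisfiable formula ⇔ b ≡ true
      formula-correct {b = true} s≤ (t , run) = mk⇔ (λ _ → refl) (λ _ → sat)
        where
        accepting : iterate succ initialReg (suc t) ≡ zeros (suc dim)
        accepting = trans (run-final s≤ z≤n run) accept≡zeros
        fixed : ∀ a → successor n a (zeros (suc dim)) ≡ zeros (suc dim)
        fixed a = subst (λ c → successor n a c ≡ c) accept≡zeros (successor-final n a true)
        from-ones : succ (ones (suc dim)) ≡ initialReg
        from-ones with choice (ones (suc dim))
        ... | true  = successor-ones n true
        ... | false = successor-ones n false
        sat : Satisfiable formula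
        -- Counting from `ones` instead of the initial configuration saves a step: the latter then
        -- arrives within `2 ^ suc dim - 2` steps, which is the number of complete rounds.
        sat with early-visit succ {ones (suc dim)} (2 + t)
                   (trans (cong (λ c → iterate succ c (suc t)) from-ones) accepting)
        ... | suc r , r< , eq = subst (λ cs → Satisfiable (programFormula (successor n true) (successor n false) choice cs))
          (sym (properBlocks-≡ dim))
          (programFormula-sat (successor n true) (successor n false) choice
            (trans (successor-ones n true) (sym (successor-ones n false))) (fixed true) (fixed false) (properVecs dim) r
            (≤-pred (≤-pred (subst (2 + r ≤_) (sym (length-properVecs dim)) r<)))
            (trans (cong (λ c → iterate succ c r) (trans (successor-ones n false) (sym from-ones))) eq))
      formula-correct {b = false} s≤ (t , run) = mk⇔
        (λ sat → ⊥-elim (programFormula-unsat (successor n true) (successor n false) choice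
            (trans (successor-ones n true) (sym (successor-ones n false))) (fixed true) (fixed false) (properBlocks dim)
            (successor-final n true false) (successor-final n false false) reject≢zeros (suc t)
            (trans (cong (λ c → iterate succ c (suc t)) (successor-ones n false)) (run-final s≤ z≤n run)) sat))
        (λ ())
        where
        fixed : ∀ a → successor n a (zeros (suc dim)) ≡ zeros (suc dim)
        fixed a = subst (λ c → successor n a c ≡ c) accept≡zeros (successor-final n a true)

      word-correct : ∀ {s b} → s ≤ suc l → AnswersInSpace M (Vec.toList x) s b →
                     MSAT (programWord (successor n true) (successor n false) choice) ⇔ b ≡ true
      word-correct s≤ run = mk⇔ (to (formula-correct s≤ run) ∘ to eq) (from eq ∘ from (formula-correct s≤ run))
        where
        open Equivalence
        eq : MSAT (programWord (successor n true) (successor n false) choice) ⇔ Satisfiable formula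
        eq = MSAT-programWord (successor n true) (successor n false) choice
               (subst (λ c → successor n true c ≡ c) accept≡zeros (successor-final n true true))

-- Machines which sweep their work tape

record Finite (A : Set) : Set where
  field
    card        : ℕ
    index       : A → Fin card
    element     : Fin card → A
    element-index : ∀ a → element (index a) ≡ a

open Finite

finiteFin : ∀ n → Finite (Fin n)
finiteFin n = record { card = n ; index = id ; element = id ; element-index = λ _ → refl }

finite⊤ : Finite ⊤
finite⊤ = record { card = 1 ; index = λ _ → 0F ; element = λ _ → tt ; element-index = λ _ → refl }

finiteBool : Finite Bool
finiteBool = record
  { card          = 2
  ; index         = λ { false → 0F ; true → 1F }
  ; element       = λ { 0F → false ; (Fin.suc _) → true }
  ; element-index = λ { false → refl ; true → refl }
  }

finite× : ∀ {A B : Set} → Finite A → Finite B → Finite (A × B)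
finite× fa fb = record
  { card          = card fa * card fb
  ; index         = λ { (a , b) → Fin.combine (index fa a) (index fb b) }
  ; element       = λ i → Product.map (element fa) (element fb) (Fin.remQuot (card fb) i)
  ; element-index = λ { (a , b) → trans (cong (Product.map (element fa) (element fb)) (Fin.remQuot-combine (index fa a) (index fb b)))
                                    (cong₂ _,_ (element-index fa a) (element-index fb b)) }
  }

finite⊎ : ∀ {A B : Set} → Finite A → Finite B → Finite (A ⊎ B)
finite⊎ fa fb = record
  { card          = card fa + card fb
  ; index         = Fin.join (card fa) (card fb) ∘ Sum.map (index fa) (index fb)
  ; element       = Sum.map (element fa) (element fb) ∘ Fin.splitAt (card fa)
  ; element-index = λ s → trans (cong (Sum.map (element fa) (element fb)) (Fin.splitAt-join (card fa) (card fb) (Sum.map (index fa) (index fb) s)))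
                            (back s)
  }
  where
  back : ∀ s → Sum.map (element fa) (element fb) (Sum.map (index fa) (index fb) s) ≡ s
  back (inj₁ a) = cong inj₁ (element-index fa a)
  back (inj₂ b) = cong inj₂ (element-index fb b)

finiteVec : ∀ {A : Set} → Finite A → ∀ n → Finite (Vec A n)
finiteVec fa zero    = record { card = 1 ; index = λ _ → 0F ; element = λ _ → [] ; element-index = λ { [] → refl } }
finiteVec fa (suc n) = record
  { card          = card f
  ; index         = λ { (a ∷ v) → index f (a , v) }
  ; element       = λ i → proj₁ (element f i) ∷ proj₂ (element f i)
  ; element-index = λ { (a ∷ v) → cong (λ p → proj₁ p ∷ proj₂ p) (element-index f (a , v)) }
  }
  where f = finite× fa (finiteVec fa n)

peek : ∀ {Σ : Set} → List Σ → InputCell Σ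
peek []      = ⊣
peek (a ∷ _) = letter a

advance : ∀ {Σ : Set} → Bool → List Σ → List Σ
advance true  r = List.drop 1 r
advance false r = r

direction : Bool → Direction
direction true  = right
direction false = stay

readInput-++ : ∀ {Σ : Set} (pre r : List Σ) → readInput (pre ++ r) (suc (length pre)) ≡ peek r
readInput-++ []        []      = refl
readInput-++ []        (a ∷ r) = refl
readInput-++ (_ ∷ pre) r       = readInput-++ pre r

-- Programs over a finite memory X and a work tape which is a row of cells.
-- An instruction inspects the current input letter, which it may consume;
-- `look` also inspects the first cell, and `sweep` passes over all cells.

module Programs {Σ X Cell : Set} where

  data Instr : Set where
    look  : (X → InputCell Σ → Cell → X × Bool) → Instr
    sweep : (X → InputCell Σ → Cell → X × Cell × Bool) → Instr

  sweepCells : ∀ {k} → (X → InputCell Σ → Cell → X × Cell × Bool) →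
               X → Vec Cell k → List Σ → X × Vec Cell k × List Σ
  sweepCells f x []       r = x , [] , r
  sweepCells f x (c ∷ cs) r =
    let x₁ , c₁ , b = f x (peek r) c
        x₂ , cs₂ , r₂ = sweepCells f x₁ cs (advance b r)
    in x₂ , c₁ ∷ cs₂ , r₂

  exec : ∀ {k} → List Instr → X → Vec Cell (suc k) → List Σ → X × Vec Cell (suc k) × List Σ
  exec []             x cs       r = x , cs , r
  exec (look f ∷ is)  x (c ∷ cs) r =
    let x₁ , b = f x (peek r) c in exec is x₁ (c ∷ cs) (advance b r)
  exec (sweep f ∷ is) x cs       r =
    let x₁ , cs₁ , r₁ = sweepCells f x cs r in exec is x₁ cs₁ r₁

  -- Opaque, or else conversion would run programs symbolically.

  opaque

    outcome : ∀ {k} → List Instr → (X → Bool) → X → Vec Cell (suc k) → List Σ → Bool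
    outcome is f x cs r = f (proj₁ (exec is x cs r))

    outcome-≡ : ∀ {k} is f x (cs : Vec Cell (suc k)) r → outcome is f x cs r ≡ f (proj₁ (exec is x cs r))
    outcome-≡ is f x cs r = refl

  exec-++ : ∀ {k} is js x (cs : Vec Cell (suc k)) r →
            exec (is ++ js) x cs r ≡ (let x₁ , cs₁ , r₁ = exec is x cs r in exec js x₁ cs₁ r₁)
  exec-++ []             js x cs       r = refl
  exec-++ (look f ∷ is)  js x (c ∷ cs) r = exec-++ is js _ _ _
  exec-++ (sweep f ∷ is) js x cs       r = exec-++ is js _ _ _

  -- A sweep needs `suc n` moves each way: `n` cells and the blank at which it turns.
  duration : ℕ → List Instr → ℕ
  duration n []             = 0
  duration n (look _ ∷ is)  = suc (duration n is)
  duration n (sweep _ ∷ is) = suc n + (suc n + duration n is)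

  duration-bound : ∀ n is → duration n is ≤ length is * (suc n + suc n)
  duration-bound n []             = z≤n
  duration-bound n (look _ ∷ is)  = +-mono-≤ (s≤s z≤n) (duration-bound n is)
  duration-bound n (sweep _ ∷ is) = ≤-trans (≤-reflexive (sym (+-assoc (suc n) (suc n) (duration n is))))
                                      (+-monoʳ-≤ (suc n + suc n) (duration-bound n is))

  suffix : (is : List Instr) → Fin (suc (length is)) → List Instr
  suffix is       0F    = is
  suffix (_ ∷ is) (Fin.suc p) = suffix is p

  following : ∀ {n} → Fin (suc n) → Fin (suc n)
  following {zero}  p           = p
  following {suc n} 0F    = 1F
  following {suc n} (Fin.suc p) = Fin.suc (following p)

  suffix-following : ∀ is p {i js} → suffix is p ≡ i ∷ js → suffix is (following p) ≡ js
  suffix-following (i ∷ is) 0F    refl = zero-suffix is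
    where
    zero-suffix : ∀ is → suffix is 0F ≡ is
    zero-suffix []      = refl
    zero-suffix (_ ∷ _) = refl
  suffix-following []       0F    ()
  suffix-following (_ ∷ is) (Fin.suc p) eq = suffix-following is p eq

  -- The machine first lays out `suc m` cells for each letter satisfying
  -- `marks`, and for the left marker, up to the first letter which does not.

  module Machine (finX : Finite X) (finC : Finite Cell) (x₀ : X) (c₀ : Cell)
                 (marks : Σ → Bool) (m : ℕ) (program : List Instr) (answer : X → Bool) where

    State : Set
    State = Fin (suc m) ⊎ (⊤ ⊎ (Bool × (Fin (suc (length program)) × X)))

    pattern marking j  = inj₁ j
    pattern rewinding  = inj₂ (inj₁ tt)
    pattern executing p x    = inj₂ (inj₂ (true , (p , x)))
    pattern back p x   = inj₂ (inj₂ (false , (p , x)))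

    abstract

      finState : Finite State
      finState = finite⊎ (finiteFin (suc m)) (finite⊎ finite⊤ (finite× finiteBool (finite× (finiteFin _) finX)))

    -- The blank is kept distinct from every cell, so that both ends of the row can be recognised.
    Letter : Set
    Letter = Fin (suc (card finC))

    toLetter : Cell → Letter
    toLetter c = Fin.suc (index finC c)

    fromLetter : Letter → Maybe Cell
    fromLetter 0F    = nothing
    fromLetter (Fin.suc i) = just (element finC i)

    Move : Set
    Move = State × Direction × Letter × Direction

    -- Besides the cell being written, `j` further ones are due for the current input position. With
    -- the last of them the input head moves on and the count restarts.
    mark : Fin (suc m) → Move
    mark 0F    = marking (Fin.fromℕ m) , right , toLetter c₀ , right
    mark (Fin.suc j) = marking (Fin.inject₁ j) , stay , toLetter c₀ , right

    perform : List Instr → Fin (suc (length program)) → X → InputCell Σ → Maybe Cell → Bool ⊎ Move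
    perform []            p x a _        = inj₁ (answer x)
    -- A `look` takes place on the first cell, so this default is never reached in the runs below.
    perform (look f ∷ _)  p x a nothing  = inj₁ false
    perform (look f ∷ _)  p x a (just c) =
      inj₂ (executing (following p) (proj₁ (f x a c)) , direction (proj₂ (f x a c)) , toLetter c , stay)
    perform (sweep f ∷ _) p x a nothing  = inj₂ (back (following p) x , stay , 0F , left)
    perform (sweep f ∷ _) p x a (just c) =
      let x₁ , c₁ , b = f x a c in inj₂ (executing p x₁ , direction b , toLetter c₁ , right)

    transition : State → InputCell Σ → Letter → Bool ⊎ Move
    transition (marking j) ⊢          s = inj₂ (mark j)
    transition (marking j) ⊣          s = inj₁ false
    transition (marking j) (letter a) s with marks a
    ... | true  = inj₂ (mark j)
    ... | false = inj₂ (rewinding , left , 0F , left)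
    transition rewinding   ⊢          s = inj₂ (back 0F x₀ , right , s , stay)
    transition rewinding   _          s = inj₂ (rewinding , left , s , stay)
    transition (executing p x)   a          s = perform (suffix program p) p x a (fromLetter s)
    transition (back p x)  a          s with fromLetter s
    ... | nothing = inj₂ (executing p x , stay , s , right)
    ... | just _  = inj₂ (back p x , stay , s , left)

    action : Bool ⊎ Move → Action (card finState) 1 (suc (card finC))
    action (inj₁ b)                  = halt b
    action (inj₂ (q , d , s , d′))   = move (index finState q) d ((s , d′) ∷ [])

    machine : TM Σ
    machine = record
      { states  = card finState
      ; tapes   = 1
      ; letters = card finC
      ; start   = index finState (marking (Fin.fromℕ m))
      ; δ       = λ { q a (s ∷ []) → action (transition (element finState q) a s) }
      }

    blanks : ℕ → List Letter
    blanks k = List.replicate k 0F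

    -- The cells left of the head (nearest first) and right of it, with the
    -- numbers of the visited blanks beyond them. The head is on the first
    -- cell on the right in `fwd`, and on the first on the left in `bwd`.

    fwd bwd : List Cell → List Cell → ℕ → ℕ → Tape (card finC)
    fwd rs []       j k = tape (List.map toLetter rs ++ blanks j) 0F (blanks (pred k))
    fwd rs (c ∷ cs) j k = tape (List.map toLetter rs ++ blanks j) (toLetter c) (List.map toLetter cs ++ blanks k)
    bwd []       cs j k = tape (blanks (pred j)) 0F (List.map toLetter cs ++ blanks k)
    bwd (c ∷ rs) cs j k = tape (List.map toLetter rs ++ blanks j) (toLetter c) (List.map toLetter cs ++ blanks k)

    fwd-right : ∀ rs c cs j k d → actOn (fwd rs (c ∷ cs) j k) (toLetter d , right) ≡ fwd (d ∷ rs) cs j k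
    fwd-right rs c []       j zero    d = refl
    fwd-right rs c []       j (suc k) d = refl
    fwd-right rs c (_ ∷ cs) j k       d = refl

    fwd-left : ∀ rs j k → actOn (fwd rs [] j k) (0F , left) ≡ bwd rs [] j (suc (pred k))
    fwd-left []       zero    k = refl
    fwd-left []       (suc j) k = refl
    fwd-left (_ ∷ rs) j       k = refl

    bwd-left : ∀ c rs cs j k → actOn (bwd (c ∷ rs) cs j k) (toLetter c , left) ≡ bwd rs (c ∷ cs) j k
    bwd-left c []       cs zero    k = refl
    bwd-left c []       cs (suc j) k = refl
    bwd-left c (_ ∷ rs) cs j       k = refl

    bwd-right : ∀ cs j k → actOn (bwd [] cs j k) (0F , right) ≡ fwd [] cs (suc (pred j)) k
    bwd-right []       j zero    = refl
    bwd-right []       j (suc k) = refl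
    bwd-right (_ ∷ cs) j k       = refl

    -- One less than the number `suc n * suc m` of cells, those for the left marker included.
    size : ℕ → ℕ
    size n = m + n * suc m

    -- The summands stand for laying out the row, rewinding the input, returning to the first cell
    -- and executing the program; the last `suc` accounts for the turn at the first unmarked letter.
    totalTime : ℕ → ℕ
    totalTime n = suc (size n) + (suc n + (suc (suc (size n)) + suc (duration (suc (size n)) program)))

    module _ (w : List Σ) where

      Ends : ℕ → State → ℕ → Tape (card finC) → Bool → Set
      Ends t q i tp b = Run machine w (λ _ → ⊤) (config (index finState q) i (tp ∷ [])) t b

      move-step : ∀ {t q i tp b q′ d s d′} → transition q (readInput w i) (scanned tp) ≡ inj₂ (q′ , d , s , d′) →
                  Ends t q′ (moveInput w d i) (actOn tp (s , d′)) b → Ends (suc t) q i tp b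
      move-step {q = q} {i} {tp} {q′ = q′} {d} {s} {d′} eq rest = next tt moves rest
        where
        moves : step machine w (config (index finState q) i (tp ∷ [])) ≡
                inj₂ (config (index finState q′) (moveInput w d i) (actOn tp (s , d′) ∷ []))
        moves rewrite element-index finState q | eq = refl

      halt-step : ∀ {q i tp b} → transition q (readInput w i) (scanned tp) ≡ inj₁ b → Ends 0 q i tp b
      halt-step {q = q} {i} {tp} {b} eq = stop tt halts
        where
        halts : step machine w (config (index finState q) i (tp ∷ [])) ≡ inj₁ b
        halts rewrite element-index finState q | eq = refl

      Reads : ℕ → List Σ → Set
      Reads i r = ∃[ pre ] w ≡ pre ++ r × i ≡ suc (length pre)

      reads-peek : ∀ {i r} → Reads i r → readInput w i ≡ peek r
      reads-peek {r = r} (pre , refl , refl) = readInput-++ pre r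

      reads-advance : ∀ {i r} b → Reads i r → Reads (moveInput w (direction b) i) (advance b r)
      reads-advance               false p = p
      reads-advance {i} {[]}      true p@(pre , eq , eq′) with readInput w i | reads-peek p
      ... | _ | refl = p
      reads-advance {i} {a ∷ r}   true p@(pre , eq , eq′) with readInput w i | reads-peek p
      ... | _ | refl = pre ++ [ a ] , trans eq (sym (List.++-assoc pre [ a ] r)) ,
        cong suc (trans eq′ (trans (+-comm 1 (length pre)) (sym (List.length-++ pre))))

      decode-encode : ∀ c → fromLetter (toLetter c) ≡ just c
      decode-encode c = cong just (element-index finC c)

      back-run : ∀ {t p x i b} rs cs j k → Ends t (executing p x) i (fwd [] (rs List.ʳ++ cs) (suc (pred j)) k) b →
                 Ends (suc (length rs) + t) (back p x) i (bwd rs cs j k) b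
      back-run {t} {p} {x} {i} {b} [] cs j k end = move-step refl (subst (λ tp → Ends t (executing p x) i tp b) (sym (bwd-right cs j k)) end)
      back-run {t} {p} {x} {i} {b} (c ∷ rs) cs j k end = move-step refl
        (subst (λ tp → Ends (suc (length rs) + t) (back p x) i tp b) (sym (bwd-left c rs cs j k)) (back-run rs (c ∷ cs) j k end))

      sweep-run : ∀ {n t p b f js} rs (cs : Vec Cell n) x i r j k → suffix program p ≡ sweep f ∷ js → Reads i r →
        let x₁ , cs₁ , r₁ = sweepCells f x cs r in
        (∀ i₁ → Reads i₁ r₁ → Ends t (back (following p) x₁) i₁ (bwd (Vec.toList cs₁ List.ʳ++ rs) [] j (suc (pred k))) b) →
        Ends (suc n + t) (executing p x) i (fwd rs (Vec.toList cs) j k) b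
      sweep-run {t = t} {p} {b} {f} {js} rs [] x i r j k eq reads end =
        move-step (cong (λ js → perform js p x (readInput w i) nothing) eq)
          (subst (λ tp → Ends t (back (following p) x) i tp b) (sym (fwd-left rs j k)) (end i reads))
      sweep-run {suc n} {t} {p} {b} {f} {js} rs (c ∷ cs) x i r j k eq reads end =
        move-step (trans (cong₂ (λ a s → perform (suffix program p) p x a s) (reads-peek reads) (decode-encode c))
                     (cong (λ js → perform js p x (peek r) (just c)) eq))
          (subst (λ tp → Ends (suc n + t) (executing p x₁) (moveInput w (direction b₁) i) tp b)
            (sym (fwd-right rs c (Vec.toList cs) j k c₁))
            (sweep-run (c₁ ∷ rs) cs x₁ _ (advance b₁ r) j k eq (reads-advance b₁ reads) end))
        where
        x₁ = proj₁ (f x (peek r) c)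
        c₁ = proj₁ (proj₂ (f x (peek r) c))
        b₁ = proj₂ (proj₂ (f x (peek r) c))

      exec-run : ∀ {n} is p (cs : Vec Cell (suc n)) x i r j k → suffix program p ≡ is → Reads i r →
                 Ends (duration (suc n) is) (executing p x) i (fwd [] (Vec.toList cs) j k) (answer (proj₁ (exec is x cs r)))
      exec-run [] p (c ∷ cs) x i r j k eq reads =
        halt-step (cong (λ js → perform js p x (readInput w i) (fromLetter (toLetter c))) eq)
      exec-run (look f ∷ is) p (c ∷ cs) x i r j k eq reads =
        move-step (trans (cong₂ (λ a s → perform (suffix program p) p x a s) (reads-peek reads) (decode-encode c))
                     (cong (λ js → perform js p x (peek r) (just c)) eq))
          (exec-run is (following p) (c ∷ cs) _ _ _ j k (suffix-following program p eq)
            (reads-advance (proj₂ (f x (peek r) c)) reads))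
      exec-run {n} (sweep f ∷ is) p cs x i r j k eq reads =
        sweep-run {p = p} {b = b} [] cs x i r j k eq reads λ i₁ reads₁ →
          subst (λ t → Ends t (back (following p) x₁) i₁ (bwd (Vec.toList cs₁ List.ʳ++ []) [] j (suc (pred k))) b)
            (cong (λ l → suc l + duration (suc n) is) len)
            (back-run (Vec.toList cs₁ List.ʳ++ []) [] j (suc (pred k))
              (subst (λ l → Ends (duration (suc n) is) (executing (following p) x₁) i₁ (fwd [] l (suc (pred j)) (suc (pred k))) b) (sym twice)
                (exec-run is (following p) cs₁ x₁ i₁ r₁ (suc (pred j)) (suc (pred k)) (suffix-following program p eq) reads₁)))
        where
        x₁ = proj₁ (sweepCells f x cs r)
        cs₁ = proj₁ (proj₂ (sweepCells f x cs r))
        r₁ = proj₂ (proj₂ (sweepCells f x cs r))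
        b  = answer (proj₁ (exec is x₁ cs₁ r₁))
        twice : (Vec.toList cs₁ List.ʳ++ []) List.ʳ++ [] ≡ Vec.toList cs₁
        twice = trans (List.ʳ++-ʳ++ (Vec.toList cs₁)) (List.++-identityʳ _)
        len : length (Vec.toList cs₁ List.ʳ++ []) ≡ suc n
        len = trans (List.length-ʳ++ (Vec.toList cs₁)) (trans (+-identityʳ _) (Vec.length-toList cs₁))

      row : ℕ → List Cell
      row n = List.replicate n c₀

      row-ʳ++ : ∀ a b → row a List.ʳ++ row b ≡ row (a + b)
      row-ʳ++ zero    b = refl
      row-ʳ++ (suc a) b = trans (row-ʳ++ a (suc b)) (cong row (+-suc a b))

      mark-run : ∀ {t i b} n (j : Fin (suc m)) a → toℕ j ≡ n →
        (∀ j → transition (marking j) (readInput w i) 0F ≡ inj₂ (mark j)) →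
        Ends t (marking (Fin.fromℕ m)) (moveInput w right i) (fwd (row (suc n + a)) [] 0 0) b →
        Ends (suc n + t) (marking j) i (fwd (row a) [] 0 0) b
      mark-run .0 0F a refl marked end = move-step (marked 0F) end
      mark-run {t} {i} {b} (suc n) (Fin.suc j) a eq marked end = move-step (marked (Fin.suc j))
        (mark-run n (Fin.inject₁ j) (suc a) (trans (Fin.toℕ-inject₁ j) (suc-injective eq)) marked
          (subst (λ l → Ends t (marking (Fin.fromℕ m)) (moveInput w right i) (fwd (row (suc l)) [] 0 0) b) (sym (+-suc n a)) end))

      marks-run : ∀ {t i b c r} ms a → All (λ c → marks c ≡ true) ms → marks c ≡ false → Reads i (ms ++ c ∷ r) →
        Ends t rewinding (pred (length ms + i)) (bwd (row (length ms * suc m + a)) [] 0 1) b →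
        Ends (length ms * suc m + suc t) (marking (Fin.fromℕ m)) i (fwd (row a) [] 0 0) b
      marks-run {t} {i} {b} {c} {r} [] a [] stops reads end =
        move-step {tp = fwd (row a) [] 0 0} {q′ = rewinding} {d = left} {s = 0F} {d′ = left} turn (subst (λ tp → Ends t rewinding (pred i) tp b) (sym (fwd-left (row a) 0 0)) end)
        where
        turn : transition (marking (Fin.fromℕ m)) (readInput w i) 0F ≡ inj₂ (rewinding , left , 0F , left)
        turn rewrite reads-peek reads | stops = refl
      marks-run {t} {i} {b} {c} {r} (d ∷ ms) a (p ∷ ps) stops reads end =
        subst (λ l → Ends l (marking (Fin.fromℕ m)) i (fwd (row a) [] 0 0) b) (sym (+-assoc (suc m) (length ms * suc m) (suc t)))
          (mark-run m (Fin.fromℕ m) a (Fin.toℕ-fromℕ m) marked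
            (marks-run ms (suc m + a) ps stops (reads-advance true reads)
              (subst₂ (λ i′ n → Ends t rewinding (pred i′) (bwd (row n) [] 0 1) b) position count end)))
        where
        marked : ∀ j → transition (marking j) (readInput w i) 0F ≡ inj₂ (mark j)
        marked j rewrite reads-peek reads | p = refl
        moved : moveInput w right i ≡ suc i
        moved with readInput w i | reads-peek reads
        ... | _ | refl = refl
        position : suc (length ms) + i ≡ length ms + moveInput w right i
        position = sym (trans (cong (length ms +_) moved) (+-suc (length ms) i))
        count : suc (length ms) * suc m + a ≡ length ms * suc m + (suc m + a)
        count = trans (cong (_+ a) (+-comm (suc m) (length ms * suc m))) (+-assoc (length ms * suc m) (suc m) a)

      rewind-run : ∀ {t tp b} i → Ends t (back 0F x₀) 1 tp b → Ends (suc i + t) rewinding i tp b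
      rewind-run {t} {tp} {b} zero    end = move-step {tp = tp} {q′ = back 0F x₀} {d = right} {s = scanned tp} {d′ = stay} refl end
      rewind-run {t} {tp} {b} (suc i) end = move-step {tp = tp} {q′ = rewinding} {d = left} {s = scanned tp} {d′ = stay} (inside i w) (rewind-run i end)
        where
        inside : ∀ i w → transition rewinding (readInput w (suc i)) (scanned tp) ≡ inj₂ (rewinding , left , scanned tp , stay)
        inside i       []      = refl
        inside zero    (a ∷ w) = refl
        inside (suc i) (a ∷ w) = inside i w

      machine-run : ∀ {c r} ms → w ≡ ms ++ c ∷ r → All (λ c → marks c ≡ true) ms → marks c ≡ false →
        Run machine w (λ _ → ⊤) (initial machine) (totalTime (length ms))
          (answer (proj₁ (exec program x₀ (Vec.replicate (suc (size (length ms))) c₀) w)))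
      machine-run {c} {r} ms eq marked stops =
        subst (λ t → Ends t (marking (Fin.fromℕ m)) 0 (fwd [] [] 0 0) b) time
          (mark-run m (Fin.fromℕ m) 0 (Fin.toℕ-fromℕ m) (λ j → refl)
            (marks-run ms (suc m + 0) marked stops ([] , eq , refl)
              (subst₂ (λ i n → Ends (suc L + (suc (length (row N)) + D)) rewinding i (bwd (row n) [] 0 1) b)
                (sym (cong pred (+-comm (length ms) 1))) count
                (rewind-run L (back-run (row N) [] 0 1
                  (subst (λ cs → Ends D (executing 0F x₀) 1 (fwd [] cs 1 1) b) cells
                    (exec-run program 0F (Vec.replicate N c₀) x₀ 1 w 1 1 (zero-suffix′ program) ([] , refl , refl))))))))
        where
        L = length ms
        N = suc (size L)
        D = duration N program
        b = answer (proj₁ (exec program x₀ (Vec.replicate N c₀) w))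
        zero-suffix′ : ∀ is → suffix is 0F ≡ is
        zero-suffix′ []      = refl
        zero-suffix′ (_ ∷ _) = refl
        cells : Vec.toList (Vec.replicate N c₀) ≡ row N List.ʳ++ []
        cells = trans (Vec.toList-replicate N c₀) (sym (trans (row-ʳ++ N 0) (cong row (+-identityʳ N))))
        count : N ≡ L * suc m + (suc m + 0)
        count = trans (+-comm (suc m) (L * suc m)) (cong (L * suc m +_) (sym (+-identityʳ (suc m))))
        time : suc m + (L * suc m + suc (suc L + (suc (length (row N)) + D))) ≡ totalTime L
        time = begin
          suc m + (L * suc m + suc (suc L + (suc (length (row N)) + D)))
            ≡⟨ +-assoc (suc m) (L * suc m) _ ⟨
          N + suc (suc L + (suc (length (row N)) + D))
            ≡⟨ cong (λ l → N + suc (suc L + (suc l + D))) (List.length-replicate N) ⟩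
          N + suc (suc L + (suc N + D))
            ≡⟨ cong (N +_) (trans (cong suc (sym (+-assoc (suc L) (suc N) D)))
                 (trans (sym (+-suc (suc L + suc N) D)) (+-assoc (suc L) (suc N) (suc D)))) ⟩
          totalTime L ∎
          where open ≡-Reasoning

      machine-answers : ∀ {k c r} ms → length ms ≡ k → w ≡ ms ++ c ∷ r → All (λ c → marks c ≡ true) ms → marks c ≡ false →
        Run machine w (λ _ → ⊤) (initial machine) (totalTime k)
          (outcome program answer x₀ (Vec.replicate (suc (size k)) c₀) w)
      machine-answers ms refl eq marked stops = subst (Run machine w (λ _ → ⊤) (initial machine) (totalTime (length ms)))
        (sym (outcome-≡ program answer x₀ (Vec.replicate (suc (size (length ms))) c₀) w)) (machine-run ms eq marked stops)

-- Deciding the direct connection language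

data Asked : Set where
  askedOutput askedInput askedNeg askedAnd askedOr askedOracle askedWire : Asked

finiteAsked : Finite Asked
finiteAsked = record
  { card    = 7
  ; index   = λ
    { askedOutput → 0F
    ; askedInput  → 1F
    ; askedNeg    → 2F
    ; askedAnd    → 3F
    ; askedOr     → 4F
    ; askedOracle → 5F
    ; askedWire   → 6F
    }
  ; element = λ
    { 0F                                              → askedOutput
    ; 1F                                    → askedInput
    ; 2F                          → askedNeg
    ; 3F                → askedAnd
    ; 4F      → askedOr
    ; 5F → askedOracle
    ; (Fin.suc (Fin.suc (Fin.suc (Fin.suc (Fin.suc (Fin.suc _)))))) → askedWire
    }
  ; element-index = λ
    { askedOutput → refl ; askedInput → refl ; askedNeg → refl ; askedAnd → refl
    ; askedOr → refl ; askedOracle → refl ; askedWire → refl }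
  }

finiteRetract : ∀ {A B : Set} → Finite A → (f : B → A) (g : A → B) → (∀ b → g (f b) ≡ b) → Finite B
finiteRetract fa f g gf = record
  { card          = card fa
  ; index         = index fa ∘ f
  ; element       = g ∘ element fa
  ; element-index = λ b → trans (cong g (element-index fa (f b))) (gf b)
  }

finiteMode : Finite Mode
finiteMode = finiteRetract (finite× finiteBool (finite× finiteBool finiteBool))
  (λ { keep → false , false , false ; pop → false , false , true ; inc → false , true , false ; dec → false , true , true
     ; (set b) → true , false , b ; (push b) → true , true , b })
  (λ { (false , false , false) → keep ; (false , false , true) → pop ; (false , true , false) → inc ; (false , true , true) → dec
     ; (true , false , b) → set b ; (true , true , b) → push b })
  (λ { keep → refl ; pop → refl ; inc → refl ; dec → refl ; (set b) → refl ; (push b) → refl })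

-- `same` compares the number being read with the one that it replaces, and `tag` and `store` hold
-- the bits of a gate number outside the tracks. `matches`, `isZero`, `isFirst` and `isLast` are
-- arguments for `wordBit`; `z` and `le` give the kind of the head position, and `argument` says
-- whether it is the position of the input asked about. `mode` and `carried` belong to the automaton
-- running on a track.
record Memory : Set where
  field
    fine tag same result matches z le argument isZero isFirst isLast carried : Bool
    store  : Vec Bool 6
    mode  : Mode
    asked : Asked

abstract

  finiteMemory : Finite Memory
  finiteMemory = finiteRetract (finite× (finiteVec finiteBool 12) (finite× (finiteVec finiteBool 6) (finite× finiteMode finiteAsked)))
    (λ x → let open Memory x in
      (fine ∷ tag ∷ same ∷ result ∷ matches ∷ z ∷ le ∷ argument ∷ isZero ∷ isFirst ∷ isLast ∷ carried ∷ []) , store , mode , asked)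
    (λ { ((a ∷ b ∷ c ∷ d ∷ e ∷ f ∷ g ∷ h ∷ i ∷ j ∷ k ∷ l ∷ []) , store , mode , asked) → record
      { fine = a ; tag = b ; same = c ; result = d ; matches = e ; z = f ; le = g ; argument = h ; isZero = i
      ; isFirst = j ; isLast = k ; carried = l ; store = store ; mode = mode ; asked = asked } })
    (λ _ → refl)

-- Reading numbers from the tuple

bitOf isBit isHash : InputCell TupleSymbol → Bool
bitOf (letter (bit b)) = b
bitOf _                = false
isBit (letter (bit b)) = true
isBit _                = false
isHash (letter `#)     = true
isHash _               = false

NonBit : List TupleSymbol → Set
NonBit r = isBit (peek r) ≡ false

word : List Bool → List TupleSymbol → List TupleSymbol
word bs r = List.map bit bs ++ r

-- Past its last bit a number reads as `false` and nothing more is consumed, so that tracks longer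
-- than the number are filled up with zeros.
bitOf-word : ∀ bs {r} → NonBit r → bitOf (peek (word bs r)) ≡ firstBit bs
bitOf-word []       {r} p with peek r
... | ⊢           = refl
... | ⊣           = refl
... | letter `#      = refl
... | letter `output = refl
... | letter `input  = refl
... | letter `neg    = refl
... | letter `and    = refl
... | letter `or     = refl
... | letter `oracle = refl
bitOf-word (b ∷ bs) p = refl

advance-word : ∀ bs {r} → NonBit r → advance (isBit (peek (word bs r))) (word bs r) ≡ word (List.drop 1 bs) r
advance-word []       {r} p = cong (λ b → advance b r) p
advance-word (b ∷ bs) p = refl

drop-+ : ∀ {A : Set} m n (xs : List A) → List.drop (m + n) xs ≡ List.drop n (List.drop m xs)
drop-+ m n xs = sym (List.drop-drop m n xs)

drop-suc : ∀ {A : Set} k (xs : List A) → List.drop k (List.drop 1 xs) ≡ List.drop (suc k) xs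
drop-suc k xs = List.drop-drop 1 k xs

pad-+ : ∀ m n bs → pad (m + n) bs ≡ pad m bs Vec.++ pad n (List.drop m bs)
pad-+ zero    n bs = refl
pad-+ (suc m) n bs = cong (firstBit bs ∷_) (trans (pad-+ m n (List.drop 1 bs))
  (cong (λ l → pad m (List.drop 1 bs) Vec.++ pad n l) (drop-suc m bs)))

eqV-++ : ∀ {m n} (a b : Vec Bool m) {c d : Vec Bool n} → eqV (a Vec.++ c) (b Vec.++ d) ≡ eqV a b ∧ eqV c d
eqV-++ []      []      = refl
eqV-++ (x ∷ a) (y ∷ b) {c} {d} = begin
  eqV (x ∷ a Vec.++ c) (y ∷ b Vec.++ d)        ≡⟨ eqV-∷ x y _ _ ⟩
  compare? x y ∧ eqV (a Vec.++ c) (b Vec.++ d) ≡⟨ cong (compare? x y ∧_) (eqV-++ a b) ⟩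
  compare? x y ∧ (eqV a b ∧ eqV c d)           ≡⟨ Bool.∧-assoc (compare? x y) _ _ ⟨
  (compare? x y ∧ eqV a b) ∧ eqV c d           ≡⟨ cong (_∧ eqV c d) (eqV-∷ x y a b) ⟨
  eqV (x ∷ a) (y ∷ b) ∧ eqV c d                ∎
  where open ≡-Reasoning

eqV-replicate-++ : ∀ m {k} b (v : Vec Bool m) (w : Vec Bool k) →
  eqV (v Vec.++ w) (Vec.replicate (m + k) b) ≡ eqV v (Vec.replicate m b) ∧ eqV w (Vec.replicate k b)
eqV-replicate-++ m b v w = trans (cong (eqV (v Vec.++ w)) (sym (replicate-++ m b))) (eqV-++ v (Vec.replicate m b))

module Reading (B : ℕ) where

  Cell : Set
  Cell = Vec (Vec Bool B) 5

  Ix : Set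
  Ix = Fin 5 × Fin B

  get : Ix → Cell → Bool
  get (s , t) c = Vec.lookup (Vec.lookup c s) t

  put : Ix → Bool → Cell → Cell
  put (s , t) b c = Vec.updateAt c s (Vec._[ t ]≔ b)

  get-put : ∀ i b c → get i (put i b c) ≡ b
  get-put (s , t) b c = trans (cong (λ v → Vec.lookup v t) (Vec.lookup∘updateAt s c))
                          (Vec.lookup∘updateAt t (Vec.lookup c s))

  get-put′ : ∀ i j b c → i ≢ j → get i (put j b c) ≡ get i c
  get-put′ (s , t) (s′ , t′) b c i≢j with s Fin.≟ s′
  ... | no s≢s′ = cong (λ v → Vec.lookup v t) (Vec.lookup∘updateAt′ s s′ s≢s′ c)
  ... | yes refl = trans (cong (λ v → Vec.lookup v t) (Vec.lookup∘updateAt s c))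
                     (Vec.lookup∘updateAt′ t t′ (i≢j ∘ cong (s ,_)) (Vec.lookup c s))

  track : ∀ {k} → Ix → Vec Cell k → Vec Bool k
  track i = Vec.map (get i)

  putTrack : ∀ {k} → Ix → Vec Bool k → Vec Cell k → Vec Cell k
  putTrack i = Vec.zipWith (put i)

  track-putTrack : ∀ {k} i (v : Vec Bool k) cs → track i (putTrack i v cs) ≡ v
  track-putTrack i []      []       = refl
  track-putTrack i (b ∷ v) (c ∷ cs) = cong₂ _∷_ (get-put i b c) (track-putTrack i v cs)

  track-putTrack′ : ∀ {k} i j (v : Vec Bool k) cs → i ≢ j → track i (putTrack j v cs) ≡ track i cs
  track-putTrack′ i j []      []       p = refl
  track-putTrack′ i j (b ∷ v) (c ∷ cs) p = cong₂ _∷_ (get-put′ i j b c p) (track-putTrack′ i j v cs p)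

  open Programs {TupleSymbol} {Memory} {Cell} public

  -- A number is compared with the old content of the cells while it overwrites them. Thus the gate
  -- `h` of a wire is compared with the index `p` read before it.
  readTrack : Ix → Instr
  readTrack i = sweep λ x a c →
    record x { same = Memory.same x ∧ compare? (get i c) (bitOf a) } , put i (bitOf a) c , isBit a

  readBit : Fin 6 → Instr
  readBit i = look λ x a c →
    record x { same = Memory.same x ∧ compare? (Vec.lookup (Memory.store x) i) (bitOf a)
             ; store = Memory.store x Vec.[ i ]≔ bitOf a } , isBit a

  readTracks : ∀ {m} → (Fin m → Ix) → List Instr
  readTracks {zero}  f = []
  readTracks {suc m} f = readTrack (f 0F) ∷ readTracks (f ∘ Fin.suc)

  tracksOf : ∀ {m k} → (Fin m → Ix) → Vec Cell k → Vec (Vec Bool k) m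
  tracksOf f cs = Vec.tabulate (λ t → track (f t) cs)

  joined : ∀ {m k} → (Fin m → Ix) → Vec Cell k → Vec Bool (m * k)
  joined f cs = Vec.concat (tracksOf f cs)

  putTracks : ∀ {m k} → (Fin m → Ix) → List Bool → Vec Cell k → Vec Cell k
  putTracks {zero}      f bs cs = cs
  putTracks {suc m} {k} f bs cs = putTracks (f ∘ Fin.suc) (List.drop k bs) (putTrack (f 0F) (pad k bs) cs)

  track-putTracks : ∀ {m k} (f : Fin m → Ix) bs (cs : Vec Cell k) i → (∀ t → i ≢ f t) →
                    track i (putTracks f bs cs) ≡ track i cs
  track-putTracks {zero}      f bs cs i p = refl
  track-putTracks {suc m} {k} f bs cs i p =
    trans (track-putTracks (f ∘ Fin.suc) _ _ i (p ∘ Fin.suc)) (track-putTrack′ i (f 0F) (pad k bs) cs (p 0F))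

  joined-≡ : ∀ {m k} {f : Fin m → Ix} {cs ds : Vec Cell k} → (∀ t → track (f t) cs ≡ track (f t) ds) → joined f cs ≡ joined f ds
  joined-≡ p = cong Vec.concat (Vec.tabulate-cong p)

  joined-putTracks : ∀ {m k} (f : Fin m → Ix) → (∀ {t u} → f t ≡ f u → t ≡ u) → ∀ bs (cs : Vec Cell k) →
                     joined f (putTracks f bs cs) ≡ pad (m * k) bs
  joined-putTracks {zero}      f inj bs cs = refl
  joined-putTracks {suc m} {k} f inj bs cs = trans
    (cong₂ Vec._++_
      (trans (track-putTracks (f ∘ Fin.suc) _ _ (f 0F) (λ t eq → 0≢suc (inj eq))) (track-putTrack (f 0F) (pad k bs) cs))
      (joined-putTracks (f ∘ Fin.suc) (Fin.suc-injective ∘ inj) (List.drop k bs) (putTrack (f 0F) (pad k bs) cs)))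
    (sym (pad-+ k (m * k) bs))
    where
    0≢suc : ∀ {n} {t : Fin n} → 0F ≢ Fin.suc t
    0≢suc ()

  readTrack-cells : ∀ {k} i x (cs : Vec Cell k) bs {r} → NonBit r →
    sweepCells (λ x a c → record x { same = Memory.same x ∧ compare? (get i c) (bitOf a) } , put i (bitOf a) c , isBit a)
      x cs (word bs r) ≡
    (record x { same = Memory.same x ∧ eqV (track i cs) (pad k bs) } , putTrack i (pad k bs) cs , word (List.drop k bs) r)
  readTrack-cells i x []       bs p rewrite Bool.∧-identityʳ (Memory.same x) = refl
  readTrack-cells {suc k} i x (c ∷ cs) bs {r} p
    rewrite bitOf-word bs p | advance-word bs p
          | readTrack-cells i (record x { same = Memory.same x ∧ compare? (get i c) (firstBit bs) }) cs (List.drop 1 bs) p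
          | eqV-∷ (get i c) (firstBit bs) (track i cs) (pad k (List.drop 1 bs))
          | Bool.∧-assoc (Memory.same x) (compare? (get i c) (firstBit bs)) (eqV (track i cs) (pad k (List.drop 1 bs)))
          | drop-suc k bs = refl

  exec-readBit : ∀ {k} i is x (cs : Vec Cell (suc k)) bs {r} → NonBit r →
    exec (readBit i ∷ is) x cs (word bs r) ≡
    exec is (record x { same = Memory.same x ∧ compare? (Vec.lookup (Memory.store x) i) (firstBit bs)
                      ; store = Memory.store x Vec.[ i ]≔ firstBit bs }) cs (word (List.drop 1 bs) r)
  exec-readBit i is x (c ∷ cs) bs p rewrite bitOf-word bs p | advance-word bs p = refl

  exec-readTracks : ∀ {m k} (f : Fin m → Ix) → (∀ {t u} → f t ≡ f u → t ≡ u) → ∀ is x (cs : Vec Cell (suc k)) bs {r} → NonBit r →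
    exec (readTracks f ++ is) x cs (word bs r) ≡
    exec is (record x { same = Memory.same x ∧ eqV (joined f cs) (pad (m * suc k) bs) })
      (putTracks f bs cs) (word (List.drop (m * suc k) bs) r)
  exec-readTracks {zero} f inj is x cs bs p rewrite Bool.∧-identityʳ (Memory.same x) = refl
  exec-readTracks {suc m} {k} f inj is x cs bs {r} p
    rewrite readTrack-cells (f 0F) x cs bs p
          | exec-readTracks (f ∘ Fin.suc) (Fin.suc-injective ∘ inj) is
              (record x { same = Memory.same x ∧ eqV (track (f 0F) cs) (pad (suc k) bs) })
              (putTrack (f 0F) (pad (suc k) bs) cs) (List.drop (suc k) bs) p
          | joined-≡ {f = f ∘ Fin.suc} {putTrack (f 0F) (pad (suc k) bs) cs} {cs}
              (λ t → track-putTrack′ (f (Fin.suc t)) (f 0F) (pad (suc k) bs) cs (λ eq → case (inj eq) of λ ()))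
          | List.drop-drop (suc k) (m * suc k) bs
          | pad-+ (suc k) (m * suc k) bs
          | eqV-++ (track (f 0F) cs) (pad (suc k) bs) {joined (f ∘ Fin.suc) cs} {pad (m * suc k) (List.drop (suc k) bs)}
          | Bool.∧-assoc (Memory.same x) (eqV (track (f 0F) cs) (pad (suc k) bs))
              (eqV (joined (f ∘ Fin.suc) cs) (pad (m * suc k) (List.drop (suc k) bs))) = refl

∧-assoc₉ : ∀ s a b c d e f g h i →
  ((((((((s ∧ a) ∧ b) ∧ c) ∧ d) ∧ e) ∧ f) ∧ g) ∧ h) ∧ i ≡
  s ∧ (a ∧ (b ∧ (c ∧ (d ∧ (e ∧ (f ∧ (g ∧ (h ∧ i))))))))
∧-assoc₉ false a     b     c     d     e     f     g     h i = refl
∧-assoc₉ true  false b     c     d     e     f     g     h i = refl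
∧-assoc₉ true  true  false c     d     e     f     g     h i = refl
∧-assoc₉ true  true  true  false d     e     f     g     h i = refl
∧-assoc₉ true  true  true  true  false e     f     g     h i = refl
∧-assoc₉ true  true  true  true  true  false f     g     h i = refl
∧-assoc₉ true  true  true  true  true  true  false g     h i = refl
∧-assoc₉ true  true  true  true  true  true  true  false h i = refl
∧-assoc₉ true  true  true  true  true  true  true  true  h i = refl

-- This is `check` without the final test, which the program performs in an instruction of its own.
oks : ∀ {k} → Mode → Bool → (c o : Vec Bool k) → Bool
oks m s []      []      = true
oks m s (c ∷ v) (o ∷ w) = ok m s c o ∧ oks m (carry m s c o) v w

carries : ∀ {k} → Mode → Bool → (c o : Vec Bool k) → Bool
carries m s []      []      = s
carries m s (c ∷ v) (o ∷ w) = carries m (carry m s c o) v w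

check-oks : ∀ {k} m s (c o : Vec Bool k) → check m s c o ≡ oks m s c o ∧ final m (carries m s c o)
check-oks m s []      []      = refl
check-oks m s (c ∷ v) (o ∷ w) = trans (cong (ok m s c o ∧_) (check-oks m (carry m s c o) v w))
  (sym (Bool.∧-assoc (ok m s c o) _ _))

module Checking (M : TM Bool) where

  open Simulation M public
  open Reading tracks public

  -- The slots of a cell: the number `n`, the index of the input asked about, and the fields `o`,
  -- `c` and round of a gate number. Each of the first two numbers occupies a single track of its
  -- slot.
  nS aS oS cS rS : Fin 5
  nS = 0F
  aS = 1F
  oS = 2F
  cS = 3F
  rS = 4F

  payload : List Instr → List Instr
  payload is = readBit 0F ∷ readBit 1F ∷ readBit 2F ∷
    readBit 3F ∷ readTracks (oS ,_) ++
    (readBit 4F ∷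
     readBit 5F ∷
     readTracks (cS ,_) ++ (readTracks (rS ,_) ++ is))

  width payloadWidth : ℕ → ℕ
  width l        = tracks * suc l
  payloadWidth l = 4 + (width l + (2 + (width l + width l)))

  assemble : ∀ {l} → Vec Bool 6 → Vec Cell (suc l) → Vec Bool (payloadWidth l)
  assemble v cs = Vec.take 4 v Vec.++ (joined (oS ,_) cs Vec.++ (Vec.drop 4 v Vec.++ (joined (cS ,_) cs Vec.++ joined (rS ,_) cs)))

  record PayloadRead {l} (is : List Instr) (x : Memory) (cs : Vec Cell (suc l)) (bs : List Bool) (r : List TupleSymbol) : Set where
    field
      store′ : Vec Bool 6
      cells′ : Vec Cell (suc l)
      reads  : exec (payload is) x cs (word bs r) ≡
               exec is (record x { same  = Memory.same x ∧ eqV (assemble (Memory.store x) cs) (pad (payloadWidth l) bs)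
                                 ; store = store′ }) cells′ (word (List.drop (payloadWidth l) bs) r)
      stored : assemble store′ cells′ ≡ pad (payloadWidth l) bs
      frame  : ∀ i → proj₁ i ≢ oS → proj₁ i ≢ cS → proj₁ i ≢ rS → track i cells′ ≡ track i cs

  exec-payload : ∀ {l} is x (cs : Vec Cell (suc l)) bs {r} → NonBit r → PayloadRead is x cs bs r
  exec-payload {l} is x cs bs {r} p = go (Memory.store x)
    where
    open ≡-Reasoning
    W = width l
    inj : ∀ {s : Fin 5} {t u : Fin tracks} → (s , t) ≡ (s , u) → t ≡ u
    inj refl = refl
    go : ∀ v → PayloadRead is (record x { store = v }) cs bs r
    go v@(a₀ ∷ a₁ ∷ a₂ ∷ a₃ ∷ a₄ ∷ a₅ ∷ []) = record
      { store′ = new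
      ; cells′ = cells₃
      ; reads  =
          trans (exec-readBit 0F _ _ cs bs p)
          (trans (exec-readBit 1F _ _ cs bs₁ p)
          (trans (exec-readBit 2F _ _ cs bs₂ p)
          (trans (exec-readBit 3F _ _ cs bs₃ p)
          (trans (exec-readTracks (oS ,_) inj _ _ cs bs₄ p)
          (trans (exec-readBit 4F _ _ cells₁ cs₀ p)
          (trans (exec-readBit 5F _ _ cells₁ cs₁ p)
          (trans (exec-readTracks (cS ,_) inj _ _ cells₁ cs₂ p)
          (trans (exec-readTracks (rS ,_) inj is _ cells₂ cs₃ p)
            (cong₂ (λ s q → exec is (record x { same = s ; store = new }) cells₃ (word q r)) sames rests)))))))))
      ; stored = trans (cong (λ u → firstBit bs ∷ firstBit bs₁ ∷ firstBit bs₂ ∷ firstBit bs₃ ∷ u)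
          (cong₂ Vec._++_ o-stored (cong₂ (λ a b → firstBit cs₀ ∷ firstBit cs₁ ∷ (a Vec.++ b)) c-stored
            (joined-putTracks (rS ,_) inj cs₃ cells₂)))) (sym padded)
      ; frame  = λ i ≢o ≢c ≢r → trans (track-putTracks (rS ,_) cs₃ cells₂ i (λ t eq → ≢r (cong proj₁ eq)))
          (trans (track-putTracks (cS ,_) cs₂ cells₁ i (λ t eq → ≢c (cong proj₁ eq)))
            (track-putTracks (oS ,_) bs₄ cs i (λ t eq → ≢o (cong proj₁ eq))))
      }
      where
      bs₁ = List.drop 1 bs
      bs₂ = List.drop 1 bs₁
      bs₃ = List.drop 1 bs₂
      bs₄ = List.drop 1 bs₃
      cs₀ = List.drop W bs₄
      cs₁ = List.drop 1 cs₀
      cs₂ = List.drop 1 cs₁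
      cs₃ = List.drop W cs₂
      new = firstBit bs ∷ firstBit bs₁ ∷ firstBit bs₂ ∷ firstBit bs₃ ∷ firstBit cs₀ ∷ firstBit cs₁ ∷ []
      cells₁ = putTracks (oS ,_) bs₄ cs
      cells₂ = putTracks (cS ,_) cs₂ cells₁
      cells₃ = putTracks (rS ,_) cs₃ cells₂
      padded : pad (payloadWidth l) bs ≡ firstBit bs ∷ firstBit bs₁ ∷ firstBit bs₂ ∷ firstBit bs₃ ∷
               (pad W bs₄ Vec.++ (firstBit cs₀ ∷ firstBit cs₁ ∷ (pad W cs₂ Vec.++ pad W cs₃)))
      padded = cong (λ u → firstBit bs ∷ firstBit bs₁ ∷ firstBit bs₂ ∷ firstBit bs₃ ∷ u)
        (trans (pad-+ W (2 + (W + W)) bs₄) (cong (λ u → pad W bs₄ Vec.++ (firstBit cs₀ ∷ firstBit cs₁ ∷ u)) (pad-+ W W cs₂)))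
      o-stored : joined (oS ,_) cells₃ ≡ pad W bs₄
      o-stored = trans (joined-≡ (λ t → trans (track-putTracks (rS ,_) cs₃ cells₂ (oS , t) (λ _ ()))
        (track-putTracks (cS ,_) cs₂ cells₁ (oS , t) (λ _ ())))) (joined-putTracks (oS ,_) inj bs₄ cs)
      c-stored : joined (cS ,_) cells₃ ≡ pad W cs₂
      c-stored = trans (joined-≡ (λ t → track-putTracks (rS ,_) cs₃ cells₂ (cS , t) (λ _ ())))
        (joined-putTracks (cS ,_) inj cs₂ cells₁)
      rests : List.drop W cs₃ ≡ List.drop (payloadWidth l) bs
      rests = sym (begin
        List.drop (4 + (W + (2 + (W + W)))) bs
          ≡⟨ trans (drop-+ 4 _ bs) (cong (List.drop (W + (2 + (W + W)))) four) ⟩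
        List.drop (W + (2 + (W + W))) bs₄
          ≡⟨ drop-+ W _ bs₄ ⟩
        List.drop (2 + (W + W)) cs₀
          ≡⟨ trans (drop-+ 2 _ cs₀) (cong (List.drop (W + W)) (sym (List.drop-drop 1 1 cs₀))) ⟩
        List.drop (W + W) cs₂
          ≡⟨ drop-+ W W cs₂ ⟩
        List.drop W cs₃ ∎)
        where
        four : List.drop 4 bs ≡ bs₄
        four = sym (trans (cong (List.drop 1 ∘ List.drop 1) (List.drop-drop 1 1 bs))
                 (trans (cong (List.drop 1) (List.drop-drop 2 1 bs)) (List.drop-drop 3 1 bs)))
      sames : ((((((((Memory.same x ∧ compare? a₀ (firstBit bs)) ∧ compare? a₁ (firstBit bs₁)) ∧ compare? a₂ (firstBit bs₂))
                ∧ compare? a₃ (firstBit bs₃)) ∧ eqV (joined (oS ,_) cs) (pad W bs₄)) ∧ compare? a₄ (firstBit cs₀))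
                ∧ compare? a₅ (firstBit cs₁)) ∧ eqV (joined (cS ,_) cells₁) (pad W cs₂)) ∧ eqV (joined (rS ,_) cells₂) (pad W cs₃)
              ≡ Memory.same x ∧ eqV (assemble v cs) (pad (payloadWidth l) bs)
      sames = begin
        _ ≡⟨ ∧-assoc₉ (Memory.same x) _ _ _ _ _ _ _ _ _ ⟩
        -- When the fields `c` and round are compared, only other slots have been overwritten, so
        -- they are compared with their contents in `cs`.
        _ ≡⟨ cong₂ (λ a b → Memory.same x ∧ (compare? a₀ (firstBit bs) ∧ (compare? a₁ (firstBit bs₁) ∧ (compare? a₂ (firstBit bs₂) ∧
               (compare? a₃ (firstBit bs₃) ∧ (eqV (joined (oS ,_) cs) (pad W bs₄) ∧ (compare? a₄ (firstBit cs₀) ∧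
               (compare? a₅ (firstBit cs₁) ∧ (eqV a (pad W cs₂) ∧ eqV b (pad W cs₃))))))))))
               (joined-≡ (λ t → track-putTracks (oS ,_) bs₄ cs (cS , t) (λ _ ())))
               (joined-≡ (λ t → trans (track-putTracks (cS ,_) cs₂ cells₁ (rS , t) (λ _ ()))
                  (track-putTracks (oS ,_) bs₄ cs (rS , t) (λ _ ())))) ⟩
        _ ≡⟨ cong (Memory.same x ∧_) (sym split) ⟩
        _ ∎
        where
        jo = joined (oS ,_) cs
        jc = joined (cS ,_) cs
        jr = joined (rS ,_) cs
        split : eqV (assemble v cs) (pad (payloadWidth l) bs) ≡
          compare? a₀ (firstBit bs) ∧ (compare? a₁ (firstBit bs₁) ∧ (compare? a₂ (firstBit bs₂) ∧
          (compare? a₃ (firstBit bs₃) ∧ (eqV jo (pad W bs₄) ∧ (compare? a₄ (firstBit cs₀) ∧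
          (compare? a₅ (firstBit cs₁) ∧ (eqV jc (pad W cs₂) ∧ eqV jr (pad W cs₃))))))))
        split rewrite padded
          | eqV-∷ a₀ (firstBit bs) (a₁ ∷ a₂ ∷ a₃ ∷ (jo Vec.++ (a₄ ∷ a₅ ∷ (jc Vec.++ jr)))) (firstBit bs₁ ∷ firstBit bs₂ ∷ firstBit bs₃ ∷ (pad W bs₄ Vec.++ (firstBit cs₀ ∷ firstBit cs₁ ∷ (pad W cs₂ Vec.++ pad W cs₃))))
          | eqV-∷ a₁ (firstBit bs₁) (a₂ ∷ a₃ ∷ (jo Vec.++ (a₄ ∷ a₅ ∷ (jc Vec.++ jr)))) (firstBit bs₂ ∷ firstBit bs₃ ∷ (pad W bs₄ Vec.++ (firstBit cs₀ ∷ firstBit cs₁ ∷ (pad W cs₂ Vec.++ pad W cs₃))))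
          | eqV-∷ a₂ (firstBit bs₂) (a₃ ∷ (jo Vec.++ (a₄ ∷ a₅ ∷ (jc Vec.++ jr)))) (firstBit bs₃ ∷ (pad W bs₄ Vec.++ (firstBit cs₀ ∷ firstBit cs₁ ∷ (pad W cs₂ Vec.++ pad W cs₃))))
          | eqV-∷ a₃ (firstBit bs₃) (jo Vec.++ (a₄ ∷ a₅ ∷ (jc Vec.++ jr))) (pad W bs₄ Vec.++ (firstBit cs₀ ∷ firstBit cs₁ ∷ (pad W cs₂ Vec.++ pad W cs₃)))
          | eqV-++ jo (pad W bs₄) {a₄ ∷ a₅ ∷ (jc Vec.++ jr)} {firstBit cs₀ ∷ firstBit cs₁ ∷ (pad W cs₂ Vec.++ pad W cs₃)}
          | eqV-∷ a₄ (firstBit cs₀) (a₅ ∷ (jc Vec.++ jr)) (firstBit cs₁ ∷ (pad W cs₂ Vec.++ pad W cs₃))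
          | eqV-∷ a₅ (firstBit cs₁) (jc Vec.++ jr) (pad W cs₂ Vec.++ pad W cs₃)
          | eqV-++ jc (pad W cs₂) {jr} {pad W cs₃} = refl

-- Whether the first number is at most the second, or less if the flag is
-- false.

leV : ∀ {k} → Bool → Vec Bool k → Vec Bool k → Bool
leV s []      []      = s
leV s (p ∷ v) (n ∷ w) = leV (if compare? p n then s else n) v w

leV-spec : ∀ {k} s (v w : Vec Bool k) → leV s v w ≡ true ⇔ bit→ℕ (not s) + val v ≤ val w
leV-spec true  []      []      = mk⇔ (λ _ → z≤n) (λ _ → refl)
leV-spec false []      []      = mk⇔ (λ ()) (λ ())
leV-spec s     (p ∷ v) (n ∷ w) = mk⇔
  (λ t → widen s p n (to (leV-spec (if compare? p n then s else n) v w) t))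
  (λ t → from (leV-spec (if compare? p n then s else n) v w) (narrow s p n t))
  where
  open Equivalence
  even≤odd : ∀ {a b} → 2 * a ≤ 1 + 2 * b → a ≤ b
  even≤odd {a} {b} p = ≮⇒≥ λ b<a → <⇒≱ (s≤s p) (≤-trans (≤-reflexive (sym (*-suc 2 b))) (*-monoʳ-≤ 2 b<a))
  odd≤even : ∀ {a b} → 1 + 2 * a ≤ 2 * b → 1 + a ≤ b
  odd≤even {a} {b} p = ≮⇒≥ λ b<1+a → <⇒≱ p (*-monoʳ-≤ 2 (≤-pred b<1+a))
  double : ∀ {a b} → 1 + a ≤ b → 2 + 2 * a ≤ 2 * b
  double {a} p = ≤-trans (≤-reflexive (sym (*-suc 2 a))) (*-monoʳ-≤ 2 p)
  half : ∀ {a b} → 2 * a ≤ 2 * b → a ≤ b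
  half = *-cancelˡ-≤ 2
  widen : ∀ s p n → bit→ℕ (not (if compare? p n then s else n)) + val v ≤ val w →
          bit→ℕ (not s) + (bit→ℕ p + 2 * val v) ≤ bit→ℕ n + 2 * val w
  widen true  false false t = *-monoʳ-≤ 2 t
  widen true  true  true  t = s≤s (*-monoʳ-≤ 2 t)
  widen true  false true  t = ≤-trans (*-monoʳ-≤ 2 t) (n≤1+n _)
  widen true  true  false t = ≤-trans (n≤1+n _) (double t)
  widen false false false t = ≤-trans (n≤1+n _) (double t)
  widen false true  true  t = s≤s (≤-trans (n≤1+n _) (double t))
  widen false false true  t = s≤s (*-monoʳ-≤ 2 t)
  widen false true  false t = double t
  narrow : ∀ s p n → bit→ℕ (not s) + (bit→ℕ p + 2 * val v) ≤ bit→ℕ n + 2 * val w →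
           bit→ℕ (not (if compare? p n then s else n)) + val v ≤ val w
  narrow true  false false t = half t
  narrow true  true  true  t = half (≤-pred t)
  narrow true  false true  t = even≤odd t
  narrow true  true  false t = odd≤even t
  narrow false false false t = odd≤even t
  narrow false true  true  t = odd≤even (≤-pred t)
  narrow false false true  t = half (≤-pred t)
  narrow false true  false t = odd≤even (≤-trans (n≤1+n _) t)

val-zeros : ∀ k → val (zeros k) ≡ 0
val-zeros zero    = refl
val-zeros (suc k) = cong (2 *_) (val-zeros k)

eqV-zeros : ∀ {k} (v : Vec Bool k) → eqV v (zeros k) ≡ true ⇔ val v ≡ 0
eqV-zeros {k} v = mk⇔ (λ eq → trans (cong val (eqV-sound v (zeros k) eq)) (val-zeros k))
  (λ eq → trans (cong (λ u → eqV u (zeros k)) (val-injective v (zeros k) (trans eq (sym (val-zeros k))))) (eqV-refl (zeros k)))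

cellFlags : (z le : Bool) → Bool → InputCell Bool
cellFlags true  _     b = ⊢
cellFlags false true  b = letter b
cellFlags false false b = ⊣

kindFlags : ∀ {n} → Kind n → Bool × Bool
kindFlags atLeft       = true , true
kindFlags (atLetter _) = false , true
kindFlags atRight      = false , false

-- The letters are at the positions from 1 to `n`, so two comparisons, with 0 and with `n`, tell the
-- kinds apart.
flags-kind : ∀ {k} (p w : Vec Bool k) n → val w ≡ n → (eqV p (zeros k) , leV true p w) ≡ kindFlags (kindOf n (val p))
flags-kind {k} p w n refl with val p | eqV-zeros p | leV-spec true p w
... | zero  | ez | le = cong₂ _,_ (Equivalence.from ez refl) (Equivalence.from le z≤n)
... | suc i | ez | le with i <? val w
...   | yes i<n = cong₂ _,_ (Bool.¬-not (λ eq → 1+n≢0 (Equivalence.to ez eq))) (Equivalence.from le i<n)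
...   | no  i≮n = cong₂ _,_ (Bool.¬-not (λ eq → 1+n≢0 (Equivalence.to ez eq))) (Bool.¬-not (λ eq → i≮n (Equivalence.to le eq)))

cellFlags-kind : ∀ {n} (k : Kind n) b → cellFlags (proj₁ (kindFlags k)) (proj₂ (kindFlags k)) b ≡ cellOf k b
cellFlags-kind atLeft       b = refl
cellFlags-kind (atLetter _) b = refl
cellFlags-kind atRight      b = refl

-- Passes that test the number of a gate

∧-swap : ∀ a b c d e → (a ∧ (b ∧ c)) ∧ (d ∧ e) ≡ a ∧ ((b ∧ d) ∧ (c ∧ e))
∧-swap false b     c     d     e = refl
∧-swap true  false c     d     e = refl
∧-swap true  true  false false e = refl
∧-swap true  true  false true  e = refl
∧-swap true  true  true  false e = refl
∧-swap true  true  true  true  e = refl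

eqV-zeros-∷ : ∀ {k} b (v : Vec Bool k) → eqV (b ∷ v) (zeros (suc k)) ≡ not b ∧ eqV v (zeros k)
eqV-zeros-∷ false v = refl
eqV-zeros-∷ true  v = refl

eqV-ones-∷ : ∀ {k} b (v : Vec Bool k) → eqV (b ∷ v) (ones (suc k)) ≡ b ∧ eqV v (ones k)
eqV-ones-∷ false v = refl
eqV-ones-∷ true  v = refl

module Passes (M : TM Bool) where

  open Checking M public
  open Memory

  -- Quarters 0 and 2 name the successors under the letters `true` and `false`, in this order, while
  -- quarters 1 and 3 name `c` itself.
  modesQuarter : (z le : Bool) → Vec Bool 2 → Vec Bool tracks → Vec Mode tracks
  modesQuarter z le (true  ∷ _ ∷ []) col = Vec.replicate tracks keep
  modesQuarter z le (false ∷ h ∷ []) col = modes (cellFlags z le (not h)) col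

  modesNow : Memory → Cell → Vec Mode tracks
  modesNow x c = modesQuarter (z x) (le x) (Vec.drop 4 (store x)) (Vec.lookup c cS)

  posT : Fin tracks
  posT = 1F

  -- `argumentPass` runs the automaton for `inc`, since input number `i` is scanned at position
  -- `suc i`.
  kindPass argumentPass : Instr
  kindPass = sweep λ x a c →
    record x { z  = z x ∧ not (get (cS , posT) c)
             ; le = if compare? (get (cS , posT) c) (get (nS , 0F) c) then le x else get (nS , 0F) c } , c , false
  argumentPass = sweep λ x a c →
    record x { argument = argument x ∧ ok inc (carried x) (get (aS , 0F) c) (get (cS , posT) c)
             ; carried  = carry inc (carried x) (get (aS , 0F) c) (get (cS , posT) c) } , c , false

  -- For one track: the mode is taken from the first cells, the automaton runs over the row, and its
  -- final condition is added. The comparisons with `zeros` and `ones` are collected on the way.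
  prepare close test : Fin tracks → Instr
  prepare t = look λ x a c → record x
    { mode = Vec.lookup (modesNow x c) t ; carried = start (Vec.lookup (modesNow x c) t) (get (cS , t) c) } , false
  test t = sweep λ x a c → record x
    { matches = matches x ∧ ok (mode x) (carried x) (get (cS , t) c) (get (oS , t) c)
    ; carried = carry (mode x) (carried x) (get (cS , t) c) (get (oS , t) c)
    ; isZero  = isZero x ∧ not (get (oS , t) c)
    ; isFirst = isFirst x ∧ (not (get (cS , t) c) ∧ not (get (rS , t) c))
    ; isLast  = isLast x ∧ (get (cS , t) c ∧ get (rS , t) c) } , c , false
  close t = look λ x a c → record x { matches = matches x ∧ final (mode x) (carried x) } , false

  testTracks : ∀ {m} → (Fin m → Fin tracks) → List Instr
  testTracks {zero}  f = []
  testTracks {suc m} f = prepare (f 0F) ∷ test (f 0F) ∷ close (f 0F) ∷ testTracks (f ∘ Fin.suc)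

  sweepOf : Instr → Memory → InputCell TupleSymbol → Cell → Memory × Cell × Bool
  sweepOf (look f)  x a c = x , c , false
  sweepOf (sweep f) x a c = f x a c

  kindPass-cells : ∀ {k} x (cs : Vec Cell k) r → sweepCells (sweepOf kindPass) x cs r ≡
    (record x { z = z x ∧ eqV (track (cS , posT) cs) (zeros k) ; le = leV (le x) (track (cS , posT) cs) (track (nS , 0F) cs) } , cs , r)
  kindPass-cells x [] r rewrite Bool.∧-identityʳ (z x) = refl
  kindPass-cells {suc k} x (c ∷ cs) r
    rewrite kindPass-cells (proj₁ (sweepOf kindPass x (peek r) c)) cs r
          | eqV-zeros-∷ (get (cS , posT) c) (track (cS , posT) cs)
          | Bool.∧-assoc (z x) (not (get (cS , posT) c)) (eqV (track (cS , posT) cs) (zeros k)) = refl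

  argumentPass-cells : ∀ {k} x (cs : Vec Cell k) r → sweepCells (sweepOf argumentPass) x cs r ≡
    (record x { argument = argument x ∧ check inc (carried x) (track (aS , 0F) cs) (track (cS , posT) cs)
              ; carried  = carries inc (carried x) (track (aS , 0F) cs) (track (cS , posT) cs) } , cs , r)
  argumentPass-cells x [] r rewrite Bool.∧-identityʳ (argument x) = refl
  argumentPass-cells x (c ∷ cs) r
    rewrite argumentPass-cells (proj₁ (sweepOf argumentPass x (peek r) c)) cs r
          | Bool.∧-assoc (argument x) (ok inc (carried x) (get (aS , 0F) c) (get (cS , posT) c))
              (check inc (carry inc (carried x) (get (aS , 0F) c) (get (cS , posT) c)) (track (aS , 0F) cs) (track (cS , posT) cs)) = refl

  test-cells : ∀ {k} t x (cs : Vec Cell k) r → sweepCells (sweepOf (test t)) x cs r ≡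
    (record x { matches = matches x ∧ oks (mode x) (carried x) (track (cS , t) cs) (track (oS , t) cs)
              ; carried = carries (mode x) (carried x) (track (cS , t) cs) (track (oS , t) cs)
              ; isZero  = isZero x ∧ eqV (track (oS , t) cs) (zeros k)
              ; isFirst = isFirst x ∧ (eqV (track (cS , t) cs) (zeros k) ∧ eqV (track (rS , t) cs) (zeros k))
              ; isLast  = isLast x ∧ (eqV (track (cS , t) cs) (ones k) ∧ eqV (track (rS , t) cs) (ones k)) } , cs , r)
  test-cells t x [] r
    rewrite Bool.∧-identityʳ (matches x) | Bool.∧-identityʳ (isZero x) | Bool.∧-identityʳ (isFirst x)
          | Bool.∧-identityʳ (isLast x) = refl
  test-cells {suc k} t x (c ∷ cs) r
    rewrite test-cells t (proj₁ (sweepOf (test t) x (peek r) c)) cs r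
          | Bool.∧-assoc (matches x) (ok (mode x) (carried x) (get (cS , t) c) (get (oS , t) c))
              (oks (mode x) (carry (mode x) (carried x) (get (cS , t) c) (get (oS , t) c)) (track (cS , t) cs) (track (oS , t) cs))
          | eqV-zeros-∷ (get (oS , t) c) (track (oS , t) cs)
          | Bool.∧-assoc (isZero x) (not (get (oS , t) c)) (eqV (track (oS , t) cs) (zeros k))
          | eqV-zeros-∷ (get (cS , t) c) (track (cS , t) cs)
          | eqV-zeros-∷ (get (rS , t) c) (track (rS , t) cs)
          | ∧-swap (isFirst x) (not (get (cS , t) c)) (not (get (rS , t) c)) (eqV (track (cS , t) cs) (zeros k)) (eqV (track (rS , t) cs) (zeros k))
          | eqV-ones-∷ (get (cS , t) c) (track (cS , t) cs)
          | eqV-ones-∷ (get (rS , t) c) (track (rS , t) cs)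
          | ∧-swap (isLast x) (get (cS , t) c) (get (rS , t) c) (eqV (track (cS , t) cs) (ones k)) (eqV (track (rS , t) cs) (ones k)) = refl

  pick-track : ∀ {m} → (Fin m → Fin tracks) → Fin 5 → Fin m → Ix
  pick-track f s t = s , f t

  images : ∀ {m k} → (Fin m → Fin tracks) → Vec Mode tracks → Vec Cell (suc k) → Vec (Vec Bool (suc k)) m
  images f ms cs = Vec.tabulate (λ t → apply (Vec.lookup ms (f t)) (track (cS , f t) cs))

  exec-testTracks : ∀ {m k} (f : Fin m → Fin tracks) is x (cs : Vec Cell (suc k)) r →
    ∃[ m′ ] ∃[ s′ ] exec (testTracks f ++ is) x cs r ≡ exec is (record x
      { mode    = m′ ; carried = s′
      ; matches = matches x ∧ eqV (joined (pick-track f oS) cs) (Vec.concat (images f (modesNow x (Vec.head cs)) cs))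
      ; isZero  = isZero x ∧ eqV (joined (pick-track f oS) cs) (zeros (m * suc k))
      ; isFirst = isFirst x ∧ (eqV (joined (pick-track f cS) cs) (zeros (m * suc k)) ∧ eqV (joined (pick-track f rS) cs) (zeros (m * suc k)))
      ; isLast  = isLast x ∧ (eqV (joined (pick-track f cS) cs) (ones (m * suc k)) ∧ eqV (joined (pick-track f rS) cs) (ones (m * suc k)))
      }) cs r
  exec-testTracks {zero} f is x cs r
    rewrite Bool.∧-identityʳ (matches x) | Bool.∧-identityʳ (isZero x) | Bool.∧-identityʳ (isFirst x)
          | Bool.∧-identityʳ (isLast x) = mode x , carried x , refl
  exec-testTracks {suc m} {k} f is x cs@(c ∷ cs′) r
    = conclusion
    where
    t = f 0F
    m₀ = Vec.lookup (modesNow x c) t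
    C = track (cS , t) cs
    O = track (oS , t) cs
    R = track (rS , t) cs
    s₀ = start m₀ (get (cS , t) c)
    x₁ = record x
      { mode = m₀ ; carried = carries m₀ s₀ C O
      ; matches = (matches x ∧ oks m₀ s₀ C O) ∧ final m₀ (carries m₀ s₀ C O)
      ; isZero  = isZero x ∧ eqV O (zeros (suc k))
      ; isFirst = isFirst x ∧ (eqV C (zeros (suc k)) ∧ eqV R (zeros (suc k)))
      ; isLast  = isLast x ∧ (eqV C (ones (suc k)) ∧ eqV R (ones (suc k))) }
    g = f ∘ Fin.suc
    Os = joined (pick-track g oS) cs
    Cs = joined (pick-track g cS) cs
    Rs = joined (pick-track g rS) cs
    Is = Vec.concat (images g (modesNow x c) cs)
    checked : (matches x ∧ oks m₀ s₀ C O) ∧ final m₀ (carries m₀ s₀ C O) ≡ matches x ∧ eqV O (apply m₀ C)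
    checked = trans (Bool.∧-assoc (matches x) _ _) (cong (matches x ∧_) (trans (sym (check-oks m₀ s₀ C O)) (check-apply m₀ C O)))
    eq₁ : (matches x₁) ∧ eqV Os Is ≡ matches x ∧ eqV (O Vec.++ Os) (apply m₀ C Vec.++ Is)
    eq₁ = trans (cong (_∧ eqV Os Is) checked) (trans (Bool.∧-assoc (matches x) _ _) (cong (matches x ∧_) (sym (eqV-++ O (apply m₀ C)))))
    eq₂ : isZero x₁ ∧ eqV Os (zeros (m * suc k)) ≡ isZero x ∧ eqV (O Vec.++ Os) (zeros (suc m * suc k))
    eq₂ = trans (Bool.∧-assoc (isZero x) _ _) (cong (isZero x ∧_) (sym (eqV-replicate-++ (suc k) false O Os)))
    eq₃ : ∀ b y → (y ∧ (eqV C (Vec.replicate (suc k) b) ∧ eqV R (Vec.replicate (suc k) b))) ∧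
                  (eqV Cs (Vec.replicate (m * suc k) b) ∧ eqV Rs (Vec.replicate (m * suc k) b)) ≡
          y ∧ (eqV (C Vec.++ Cs) (Vec.replicate (suc m * suc k) b) ∧ eqV (R Vec.++ Rs) (Vec.replicate (suc m * suc k) b))
    eq₃ b y = trans (∧-swap y (eqV C (Vec.replicate (suc k) b)) (eqV R (Vec.replicate (suc k) b))
                     (eqV Cs (Vec.replicate (m * suc k) b)) (eqV Rs (Vec.replicate (m * suc k) b))) (cong (y ∧_) (sym (cong₂ _∧_ (eqV-replicate-++ (suc k) b C Cs) (eqV-replicate-++ (suc k) b R Rs))))
    one-track : exec (testTracks f ++ is) x cs r ≡ exec (testTracks g ++ is) x₁ cs r
    one-track = cong (λ s → exec (close t ∷ testTracks g ++ is) (proj₁ s) (proj₁ (proj₂ s)) (proj₂ (proj₂ s)))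
      (test-cells t (record x { mode = m₀ ; carried = s₀ }) cs r)
    conclusion : ∃[ m′ ] ∃[ s′ ] exec (testTracks f ++ is) x cs r ≡ exec is (record x
      { mode    = m′ ; carried = s′
      ; matches = matches x ∧ eqV (O Vec.++ Os) (apply m₀ C Vec.++ Is)
      ; isZero  = isZero x ∧ eqV (O Vec.++ Os) (zeros (suc m * suc k))
      ; isFirst = isFirst x ∧ (eqV (C Vec.++ Cs) (zeros (suc m * suc k)) ∧ eqV (R Vec.++ Rs) (zeros (suc m * suc k)))
      ; isLast  = isLast x ∧ (eqV (C Vec.++ Cs) (ones (suc m * suc k)) ∧ eqV (R Vec.++ Rs) (ones (suc m * suc k)))
      }) cs r
    conclusion with exec-testTracks g is x₁ cs r
    ... | m′ , s′ , eq rewrite eq₁ | eq₂ | eq₃ false (isFirst x) | eq₃ true (isLast x) = m′ , s′ , trans one-track eq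

-- The program for the direct connection language

isEmpty : List Bool → Bool
isEmpty []      = true
isEmpty (_ ∷ _) = false

isWire isInput : Asked → Bool
isWire askedWire   = true
isWire _           = false
isInput askedInput = true
isInput _          = false

askedOf : InputCell TupleSymbol → Asked
askedOf (letter `output) = askedOutput
askedOf (letter `input)  = askedInput
askedOf (letter `neg)    = askedNeg
askedOf (letter `and)    = askedAnd
askedOf (letter `or)     = askedOr
askedOf (letter `oracle) = askedOracle
askedOf _                = askedWire

query : Query → Asked
query isOutput            = askedOutput
query (hasType (input i)) = askedInput
query (hasType neg)       = askedNeg
query (hasType and)       = askedAnd
query (hasType or)        = askedOr
query (hasType oracle)    = askedOracle
query (wire p h)          = askedWire

operands : Query → List TupleSymbol
operands (hasType (input i)) = word (bin i) []
operands (wire p h)          = word (bin p) (`# ∷ word (bin h) [])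
operands _                   = []

isLetter : ∀ {n} → Kind n → Bool
isLetter (atLetter _) = true
isLetter _            = false

-- The verdict on a question other than a wire, given whether the tuple is
-- well-formed so far, whether the gate is an oracle gate, whether it has
-- payload zero, whether it depends on an input bit, the bits it stands for
-- if that bit is true or false, and whether it is the input asked about.

verdict : Asked → (fine tag zero? letter? b₁ b₀ argument : Bool) → Bool
verdict askedOutput f t z l b₁ b₀ a = f ∧ (t ∧ z)
verdict askedInput  f t z l b₁ b₀ a = f ∧ (not t ∧ (l ∧ (b₁ ∧ (not b₀ ∧ a))))
verdict askedNeg    f t z l b₁ b₀ a = false
verdict askedAnd    f t z l b₁ b₀ a = f ∧ (not t ∧ (if l then b₀ else b₁))
verdict askedOr     f t z l b₁ b₀ a = f ∧ (not t ∧ not b₁)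
verdict askedOracle f t z l b₁ b₀ a = f ∧ t
verdict askedWire   f t z l b₁ b₀ a = f ∧ t

verdict-false : ∀ q t z l b₁ b₀ a → verdict q false t z l b₁ b₀ a ≡ false
verdict-false askedOutput t z l b₁ b₀ a = refl
verdict-false askedInput  t z l b₁ b₀ a = refl
verdict-false askedNeg    t z l b₁ b₀ a = refl
verdict-false askedAnd    t z l b₁ b₀ a = refl
verdict-false askedOr     t z l b₁ b₀ a = refl
verdict-false askedOracle t z l b₁ b₀ a = refl
verdict-false askedWire   t z l b₁ b₀ a = refl

module Deciding (M : TM Bool) where

  open Passes M public
  open Memory

  numIx argIx : Ix
  numIx = nS , 0F
  argIx = aS , 0F

  opBit : Memory → Bool → Bool
  opBit x = wordBit (isFirst x) (isLast x) (isZero x) (matches x) (Vec.drop 4 (store x)) (Vec.take 4 (store x))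

  decide : Memory → Bool
  decide x = verdict (asked x) (fine x) (tag x) (eqV (store x) (zeros 6) ∧ (isZero x ∧ isFirst x))
               (not (z x) ∧ le x) (opBit x true) (opBit x false) (argument x)

  -- `expectHash` also starts a new comparison, so that in the end `same` speaks of the last two
  -- payloads only. A wire question has no keyword: the symbol met by `readQuery` then belongs to
  -- the operands and is left unread.
  expectHash readTag readQuery readArgument endArgument storeResult expectEnd : Instr
  expectHash   = look λ x a c → record x { fine = fine x ∧ isHash a ; same = true } , true
  readTag      = look λ x a c → record x { tag = bitOf a } , isBit a
  readQuery    = look λ x a c → record x { asked = askedOf a } , not (isWire (askedOf a))
  readArgument = sweep λ x a c → x , (if isInput (asked x) then put argIx (bitOf a) c else c) , isInput (asked x) ∧ isBit a
  endArgument  = look λ x a c → record x { fine = fine x ∧ (if isInput (asked x) then not (isBit a) else true) } , false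
  storeResult  = look λ x a c → record x { result = decide x } , false
  expectEnd    = look λ x a c → record x { fine = fine x ∧ not (isBit a) } , false

  -- There are no branches: the operands of a wire are read after every question, and `answer` takes
  -- account of them only for a wire. The result is stored before that, because reading `p`
  -- overwrites the number of the gate.
  afterWire afterGate examine program : List Instr
  afterWire = expectHash ∷ readTag ∷ payload (expectEnd ∷ [])
  examine   = kindPass ∷ argumentPass ∷ testTracks id
  afterGate = expectHash ∷ readQuery ∷ readArgument ∷ endArgument ∷ examine ++ (storeResult ∷ payload afterWire)
  program   = readTrack numIx ∷ expectHash ∷ readTag ∷ payload afterGate

  answer : Memory → Bool
  answer x = result x ∧ (if isWire (asked x) then fine x ∧ (not (tag x) ∧ same x) else true)

  x₀ : Memory
  x₀ = record
    { fine = true ; tag = false ; same = true ; result = false ; matches = true ; z = true ; le = true ; argument = true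
    ; isZero = true ; isFirst = true ; isLast = true ; carried = true ; store = zeros 6 ; mode = keep ; asked = askedWire }

  c₀ : Cell
  c₀ = Vec.replicate 5 (zeros tracks)

  Keeps : (Memory → Set) → Instr → Set
  Keeps P (look f)  = ∀ x a c → P x → P (proj₁ (f x a c))
  Keeps P (sweep f) = ∀ x a c → P x → P (proj₁ (f x a c))

  -- For runs whose remaining input is not followed in detail, as after a number that is too long: a
  -- property kept by each instruction carries a failure, or a stored result, to the end.
  exec-keeps : ∀ {k P is} → All (Keeps P) is → ∀ x (cs : Vec Cell (suc k)) r → P x → P (proj₁ (exec is x cs r))
  exec-keeps []                        x cs       r p = p
  exec-keeps {is = look f ∷ _}  (q ∷ qs) x (c ∷ cs) r p = exec-keeps qs _ (c ∷ cs) _ (q x (peek r) c p)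
  exec-keeps {P = P} {sweep f ∷ _} (q ∷ qs) x cs       r p = exec-keeps qs _ _ _ (cells x cs r p)
    where
    cells : ∀ {k} x (cs : Vec Cell k) r → P x → P (proj₁ (sweepCells f x cs r))
    cells x []       r p = p
    cells x (c ∷ cs) r p = cells _ cs _ (q x (peek r) c p)

  payload-keeps : ∀ {P is} → (∀ x s t → P x → P (record x { same = s ; store = t })) →
                  All (Keeps P) is → All (Keeps P) (payload is)
  payload-keeps {P} closed qs = eachBit 0F ∷ eachBit _ ∷ eachBit _ ∷ eachBit _ ∷
    All.++⁺ (eachTrack (oS ,_)) (eachBit _ ∷ eachBit _ ∷ All.++⁺ (eachTrack (cS ,_)) (All.++⁺ (eachTrack (rS ,_)) qs))
    where
    eachBit : ∀ i → Keeps P (readBit i)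
    eachBit i x a c = closed x _ _
    eachTrack : ∀ {m} (f : Fin m → Ix) → All (Keeps P) (readTracks f)
    eachTrack {zero}  f = []
    eachTrack {suc m} f = (λ x a c → closed x _ (store x)) ∷ eachTrack (f ∘ Fin.suc)

  testTracks-keeps : ∀ {P m} → (∀ x m c s z f l → P x → P (record x { mode = m ; carried = c ; matches = s ; isZero = z ; isFirst = f ; isLast = l })) →
                     (f : Fin m → Fin tracks) → All (Keeps P) (testTracks f)
  testTracks-keeps {m = zero}  closed f = []
  testTracks-keeps {m = suc m} closed f =
    (λ x a c → closed x _ _ (matches x) (isZero x) (isFirst x) (isLast x)) ∷ (λ x a c → closed x (mode x) _ _ _ _ _) ∷
    (λ x a c → closed x (mode x) (carried x) _ (isZero x) (isFirst x) (isLast x)) ∷ testTracks-keeps closed (f ∘ Fin.suc)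

  Rejected Failed : Memory → Set
  Rejected x = result x ≡ false
  Failed x   = fine x ≡ false

  Settled : Memory → Memory → Set
  Settled x y = result y ≡ result x × asked y ≡ asked x

  afterWire-keeps : ∀ {P} → (∀ x f t s st → P x → P (record x { fine = fine x ∧ f ; tag = t ; same = s ; store = st })) → All (Keeps P) afterWire
  afterWire-keeps {P} closed =
    (λ x a c → closed x _ (tag x) true (store x)) ∷
    (λ x a c p → subst P (cong (λ f → record x { fine = f ; tag = bitOf a }) (Bool.∧-identityʳ (fine x))) (closed x true (bitOf a) (same x) (store x) p)) ∷
    payload-keeps (λ x s t p → subst P (cong (λ f → record x { fine = f ; same = s ; store = t }) (Bool.∧-identityʳ (fine x))) (closed x true (tag x) s t p))
      ((λ x a c → closed x _ (tag x) (same x) (store x)) ∷ [])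

  false-∧ : ∀ {a} b → a ≡ false → a ∧ b ≡ false
  false-∧ b refl = refl

  decide-failed : ∀ x → Failed x → decide x ≡ false
  decide-failed x p rewrite p = verdict-false (asked x) (tag x) (eqV (store x) (zeros 6) ∧ (isZero x ∧ isFirst x))
    (not (z x) ∧ le x) (opBit x true) (opBit x false) (argument x)

  failed-gate : ∀ {k} x (cs : Vec Cell (suc k)) r → Failed x →
    answer (proj₁ (exec (readQuery ∷ readArgument ∷ endArgument ∷ examine ++ (storeResult ∷ payload afterWire)) x cs r)) ≡ false
  failed-gate {k} x cs r p
    rewrite exec-++ (readQuery ∷ readArgument ∷ endArgument ∷ examine) (storeResult ∷ payload afterWire) x cs r
    = rejected (proj₁ s) (proj₁ (proj₂ s)) (proj₂ (proj₂ s)) (exec-keeps {P = Failed} first x cs r p)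
    where
    s = exec (readQuery ∷ readArgument ∷ endArgument ∷ examine) x cs r
    first : All (Keeps Failed) (readQuery ∷ readArgument ∷ endArgument ∷ examine)
    first = (λ x a c p → p) ∷ (λ x a c p → p) ∷ (λ x a c → false-∧ _) ∷ (λ x a c p → p) ∷ (λ x a c p → p) ∷
            testTracks-keeps (λ x m c s z f l p → p) id
    rejected : ∀ y (ds : Vec Cell (suc k)) r → Failed y → answer (proj₁ (exec (storeResult ∷ payload afterWire) y ds r)) ≡ false
    rejected y (d ∷ ds) r p = false-∧ _ (exec-keeps {P = Rejected} (payload-keeps (λ x s t p → p) (afterWire-keeps (λ x f t s st p → p)))
      (record y { result = decide y }) (d ∷ ds) r
      (decide-failed y p))

  failed-wire : ∀ {k} x (cs : Vec Cell (suc k)) r → Failed x → asked x ≡ askedWire →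
    answer (proj₁ (exec (readTag ∷ payload (expectEnd ∷ [])) x cs r)) ≡ false
  failed-wire x cs r p q with exec (readTag ∷ payload (expectEnd ∷ [])) x cs r
    | exec-keeps {P = λ x → Failed x × asked x ≡ askedWire} {readTag ∷ payload (expectEnd ∷ [])}
        ((λ x a c p → p) ∷ payload-keeps (λ x s t p → p) ((λ x a c p → false-∧ _ (proj₁ p) , proj₂ p) ∷ [])) x cs r (p , q)
  ... | y , _ | p′ , q′ rewrite p′ | q′ = Bool.∧-zeroʳ (result y)

  settled-answer : ∀ {k} x (cs : Vec Cell (suc k)) r → isWire (asked x) ≡ false → answer (proj₁ (exec (payload afterWire) x cs r)) ≡ result x
  settled-answer x cs r p with exec (payload afterWire) x cs r
    | exec-keeps {P = Settled x} (payload-keeps (λ y s t p → p) (afterWire-keeps (λ y f t s st p → p))) x cs r (refl , refl)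
  ... | y , _ | eq , eq′ rewrite eq | eq′ | p = Bool.∧-identityʳ (result x)

-- Correctness of the verdicts

zipWith-tabulate : ∀ {A B C : Set} {n} (f : A → B → C) (v : Vec A n) (g : Fin n → B) →
                   Vec.zipWith f v (Vec.tabulate g) ≡ Vec.tabulate (λ i → f (Vec.lookup v i) (g i))
zipWith-tabulate f []      g = refl
zipWith-tabulate f (x ∷ v) g = cong (f x (g 0F) ∷_) (zipWith-tabulate f v (g ∘ Fin.suc))

∧-rotate : ∀ a b c d → (a ∧ b) ∧ (c ∧ d) ≡ a ∧ (c ∧ (b ∧ d))
∧-rotate false b     c     d = refl
∧-rotate true  false false d = refl
∧-rotate true  false true  d = refl
∧-rotate true  true  c     d = refl

module Examination (M : TM Bool) (n l : ℕ) (n< : n < 2 ^ suc l) where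

  open Deciding M public
  open Registers M l using (dim; toTracks; position; kind; successor) public
  open Memory

  W : ℕ
  W = suc dim

  Payload : Set
  Payload = Vec Bool (payloadWidth l)

  register : Payload → Vec Bool W
  register = fields W (λ lo o h b → Vec.take W b)

  gateBit : Payload → Bool → Bool
  gateBit v b = fields W (bitAt (successor n true) (successor n false) (λ _ → b)) v

  gateBit-mono : ∀ v → gateBit v false ≡ true → gateBit v true ≡ true
  gateBit-mono v = wordBit-mono (eqV b (zeros (W + W))) (eqV b (ones (W + W))) (eqV o (zeros W))
    (eqV o (target (successor n true) (successor n false) h (Vec.take W b))) h (Vec.take 4 v)
    where
    o = Vec.take W (Vec.drop 4 v)
    h = Vec.take 2 (Vec.drop W (Vec.drop 4 v))
    b = Vec.drop 2 (Vec.drop W (Vec.drop 4 v))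

  gateKind : Payload → Kind n
  gateKind v = kind n (register v)

  positionTrack : Payload → Vec Bool (suc l)
  positionTrack v = Vec.head (Vec.tail (toTracks (register v)))

  module _ (st : Vec Bool 6) (cs : Vec Cell (suc l)) where

    private
      jo jc jr : Vec Bool W
      jo = joined (oS ,_) cs
      jc = joined (cS ,_) cs
      jr = joined (rS ,_) cs

    toTracks-joined : toTracks jc ≡ tracksOf (cS ,_) cs
    toTracks-joined = cut-concat (tracksOf (cS ,_) cs)

    register-assemble : register (assemble st cs) ≡ jc
    register-assemble = trans (fields-++ W (λ lo o h b → Vec.take W b) (Vec.take 4 st) jo (Vec.drop 4 st) (jc Vec.++ jr))
                          (take-++ jc jr)

    positionTrack-assemble : positionTrack (assemble st cs) ≡ track (cS , posT) cs
    positionTrack-assemble = cong (λ t → Vec.head (Vec.tail t)) (trans (cong toTracks register-assemble) toTracks-joined)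

    flags-assemble : track numIx cs ≡ pad (suc l) (bin n) →
      (eqV (track (cS , posT) cs) (zeros (suc l)) , leV true (track (cS , posT) cs) (track numIx cs)) ≡ kindFlags (gateKind (assemble st cs))
    flags-assemble eq = trans
      (flags-kind (track (cS , posT) cs) (track numIx cs) n (trans (cong val eq) (val-pad-bin (suc l) n n<)))
      (cong (λ t → kindFlags (kindOf n (val t))) (sym positionTrack-assemble))

    -- The column of first cells which the program sees, with the kind given by the two flags, is
    -- all that `nextTracks` takes its modes from.
    images-target : ∀ z le → (z , le) ≡ kindFlags (kind n jc) → ∀ h →
      Vec.concat (images id (modesQuarter z le h (Vec.lookup (Vec.head cs) cS)) cs) ≡ target (successor n true) (successor n false) h jc
    images-target z le eq h = trans (cong Vec.concat (sym (trans (cong (applyAll ms) toTracks-joined) (zipWith-tabulate apply ms (λ t → track (cS , t) cs)))))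
                                (byQuarter h)
      where
      ms = modesQuarter z le h (Vec.lookup (Vec.head cs) cS)
      column : ∀ {k} (cs : Vec Cell (suc k)) → Vec.map Vec.head (tracksOf (cS ,_) cs) ≡ Vec.lookup (Vec.head cs) cS
      column (c ∷ cs) = trans (sym (Vec.tabulate-∘ Vec.head (λ t → track (cS , t) (c ∷ cs)))) (Vec.tabulate∘lookup (Vec.lookup c cS))
      moved : ∀ b → Vec.concat (applyAll (modes (cellFlags z le b) (Vec.lookup (Vec.head cs) cS)) (toTracks jc)) ≡ successor n b jc
      moved b = cong Vec.concat (cong₂ (λ s col → applyAll (modes s col) (toTracks jc))
        (trans (cong₂ (λ z le → cellFlags z le b) (cong proj₁ eq) (cong proj₂ eq)) (cellFlags-kind (kind n jc) b))
        (sym (trans (cong (Vec.map Vec.head) toTracks-joined) (column cs))))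
      byQuarter : ∀ h → Vec.concat (applyAll (modesQuarter z le h (Vec.lookup (Vec.head cs) cS)) (toTracks jc)) ≡
               target (successor n true) (successor n false) h jc
      byQuarter (false ∷ false ∷ []) = moved true
      byQuarter (false ∷ true  ∷ []) = moved false
      byQuarter (true  ∷ _     ∷ []) = trans (cong Vec.concat (apply-keep (toTracks jc))) (concat-cut tracks (suc l) jc)

    gateBit-assemble : ∀ b → gateBit (assemble st cs) b ≡
      wordBit (eqV jc (zeros W) ∧ eqV jr (zeros W)) (eqV jc (ones W) ∧ eqV jr (ones W)) (eqV jo (zeros W))
        (eqV jo (target (successor n true) (successor n false) (Vec.drop 4 st) jc)) (Vec.drop 4 st) (Vec.take 4 st) b
    gateBit-assemble b
      rewrite fields-++ W (bitAt (successor n true) (successor n false) (λ _ → b)) (Vec.take 4 st) jo (Vec.drop 4 st) (jc Vec.++ jr)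
            | take-++ jc jr | eqV-replicate-++ W false jc jr | eqV-replicate-++ W true jc jr = refl

    zero-assemble : eqV (assemble st cs) (zeros (payloadWidth l)) ≡ eqV st (zeros 6) ∧ (eqV jo (zeros W) ∧ (eqV jc (zeros W) ∧ eqV jr (zeros W)))
    zero-assemble = begin
      eqV (assemble st cs) (zeros (payloadWidth l))
        ≡⟨ eqV-replicate-++ 4 false (Vec.take 4 st) (jo Vec.++ (Vec.drop 4 st Vec.++ (jc Vec.++ jr))) ⟩
      eqV (Vec.take 4 st) (zeros 4) ∧ eqV (jo Vec.++ (Vec.drop 4 st Vec.++ (jc Vec.++ jr))) (zeros (W + (2 + (W + W))))
        ≡⟨ cong (eqV (Vec.take 4 st) (zeros 4) ∧_) (trans (eqV-replicate-++ W false jo (Vec.drop 4 st Vec.++ (jc Vec.++ jr)))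
             (cong (eqV jo (zeros W) ∧_) (trans (eqV-replicate-++ 2 false (Vec.drop 4 st) (jc Vec.++ jr))
               (cong (eqV (Vec.drop 4 st) (zeros 2) ∧_) (eqV-replicate-++ W false jc jr))))) ⟩
      eqV (Vec.take 4 st) (zeros 4) ∧ (eqV jo (zeros W) ∧ (eqV (Vec.drop 4 st) (zeros 2) ∧ (eqV jc (zeros W) ∧ eqV jr (zeros W))))
        ≡⟨ ∧-rotate (eqV (Vec.take 4 st) (zeros 4)) (eqV (Vec.drop 4 st) (zeros 2)) (eqV jo (zeros W)) _ ⟨
      (eqV (Vec.take 4 st) (zeros 4) ∧ eqV (Vec.drop 4 st) (zeros 2)) ∧ (eqV jo (zeros W) ∧ (eqV jc (zeros W) ∧ eqV jr (zeros W)))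
        ≡⟨ cong (_∧ (eqV jo (zeros W) ∧ (eqV jc (zeros W) ∧ eqV jr (zeros W))))
             (trans (sym (eqV-replicate-++ 4 false (Vec.take 4 st) (Vec.drop 4 st))) (cong (λ s → eqV s (zeros 6)) (Vec.take++drop≡id 4 st))) ⟩
      eqV st (zeros 6) ∧ (eqV jo (zeros W) ∧ (eqV jc (zeros W) ∧ eqV jr (zeros W))) ∎
      where open ≡-Reasoning

  isLetter-flags : ∀ {z le} (k : Kind n) → (z , le) ≡ kindFlags k → not z ∧ le ≡ isLetter k
  isLetter-flags atLeft       refl = refl
  isLetter-flags (atLetter _) refl = refl
  isLetter-flags atRight      refl = refl

  ready : (fine tag same : Bool) → Vec Bool 6 → Asked → Memory
  ready f t s st q = record x₀ { fine = f ; tag = t ; same = s ; store = st ; asked = q }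

  exec-examine : ∀ f t s st q is (cs : Vec Cell (suc l)) r → track numIx cs ≡ pad (suc l) (bin n) →
    let v = assemble st cs in
    ∃[ y ] exec (examine ++ is) (ready f t s st q) cs r ≡ exec is y cs r × fine y ≡ f × tag y ≡ t × asked y ≡ q ×
      decide y ≡ verdict q f t (eqV v (zeros (payloadWidth l))) (isLetter (gateKind v)) (gateBit v true) (gateBit v false)
                   (check inc true (track argIx cs) (positionTrack v))
  exec-examine f t s st q is cs r eq = y , runs , refl , refl , refl , decided
    where
    v = assemble st cs
    jo = joined (oS ,_) cs
    jc = joined (cS ,_) cs
    jr = joined (rS ,_) cs
    P = track (cS , posT) cs
    x₁ = record (ready f t s st q) { z = eqV P (zeros (suc l)) ; le = leV true P (track numIx cs) }
    x₂ = record x₁ { argument = check inc true (track argIx cs) P ; carried = carries inc true (track argIx cs) P }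
    tested = exec-testTracks id is x₂ cs r
    y = record x₂
      { mode    = proj₁ tested ; carried = proj₁ (proj₂ tested)
      ; matches = eqV jo (Vec.concat (images id (modesNow x₂ (Vec.head cs)) cs))
      ; isZero  = eqV jo (zeros W)
      ; isFirst = eqV jc (zeros W) ∧ eqV jr (zeros W)
      ; isLast  = eqV jc (ones W) ∧ eqV jr (ones W) }
    runs : exec (examine ++ is) (ready f t s st q) cs r ≡ exec is y cs r
    runs = trans (cong (λ s → exec (argumentPass ∷ testTracks id ++ is) (proj₁ s) (proj₁ (proj₂ s)) (proj₂ (proj₂ s)))
                   (kindPass-cells (ready f t s st q) cs r))
             (trans (cong (λ s → exec (testTracks id ++ is) (proj₁ s) (proj₁ (proj₂ s)) (proj₂ (proj₂ s))) (argumentPass-cells x₁ cs r))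
               (proj₂ (proj₂ tested)))
    flags = flags-assemble st cs eq
    matched : matches y ≡ eqV jo (target (successor n true) (successor n false) (Vec.drop 4 st) jc)
    matched = cong (eqV jo) (images-target st cs (z x₂) (le x₂)
      (trans flags (cong (λ c → kindFlags (kind n c)) (register-assemble st cs))) (Vec.drop 4 st))
    opBits : ∀ b → opBit y b ≡ gateBit v b
    opBits b = trans (cong (λ m → wordBit (isFirst y) (isLast y) (isZero y) m (Vec.drop 4 st) (Vec.take 4 st) b) matched)
                 (sym (gateBit-assemble st cs b))
    decided : decide y ≡ verdict q f t (eqV v (zeros (payloadWidth l))) (isLetter (gateKind v)) (gateBit v true) (gateBit v false)
                           (check inc true (track argIx cs) (positionTrack v))
    decided = begin
      verdict q f t (eqV st (zeros 6) ∧ (isZero y ∧ isFirst y)) (not (z y) ∧ le y) (opBit y true) (opBit y false) (argument y)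
        ≡⟨ cong₂ (λ a b → verdict q f t a b (opBit y true) (opBit y false) (argument y))
             (sym (zero-assemble st cs)) (isLetter-flags (gateKind v) flags) ⟩
      verdict q f t (eqV v (zeros (payloadWidth l))) (isLetter (gateKind v)) (opBit y true) (opBit y false) (argument y)
        ≡⟨ cong₂ (λ a b → verdict q f t (eqV v (zeros (payloadWidth l))) (isLetter (gateKind v)) a b (argument y)) (opBits true) (opBits false) ⟩
      verdict q f t (eqV v (zeros (payloadWidth l))) (isLetter (gateKind v)) (gateBit v true) (gateBit v false) (argument y)
        ≡⟨ cong (λ p → verdict q f t (eqV v (zeros (payloadWidth l))) (isLetter (gateKind v)) (gateBit v true) (gateBit v false)
                  (check inc true (track argIx cs) p)) (sym (positionTrack-assemble st cs)) ⟩
      verdict q f t (eqV v (zeros (payloadWidth l))) (isLetter (gateKind v)) (gateBit v true) (gateBit v false)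
        (check inc true (track argIx cs) (positionTrack v)) ∎
      where open ≡-Reasoning

isBit-word : ∀ bs → not (isBit (peek (word bs []))) ≡ isEmpty bs
isBit-word []       = refl
isBit-word (b ∷ bs) = refl

argumentBits : Query → List Bool
argumentBits (hasType (input i)) = bin i
argumentBits _                   = []

module Answers (M : TM Bool) (n l : ℕ) (n< : n < 2 ^ suc l) (n-length : length (bin n) ≤ suc l) where

  open Examination M n l n< public
  open Memory

  T : ℕ
  T = payloadWidth l

  exec-look : ∀ f is x (cs : Vec Cell (suc l)) r →
    exec (look f ∷ is) x cs r ≡ exec is (proj₁ (f x (peek r) (Vec.head cs))) cs (advance (proj₂ (f x (peek r) (Vec.head cs))) r)
  exec-look f is x (c ∷ cs) r = refl

  exec-readTag : ∀ is x (cs : Vec Cell (suc l)) bs {r} → NonBit r →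
    exec (readTag ∷ is) x cs (word bs r) ≡ exec is (record x { tag = firstBit bs }) cs (word (List.drop 1 bs) r)
  exec-readTag is x (c ∷ cs) bs p rewrite bitOf-word bs p | advance-word bs p = refl

  exec-readQuery : ∀ is x (cs : Vec Cell (suc l)) q →
    exec (readQuery ∷ is) x cs (writeQuery q) ≡ exec is (record x { asked = query q }) cs (operands q)
  exec-readQuery is x (c ∷ cs) isOutput            = refl
  exec-readQuery is x (c ∷ cs) (hasType (input i)) =
    cong (exec is (record x { asked = askedInput }) (c ∷ cs)) (sym (List.++-identityʳ (bits i)))
  exec-readQuery is x (c ∷ cs) (hasType neg)       = refl
  exec-readQuery is x (c ∷ cs) (hasType and)       = refl
  exec-readQuery is x (c ∷ cs) (hasType or)        = refl
  exec-readQuery is x (c ∷ cs) (hasType oracle)    = refl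
  exec-readQuery is x (c ∷ cs) (wire p h) with bin p
  ... | []     = cong (λ r → exec is (record x { asked = askedWire }) (c ∷ cs) (`# ∷ r)) (sym (List.++-identityʳ (bits h)))
  ... | b ∷ bs = cong (λ r → exec is (record x { asked = askedWire }) (c ∷ cs) (word (b ∷ bs) (`# ∷ r))) (sym (List.++-identityʳ (bits h)))

  fits : ℕ → List Bool → Bool
  fits k bs = isEmpty (List.drop k bs)

  argumentFits : Query → Bool
  argumentFits q = fits (suc l) (argumentBits q)

  record ArgumentRead (is : List Instr) (x : Memory) (cs : Vec Cell (suc l)) (q : Query) : Set where
    field
      cells′ : Vec Cell (suc l)
      rest′  : List TupleSymbol
      reads  : exec (readArgument ∷ endArgument ∷ is) (record x { asked = query q }) cs (operands q) ≡
               exec is (record x { asked = query q ; fine = fine x ∧ argumentFits q }) cells′ rest′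
      frame  : ∀ i → i ≢ argIx → track i cells′ ≡ track i cs
      argues : track argIx cs ≡ zeros (suc l) → track argIx cells′ ≡ pad (suc l) (argumentBits q)
      rest-≡ : isWire (query q) ≡ true → rest′ ≡ operands q

  -- Both instructions are executed for every question; unless it concerns an input, they consume
  -- nothing and leave the cells as they are.
  exec-readArgument : ∀ is x cs q → ArgumentRead is x cs q
  exec-readArgument is x cs q = go q
    where
    idle : ∀ {k} x (cs : Vec Cell k) r → isInput (asked x) ≡ false → sweepCells (sweepOf readArgument) x cs r ≡ (x , cs , r)
    idle x []       r p = refl
    idle x (c ∷ cs) r p rewrite p | idle x cs r p = refl
    busy : ∀ {k} x (cs : Vec Cell k) bs → isInput (asked x) ≡ true → sweepCells (sweepOf readArgument) x cs (word bs []) ≡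
           (x , putTrack argIx (pad k bs) cs , word (List.drop k bs) [])
    busy x []       bs p = refl
    busy {suc k} x (c ∷ cs) bs p
      rewrite p | bitOf-word bs {[]} refl | advance-word bs {[]} refl | busy x cs (List.drop 1 bs) p | drop-suc k bs = refl
    unchanged : ∀ q → isInput (query q) ≡ false → argumentBits q ≡ [] → ArgumentRead is x cs q
    unchanged q p none = record
      { cells′ = cs ; rest′ = operands q
      ; reads  = trans (cong (λ s → exec (endArgument ∷ is) (proj₁ s) (proj₁ (proj₂ s)) (proj₂ (proj₂ s)))
                   (idle (record x { asked = query q }) cs (operands q) p))
                 (trans (exec-look _ is (record x { asked = query q }) cs (operands q))
                   (cong (λ f → exec is (record x { asked = query q ; fine = fine x ∧ f }) cs (operands q)) (fine-≡ (peek (operands q)))))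
      ; frame  = λ i _ → refl
      ; argues = λ eq → trans eq (sym (trans (cong (pad (suc l)) none) (pad-[] (suc l))))
      ; rest-≡ = λ _ → refl }
      where
      fine-≡ : ∀ a → (if isInput (query q) then not (isBit a) else true) ≡ argumentFits q
      fine-≡ a rewrite p | none = refl
    go : ∀ q → ArgumentRead is x cs q
    go isOutput         = unchanged isOutput refl refl
    go (hasType neg)    = unchanged (hasType neg) refl refl
    go (hasType and)    = unchanged (hasType and) refl refl
    go (hasType or)     = unchanged (hasType or) refl refl
    go (hasType oracle) = unchanged (hasType oracle) refl refl
    go (wire p h)       = unchanged (wire p h) refl refl
    go (hasType (input i)) = record
      { cells′ = putTrack argIx (pad (suc l) (bin i)) cs ; rest′ = word (List.drop (suc l) (bin i)) []
      ; reads  = trans (cong (λ s → exec (endArgument ∷ is) (proj₁ s) (proj₁ (proj₂ s)) (proj₂ (proj₂ s)))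
                   (busy (record x { asked = askedInput }) cs (bin i) refl))
                 (trans (exec-look _ is (record x { asked = askedInput }) (putTrack argIx (pad (suc l) (bin i)) cs) (word (List.drop (suc l) (bin i)) []))
                   (cong (λ f → exec is (record x { asked = askedInput ; fine = fine x ∧ f }) (putTrack argIx (pad (suc l) (bin i)) cs)
                            (word (List.drop (suc l) (bin i)) [])) (isBit-word (List.drop (suc l) (bin i)))))
      ; frame  = λ j ≢ → track-putTrack′ j argIx (pad (suc l) (bin i)) cs ≢
      ; argues = λ _ → track-putTrack argIx (pad (suc l) (bin i)) cs
      ; rest-≡ = λ () }

  assemble-frame : ∀ st (cs ds : Vec Cell (suc l)) → (∀ i → i ≢ argIx → track i ds ≡ track i cs) → assemble st ds ≡ assemble st cs
  assemble-frame st cs ds p = cong₂ (λ o b → Vec.take 4 st Vec.++ (o Vec.++ (Vec.drop 4 st Vec.++ b)))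
    (joined-≡ (λ t → p (oS , t) (λ ()))) (cong₂ Vec._++_ (joined-≡ (λ t → p (cS , t) (λ ()))) (joined-≡ (λ t → p (rS , t) (λ ()))))

  payloadOf : ℕ → Payload
  payloadOf g = pad T (List.drop 1 (bin g))

  tagOf : ℕ → Bool
  tagOf g = firstBit (bin g)

  gateFits : ℕ → Bool
  gateFits g = fits T (List.drop 1 (bin g))

  verdictOn : ℕ → Query → Bool
  verdictOn g q = let v = payloadOf g in
    verdict (query q) (argumentFits q) (tagOf g) (eqV v (zeros T)) (isLetter (gateKind v)) (gateBit v true) (gateBit v false)
            (check inc true (pad (suc l) (argumentBits q)) (positionTrack v))

  wireHolds : ℕ → ℕ → Bool
  wireHolds p h = fits T (bin p) ∧ (gateFits h ∧ (not (tagOf h) ∧ eqV (pad T (bin p)) (payloadOf h)))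

  module _ (cells₀ : Vec Cell (suc l)) (blank : track argIx cells₀ ≡ zeros (suc l)) where

    record GateRead (g : ℕ) (q : Query) : Set where
      field
        memory   : Memory
        cells′   : Vec Cell (suc l)
        rest′    : List TupleSymbol
        reads    : proj₁ (exec program x₀ cells₀ ⟨ n , g , q ⟩) ≡ proj₁ (exec (payload afterWire) memory cells′ rest′)
        asked-≡  : asked memory ≡ query q
        fine-≡   : fine memory ≡ argumentFits q
        result-≡ : result memory ≡ verdictOn g q
        rest-≡   : isWire (query q) ≡ true → rest′ ≡ operands q

    reading : ∀ g q → (gateFits g ≡ false × answer (proj₁ (exec program x₀ cells₀ ⟨ n , g , q ⟩)) ≡ false) ⊎
                      (gateFits g ≡ true × GateRead g q)
    reading g q = byFit (List.drop T bs) refl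
      where
      R = writeQuery q
      bs = List.drop 1 (bin g)
      t = tagOf g
      v₀ = pad (suc l) (bin n)
      cells₁ = putTrack numIx v₀ cells₀
      x₁ = record x₀ { tag = t }
      numberRead : exec program x₀ cells₀ ⟨ n , g , q ⟩ ≡ exec (payload afterGate) x₁ cells₁ (word bs (`# ∷ R))
      numberRead = trans
        (cong (λ s → exec (expectHash ∷ readTag ∷ payload afterGate) (proj₁ s) (proj₁ (proj₂ s)) (proj₂ (proj₂ s)))
          (readTrack-cells numIx x₀ cells₀ (bin n) {`# ∷ word (bin g) (`# ∷ R)} refl))
        (trans (cong (λ ds → exec (expectHash ∷ readTag ∷ payload afterGate)
                   (record x₀ { same = true ∧ eqV (track numIx cells₀) v₀ }) cells₁ (word ds (`# ∷ word (bin g) (`# ∷ R))))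
                   (List.drop-all (suc l) (bin n) n-length))
          (trans (exec-look _ (readTag ∷ payload afterGate) (record x₀ { same = true ∧ eqV (track numIx cells₀) v₀ }) cells₁ (`# ∷ word (bin g) (`# ∷ R)))
            (exec-readTag (payload afterGate) x₀ cells₁ (bin g) {`# ∷ R} refl)))
      open PayloadRead (exec-payload afterGate x₁ cells₁ bs {`# ∷ R} refl) renaming (reads to payload-reads; frame to payload-frame)
      s₁ = eqV (assemble (store x₁) cells₁) (pad T bs)
      x₂ = record x₁ { same = true ∧ s₁ ; store = store′ }
      tail′ = readQuery ∷ readArgument ∷ endArgument ∷ examine ++ (storeResult ∷ payload afterWire)
      gateRead : exec program x₀ cells₀ ⟨ n , g , q ⟩ ≡ exec (expectHash ∷ tail′) x₂ cells′ (word (List.drop T bs) (`# ∷ R))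
      gateRead = trans numberRead payload-reads
      byFit : ∀ ds → List.drop T bs ≡ ds → (gateFits g ≡ false × answer (proj₁ (exec program x₀ cells₀ ⟨ n , g , q ⟩)) ≡ false) ⊎
                      (gateFits g ≡ true × GateRead g q)
      -- The number of the gate is too long: a bit is left where the separator is expected.
      byFit (d ∷ ds) eq = inj₁ (cong isEmpty eq , trans (cong (answer ∘ proj₁) (trans gateRead
        (trans (cong (λ ds → exec (expectHash ∷ tail′) x₂ cells′ (word ds (`# ∷ R))) eq) (exec-look _ tail′ x₂ cells′ (word (d ∷ ds) (`# ∷ R))))))
        (failed-gate (record x₂ { fine = false ; same = true }) cells′ (word ds (`# ∷ R)) refl))
      byFit [] eq = inj₂ (cong isEmpty eq , record
        { memory   = record y { result = decide y }
        ; cells′   = A.cells′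
        ; rest′    = A.rest′
        ; reads    = cong proj₁ (trans gateRead (trans (cong (λ ds → exec (expectHash ∷ tail′) x₂ cells′ (word ds (`# ∷ R))) eq)
                       (trans (exec-look _ tail′ x₂ cells′ (`# ∷ R))
                         (trans (exec-readQuery _ x₃ cells′ q) (trans A.reads (trans runs (exec-look _ _ y A.cells′ A.rest′)))))))
        ; asked-≡  = asked-y
        ; fine-≡   = fine-y
        ; result-≡ = trans decided (cong₂ (λ v a → verdict (query q) (argumentFits q) t (eqV v (zeros T)) (isLetter (gateKind v))
                       (gateBit v true) (gateBit v false) (check inc true a (positionTrack v)))
                       (trans (assemble-frame store′ cells′ A.cells′ A.frame) stored) (A.argues argument₀))
        ; rest-≡   = A.rest-≡
        })
        where
        x₃ = record x₂ { fine = true ; same = true }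
        module A = ArgumentRead (exec-readArgument (examine ++ (storeResult ∷ payload afterWire)) x₃ cells′ q)
        number : track numIx A.cells′ ≡ v₀
        number = trans (A.frame numIx λ ()) (trans (payload-frame numIx (λ ()) (λ ()) (λ ())) (track-putTrack numIx v₀ cells₀))
        argument₀ : track argIx cells′ ≡ zeros (suc l)
        argument₀ = trans (payload-frame argIx (λ ()) (λ ()) (λ ())) (trans (track-putTrack′ argIx numIx v₀ cells₀ λ ()) blank)
        examined = exec-examine (argumentFits q) t true store′ (query q) (storeResult ∷ payload afterWire) A.cells′ A.rest′ number
        y = proj₁ examined
        runs = proj₁ (proj₂ examined)
        fine-y = proj₁ (proj₂ (proj₂ examined))
        asked-y = proj₁ (proj₂ (proj₂ (proj₂ (proj₂ examined))))
        decided = proj₂ (proj₂ (proj₂ (proj₂ (proj₂ examined))))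

    answer-type : ∀ g q → isWire (query q) ≡ false →
      answer (proj₁ (exec program x₀ cells₀ ⟨ n , g , q ⟩)) ≡ gateFits g ∧ verdictOn g q
    answer-type g q notWire with reading g q
    ... | inj₁ (unfit , eq) = trans eq (sym (cong (_∧ verdictOn g q) unfit))
    ... | inj₂ (fit , read) = trans (cong answer reads)
        (trans (settled-answer memory cells′ rest′ (trans (cong isWire asked-≡) notWire))
          (trans result-≡ (sym (cong (_∧ verdictOn g q) fit))))
        where open GateRead read

    -- The stored result comes down to the tag of `g`, as only oracle gates have predecessors. Since
    -- `h` is read over `p`, the flag `same` then compares their payloads.
    answer-wire : ∀ g p h → answer (proj₁ (exec program x₀ cells₀ ⟨ n , g , wire p h ⟩)) ≡ gateFits g ∧ (tagOf g ∧ wireHolds p h)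
    answer-wire g p h with reading g (wire p h)
    ... | inj₁ (unfit , eq) = trans eq (sym (cong (_∧ (tagOf g ∧ wireHolds p h)) unfit))
    ... | inj₂ (fit , read) = trans (cong answer reads)
        (trans (trans (cong (λ r → answer (proj₁ (exec (payload afterWire) memory cells′ r))) (rest-≡ refl)) (byFit (List.drop T (bin p)) refl))
          (cong (_∧ (tagOf g ∧ wireHolds p h)) (sym fit)))
      where
      open GateRead read
      R = word (bin h) []
      module P = PayloadRead (exec-payload afterWire memory cells′ (bin p) {`# ∷ R} refl)
      x₁ = record memory { same = same memory ∧ eqV (assemble (store memory) cells′) (pad T (bin p)) ; store = P.store′ }
      byFit : ∀ ds → List.drop T (bin p) ≡ ds →
        answer (proj₁ (exec (payload afterWire) memory cells′ (word (bin p) (`# ∷ R)))) ≡ tagOf g ∧ wireHolds p h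
      byFit (d ∷ ds) eq = trans (cong (answer ∘ proj₁) (trans P.reads
          (trans (cong (λ ds → exec afterWire x₁ P.cells′ (word ds (`# ∷ R))) eq) (exec-look _ _ x₁ P.cells′ (word (d ∷ ds) (`# ∷ R))))))
        (trans (failed-wire (record x₁ { fine = fine memory ∧ false ; same = true }) P.cells′ (word ds (`# ∷ R)) (Bool.∧-zeroʳ (fine memory)) asked-≡)
          (sym (trans (cong (λ b → tagOf g ∧ (b ∧ (gateFits h ∧ (not (tagOf h) ∧ eqV (pad T (bin p)) (payloadOf h))))) (cong isEmpty eq))
            (Bool.∧-zeroʳ (tagOf g)))))
      byFit [] eq = trans (cong (answer ∘ proj₁) whole) value
        where
        hs = List.drop 1 (bin h)
        x₂ = record x₁ { fine = fine memory ∧ true ; same = true }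
        x₃ = record x₂ { tag = tagOf h }
        module Q = PayloadRead (exec-payload (expectEnd ∷ []) x₃ P.cells′ hs {[]} refl)
        x₄ = record x₃ { same = eqV (assemble P.store′ P.cells′) (pad T hs) ; store = Q.store′ }
        x₅ = record x₄ { fine = (fine memory ∧ true) ∧ not (isBit (peek (word (List.drop T hs) []))) }
        whole : exec (payload afterWire) memory cells′ (word (bin p) (`# ∷ R)) ≡ exec [] x₅ Q.cells′ (word (List.drop T hs) [])
        whole = trans P.reads (trans (cong (λ ds → exec afterWire x₁ P.cells′ (word ds (`# ∷ R))) eq)
          (trans (exec-look _ _ x₁ P.cells′ (`# ∷ R)) (trans (exec-readTag (payload (expectEnd ∷ [])) x₂ P.cells′ (bin h) refl)
            (trans Q.reads (exec-look _ [] x₄ Q.cells′ (word (List.drop T hs) []))))))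
        value : answer x₅ ≡ tagOf g ∧ wireHolds p h
        value = begin
          result memory ∧ (if isWire (asked memory) then
             ((fine memory ∧ true) ∧ not (isBit (peek (word (List.drop T hs) [])))) ∧ (not (tagOf h) ∧ eqV (assemble P.store′ P.cells′) (pad T hs)) else true)
            ≡⟨ cong₂ (λ r a → r ∧ (if isWire a then ((fine memory ∧ true) ∧ not (isBit (peek (word (List.drop T hs) [])))) ∧
                 (not (tagOf h) ∧ eqV (assemble P.store′ P.cells′) (pad T hs)) else true)) result-≡ asked-≡ ⟩
          tagOf g ∧ (((fine memory ∧ true) ∧ not (isBit (peek (word (List.drop T hs) [])))) ∧ (not (tagOf h) ∧ eqV (assemble P.store′ P.cells′) (pad T hs)))
            ≡⟨ cong₂ (λ f b → tagOf g ∧ (((f ∧ true) ∧ b) ∧ (not (tagOf h) ∧ eqV (assemble P.store′ P.cells′) (pad T hs)))) fine-≡ (isBit-word (List.drop T hs)) ⟩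
          tagOf g ∧ (gateFits h ∧ (not (tagOf h) ∧ eqV (assemble P.store′ P.cells′) (pad T hs)))
            ≡⟨ cong (λ v → tagOf g ∧ (gateFits h ∧ (not (tagOf h) ∧ eqV v (pad T hs)))) P.stored ⟩
          tagOf g ∧ (gateFits h ∧ (not (tagOf h) ∧ eqV (pad T (bin p)) (payloadOf h)))
            ≡⟨ cong (λ b → tagOf g ∧ (b ∧ (gateFits h ∧ (not (tagOf h) ∧ eqV (pad T (bin p)) (payloadOf h))))) (sym (cong isEmpty eq)) ⟩
          tagOf g ∧ wireHolds p h ∎
          where open ≡-Reasoning

    outcome-type : ∀ g q → isWire (query q) ≡ false → outcome program answer x₀ cells₀ ⟨ n , g , q ⟩ ≡ gateFits g ∧ verdictOn g q
    outcome-type g q notWire = trans (outcome-≡ program answer x₀ cells₀ ⟨ n , g , q ⟩) (answer-type g q notWire)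

    outcome-wire : ∀ g p h → outcome program answer x₀ cells₀ ⟨ n , g , wire p h ⟩ ≡ gateFits g ∧ (tagOf g ∧ wireHolds p h)
    outcome-wire g p h = trans (outcome-≡ program answer x₀ cells₀ ⟨ n , g , wire p h ⟩) (answer-wire g p h)

-- Circuits

-- The gate for a bit of the word that is `b₁` or `b₀` according to the letter. At a marker only
-- `b₁` counts, since `letterOf` is `true` there. A negated input, with `b₁` false and `b₀` true, is
-- excluded by `wordBit-mono`.
leaf : ∀ {n s} → Kind n → (b₁ b₀ : Bool) → Gate n s
leaf (atLetter i) true  false = input i
leaf (atLetter i) true  true  = and []
leaf (atLetter i) false _     = or []
leaf atLeft       true  _     = and []
leaf atLeft       false _     = or []
leaf atRight      true  _     = and []
leaf atRight      false _     = or []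

leaf-predecessors : ∀ {n s} (k : Kind n) b₁ b₀ → predecessors (leaf {n} {s} k b₁ b₀) ≡ []
leaf-predecessors (atLetter i) true  true  = refl
leaf-predecessors (atLetter i) true  false = refl
leaf-predecessors (atLetter i) false b     = refl
leaf-predecessors atLeft       true  b     = refl
leaf-predecessors atLeft       false b     = refl
leaf-predecessors atRight      true  b     = refl
leaf-predecessors atRight      false b     = refl

-- Circuits with a leaf for each word of length T, and oracle gates all of
-- which query the word of the values of all leaves. The low-order bit of
-- the number of a gate tells oracle gates from leaves.

module TwoLevel (n T : ℕ) (leafOf : Vec Bool T → Gate n (2 ^ suc T))
                (leafOf-predecessors : ∀ v → predecessors (leafOf v) ≡ []) where

  tagOf : ℕ → Bool
  tagOf g = firstBit (bin g)

  payloadOf : ℕ → Vec Bool T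
  payloadOf g = pad T (List.drop 1 (bin g))

  number : Vec Bool (suc T) → Fin (2 ^ suc T)
  number v = Fin.fromℕ< (val<2^ v)

  toℕ-number : ∀ v → toℕ (number v) ≡ val v
  toℕ-number v = Fin.toℕ-fromℕ< (val<2^ v)

  tag-number : ∀ t p → tagOf (toℕ (number (t ∷ p))) ≡ t
  tag-number t p = cong Vec.head (trans (cong (pad (suc T) ∘ bin) (toℕ-number (t ∷ p))) (pad-bin-val (t ∷ p)))

  payload-number : ∀ t p → payloadOf (toℕ (number (t ∷ p))) ≡ p
  payload-number t p = cong Vec.tail (trans (cong (pad (suc T) ∘ bin) (toℕ-number (t ∷ p))) (pad-bin-val (t ∷ p)))

  children : List (Fin (2 ^ suc T))
  children = List.map (λ p → number (false ∷ p)) (allVecs T)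

  -- Half of the gates are copies of one oracle gate, and the copy with payload 0 is the output. In
  -- return every number of at most `suc T` bits belongs to a gate, so that the range of gate
  -- numbers is tested by length alone.
  circuit : Circuit n
  circuit = record
    { size   = 2 ^ suc T
    ; gate   = λ g → if tagOf (toℕ g) then oracle children else leafOf (payloadOf (toℕ g))
    ; output = number (true ∷ zeros T)
    }

  open Circuit circuit using (gate; Path; here; there)

  gate-false : ∀ {g} → tagOf (toℕ g) ≡ false → gate g ≡ leafOf (payloadOf (toℕ g))
  gate-false {g} = cong (λ t → if t then oracle children else leafOf (payloadOf (toℕ g)))

  children-tag : All (λ g → tagOf (toℕ g) ≡ false) children
  children-tag = All.map⁺ (All.universal (tag-number false) (allVecs T))

  leaf-path : ∀ {g k} → tagOf (toℕ g) ≡ false → Path g k → k ≡ 0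
  leaf-path eq here = refl
  leaf-path {g} eq (there p path) with predecessors (gate g) | trans (cong predecessors (gate-false {g} eq)) (leafOf-predecessors (payloadOf (toℕ g)))
  leaf-path eq (there () path) | .[] | refl

  depth : Circuit.Depth≤ circuit 1
  depth here = z≤n
  depth {g} (there p path) = s≤s (≤-reflexive (leaf-path (after p) path))
    where
    after : (p : Fin (length (predecessors (gate g)))) → tagOf (toℕ (List.lookup (predecessors (gate g)) p)) ≡ false
    after p with tagOf (toℕ g)
    ... | true  = All.lookup children-tag (List.∈-lookup p)
    ... | false with predecessors (leafOf (payloadOf (toℕ g))) | leafOf-predecessors (payloadOf (toℕ g))
    after () | false | .[] | refl

  size≤ : Circuit.Size≤ circuit (2 ^ suc T)
  size≤ = ≤-refl , λ g → bound g
    where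
    bound : ∀ g → length (predecessors (gate g)) ≤ 2 ^ suc T
    bound g with tagOf (toℕ g)
    ... | true  = ≤-trans (≤-reflexive (trans (List.length-map _ (allVecs T)) (length-allVecs T))) (^-monoʳ-≤ 2 (n≤1+n T))
    ... | false = ≤-trans (≤-reflexive (cong length (leafOf-predecessors (payloadOf (toℕ g))))) z≤n

  module _ (D : Language) (x : Vec Bool n) (b : Bool) (leafValue : Vec Bool T → Bool) where

    value : Fin (2 ^ suc T) → Bool
    value g = if tagOf (toℕ g) then b else leafValue (payloadOf (toℕ g))

    word-value : List.map value children ≡ List.map leafValue (allVecs T)
    word-value = trans (sym (List.map-∘ (allVecs T))) (List.map-cong
      (λ p → cong₂ (λ t v → if t then b else leafValue v) (tag-number false p) (payload-number false p)) (allVecs T))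

    outputs : (∀ v → Circuit.Correct circuit D x value (leafValue v) (leafOf v)) →
              (D (List.map leafValue (allVecs T)) ⇔ b ≡ true) → Circuit.Outputs circuit D x b
    outputs leaf-correct h = value , evaluation ,
      cong (λ t → if t then b else leafValue (payloadOf (toℕ (number (true ∷ zeros T))))) (tag-number true (zeros T))
      where
      word′ : D (List.map value children) ⇔ b ≡ true
      word′ = subst (λ w → D w ⇔ b ≡ true) (sym word-value) h
      evaluation : Circuit.IsEvaluation circuit D x value
      evaluation g with tagOf (toℕ g)
      ... | true  = mk⇔ (Equivalence.from word′) (Equivalence.to word′)
      ... | false = leaf-correct (payloadOf (toℕ g))

leaf-correct : ∀ {n} (C : Circuit n) D (x : Vec Bool n) val k (f : Bool → Bool) → (f false ≡ true → f true ≡ true) →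
               Circuit.Correct C D x val (f (letterOf x k)) (leaf k (f true) (f false))
leaf-correct C D x val k f mono with f true in p | f false in q
leaf-correct C D x val atLeft       f mono | true  | b₀    = p
leaf-correct C D x val atLeft       f mono | false | b₀    = p
leaf-correct C D x val atRight      f mono | true  | b₀    = p
leaf-correct C D x val atRight      f mono | false | b₀    = p
leaf-correct C D x val (atLetter i) f mono | true  | true  with Vec.lookup x i
... | true  = p
... | false = q
leaf-correct C D x val (atLetter i) f mono | true  | false with Vec.lookup x i
... | true  = p
... | false = q
leaf-correct C D x val (atLetter i) f mono | false | false with Vec.lookup x i
... | true  = p
... | false = q
leaf-correct C D x val (atLetter i) f mono | false | true  = case mono refl of λ ()

-- Polynomial size

gate-number-length : ∀ t S u → 1 ≤ S → let W = t * (S * u) in 5 + (W + (2 + (W + W))) ≤ S * (7 + 3 * (t * u))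
gate-number-length t S u 1≤S = go (t * (S * u)) (trans (x∙yz≈y∙xz t S u) refl)
  where
  open ≤-Reasoning
  go : ∀ W → W ≡ S * (t * u) → 5 + (W + (2 + (W + W))) ≤ S * (7 + 3 * (t * u))
  go W eq = begin
    5 + (W + (2 + (W + W)))    ≡⟨ cong (5 +_) (trans (+-suc W (1 + (W + W))) (cong suc (+-suc W (W + W)))) ⟩
    7 + (W + (W + W))          ≡⟨ cong (λ k → 7 + (W + (W + k))) (+-identityʳ W) ⟨
    7 + 3 * W                  ≤⟨ +-mono-≤ {7} {S * 7} (*-monoˡ-≤ 7 1≤S) (≤-reflexive (trans (cong (3 *_) eq) (x∙yz≈y∙xz 3 S (t * u)))) ⟩
    S * 7 + S * (3 * (t * u))  ≡⟨ *-distribˡ-+ S 7 (3 * (t * u)) ⟨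
    S * (7 + 3 * (t * u))      ∎

abstract

  -- The number of gates turns out to be at most `(2 * (1 + 2 * n)) ^ e`. Its base is at most 6 for
  -- `n` below 2, and at most `n ^ 4` from 2 on; hence the two summands.
  degree : ℕ → ℕ
  degree e = 6 ^ e + 4 * e

  polynomial : ∀ n e t → t ≤ suc (length (bin n)) * e → 2 ^ t ≤ n ^ degree e + degree e
  polynomial n e t t≤ = begin
    2 ^ t                           ≤⟨ ^-monoʳ-≤ 2 t≤ ⟩
    2 ^ (suc (length (bin n)) * e)  ≡⟨ ^-*-assoc 2 (suc (length (bin n))) e ⟨
    (2 * 2 ^ length (bin n)) ^ e    ≤⟨ ^-monoˡ-≤ e (*-monoʳ-≤ 2 (2^length-bin≤ n)) ⟩
    (2 * (1 + 2 * n)) ^ e           ≤⟨ small n ⟩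
    n ^ k + k                       ∎
    where
    open ≤-Reasoning
    k : ℕ
    k = 6 ^ e + 4 * e
    small : ∀ n → (2 * (1 + 2 * n)) ^ e ≤ n ^ k + k
    small zero          = ≤-trans (^-monoˡ-≤ e (s≤s (s≤s z≤n))) (≤-trans (m≤m+n (6 ^ e) (4 * e)) (m≤n+m k (0 ^ k)))
    small (suc zero)    = ≤-trans (m≤m+n (6 ^ e) (4 * e)) (m≤n+m k (1 ^ k))
    small (suc (suc i)) = begin
      (2 * (1 + 2 * j)) ^ e ≤⟨ ^-monoˡ-≤ e base ⟩
      (j ^ 4) ^ e           ≡⟨ ^-*-assoc j 4 e ⟩
      j ^ (4 * e)           ≤⟨ ^-monoʳ-≤ j (m≤n+m (4 * e) (6 ^ e)) ⟩
      j ^ k                 ≤⟨ m≤m+n (j ^ k) k ⟩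
      j ^ k + k             ∎
      where
      j : ℕ
      j = 2 + i
      2≤j : 2 ≤ j
      2≤j = s≤s (s≤s z≤n)
      base : 2 * (1 + 2 * j) ≤ j ^ 4
      base = begin
        2 * (1 + 2 * j)     ≤⟨ *-monoʳ-≤ 2 (+-monoˡ-≤ (2 * j) (≤-trans (s≤s z≤n) (m≤n*m j 2))) ⟩
        2 * (2 * j + 2 * j) ≡⟨ cong (2 *_) (trans (sym (*-distribʳ-+ j 2 2)) (*-assoc 2 2 j)) ⟩
        2 * (2 * (2 * j))   ≤⟨ *-mono-≤ 2≤j (*-mono-≤ 2≤j (*-mono-≤ 2≤j (≤-reflexive (sym (*-identityʳ j))))) ⟩
        j * (j * (j * (j * 1))) ∎

module Family (M : TM Bool) (m : ℕ) where

  -- `suc (extent n)` is `suc m` times one more than the length of `bin n`, the number of cells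
  -- which the sweeping machine lays out on the left marker and the bits of `n`. Tracks of this
  -- length hold head positions up to `suc n`, and stacks within the space bound if its factor is at
  -- most `suc m`.
  extent : ℕ → ℕ
  extent n = m + length (bin n) * suc m

  1+len≤ : ∀ n → suc (length (bin n)) ≤ suc (extent n)
  1+len≤ n = s≤s (≤-trans (m≤m*n (length (bin n)) (suc m)) (m≤n+m _ m))

  len≤ : ∀ n → length (bin n) ≤ suc (extent n)
  len≤ n = ≤-trans (n≤1+n _) (1+len≤ n)

  1+n< : ∀ n → suc n < 2 ^ suc (extent n)
  1+n< n = begin-strict
    suc n                         ≤⟨ n<2^length-bin n ⟩
    2 ^ length (bin n)            <⟨ ^-monoʳ-< 2 ≤-refl (1+len≤ n) ⟩
    2 ^ suc (extent n)            ∎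
    where open ≤-Reasoning

  n<2^ : ∀ n → n < 2 ^ suc (extent n)
  n<2^ n = ≤-trans (n≤1+n _) (1+n< n)

  module _ (n : ℕ) where

    open Answers M n (extent n) (n<2^ n) (len≤ n)

    leafOf : Payload → Gate n (2 ^ suc T)
    leafOf v = leaf (gateKind v) (gateBit v true) (gateBit v false)

    module Two = TwoLevel n T leafOf (λ v → leaf-predecessors (gateKind v) (gateBit v true) (gateBit v false))

    outputs : ∀ (x : Vec Bool n) b →
      (MSAT (programWord (successor n true) (successor n false) (λ c → letterOf x (kind n c))) ⇔ b ≡ true) →
      Circuit.Outputs Two.circuit MSAT x b
    outputs x b = Two.outputs MSAT x b (λ v → gateBit v (letterOf x (gateKind v)))
      (λ v → leaf-correct Two.circuit MSAT x _ (gateKind v) (gateBit v)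
        (gateBit-mono v))

  circuit : CircuitFamily
  circuit n = Two.circuit n

  exponent : ℕ
  exponent = 7 + 3 * (tracks * suc m)
    where open Simulation M

  size-bound : ∀ n → 2 ^ suc (Answers.T M n (extent n) (n<2^ n) (len≤ n)) ≤ n ^ degree exponent + degree exponent
  size-bound n = polynomial n exponent _ (gate-number-length (Simulation.tracks M) (suc (length (bin n))) (suc m) (s≤s z≤n))

  isAC⁰ : IsAC⁰ circuit
  isAC⁰ = (1 , λ n → Two.depth n) , degree exponent , λ n → size-bound n , λ g → ≤-trans (proj₂ (Two.size≤ n) g) (size-bound n)

  decides : ∀ A c → c ≤ suc m → (∀ w → ∃[ b ] AnswersInSpace M w (c * suc ⌊log₂ length w ⌋) b × (b ≡ true ⇔ A w)) →
            Decides circuit MSAT A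
  decides A c c≤ h n x =
    proj₁ answered , outputs n x (proj₁ answered) (R.word-correct x (1+n< n) space (proj₁ (proj₂ answered))) , proj₂ (proj₂ answered)
    where
    answered = h (Vec.toList x)
    module R = Registers M (extent n)
    space : c * suc ⌊log₂ length (Vec.toList x) ⌋ ≤ suc (extent n)
    space = begin
      c * suc ⌊log₂ length (Vec.toList x) ⌋ ≡⟨ cong (λ k → c * suc ⌊log₂ k ⌋) (Vec.length-toList x) ⟩
      c * suc ⌊log₂ n ⌋                     ≤⟨ *-mono-≤ c≤ (s≤s (⌊log₂⌋≤length-bin n)) ⟩
      suc m * suc (length (bin n))          ≡⟨ *-comm (suc m) _ ⟩
      suc (extent n)                        ∎
      where open ≤-Reasoning

-- Uniformity

∧-true : ∀ {a b} → a ∧ b ≡ true → a ≡ true × b ≡ true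
∧-true {true} {true} refl = refl , refl

true-∧ : ∀ {a b} → a ≡ true → b ≡ true → a ∧ b ≡ true
true-∧ refl refl = refl

not-true : ∀ {a} → not a ≡ true → a ≡ false
not-true {false} refl = refl

isEmpty-drop : ∀ k bs → isEmpty (List.drop k bs) ≡ true ⇔ length bs ≤ k
isEmpty-drop k       []       = mk⇔ (λ _ → z≤n) (λ _ → cong isEmpty (List.drop-[] k))
isEmpty-drop zero    (b ∷ bs) = mk⇔ (λ ()) (λ ())
isEmpty-drop (suc k) (b ∷ bs) = mk⇔ (s≤s ∘ to (isEmpty-drop k bs)) (from (isEmpty-drop k bs) ∘ ≤-pred)
  where open Equivalence

isEmpty-bin : ∀ k n → isEmpty (List.drop k (bin n)) ≡ true ⇔ n < 2 ^ k
isEmpty-bin k n = mk⇔ (length≤⇒<2^ k n ∘ to (isEmpty-drop k (bin n))) (from (isEmpty-drop k (bin n)) ∘ length-bin≤ k)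
  where open Equivalence

lookup-iterate : ∀ {A : Set} (f : A → ℕ) xs a m → List.map f xs ≡ List.iterate suc a m → ∀ i → f (List.lookup xs i) ≡ a + toℕ i
lookup-iterate f (x ∷ xs) a (suc m) eq 0F    = trans (List.∷-injectiveˡ eq) (sym (+-identityʳ a))
lookup-iterate f (x ∷ xs) a (suc m) eq (Fin.suc i) = trans (lookup-iterate f xs (suc a) m (List.∷-injectiveʳ eq) i) (sym (+-suc a (toℕ i)))

map-index : ∀ {A B : Set} (f : A → B) xs (i : Fin (length (List.map f xs))) →
            ∃[ j ] toℕ j ≡ toℕ i × List.lookup (List.map f xs) i ≡ f (List.lookup xs j)
map-index f (x ∷ xs) 0F    = 0F , refl , refl
map-index f (x ∷ xs) (Fin.suc i) with map-index f xs i
... | j , eq , eq′ = Fin.suc j , cong suc eq , eq′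

lookup-allVecs : ∀ k i → List.lookup (allVecs k) i ≡ pad k (bin (toℕ i))
lookup-allVecs k i = trans (sym (pad-bin-val _)) (cong (pad k ∘ bin) (lookup-iterate val (allVecs k) 0 (2 ^ k) (map-val-allVecs k) i))

module Connections (n T : ℕ) (leafOf : Vec Bool T → Gate n (2 ^ suc T))
                   (leafOf-predecessors : ∀ v → predecessors (leafOf v) ≡ []) where

  open TwoLevel n T leafOf leafOf-predecessors
  open Circuit circuit using (gate; output)

  InRange : ℕ → Bool
  InRange g = isEmpty (List.drop T (List.drop 1 (bin g)))

  inRange : ∀ g → InRange g ≡ true ⇔ g < 2 ^ suc T
  inRange g = mk⇔ (λ p → to (isEmpty-bin (suc T) g) (trans (cong isEmpty (sym (drop-suc T (bin g)))) p))
                  (λ p → trans (cong isEmpty (drop-suc T (bin g))) (from (isEmpty-bin (suc T) g) p))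
    where open Equivalence

  val-number : ∀ g → g < 2 ^ suc T → val (tagOf g ∷ payloadOf g) ≡ g
  val-number g p = val-pad-bin (suc T) g p

  Connected : ℕ → (Fin (2 ^ suc T) → Set) → Set
  Connected g P = ∃[ g′ ] toℕ g′ ≡ g × P g′

  connected : ∀ g (b : Bool) (P : Fin (2 ^ suc T) → Set) → (∀ g′ → toℕ g′ ≡ g → b ≡ true ⇔ P g′) →
              InRange g ∧ b ≡ true ⇔ Connected g P
  connected g b P h = mk⇔
    (λ eq → let p , q = ∧-true {InRange g} eq
                g′ = Fin.fromℕ< (Equivalence.to (inRange g) p)
                g′≡g = Fin.toℕ-fromℕ< (Equivalence.to (inRange g) p)
            in g′ , g′≡g , Equivalence.to (h g′ g′≡g) q)
    (λ { (g′ , g′≡g , p) → true-∧ (Equivalence.from (inRange g) (subst (_< 2 ^ suc T) g′≡g (Fin.toℕ<n g′))) (Equivalence.from (h g′ g′≡g) p) })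

  connected-output : ∀ g → InRange g ∧ (tagOf g ∧ eqV (payloadOf g) (zeros T)) ≡ true ⇔ Connected g (λ g′ → output ≡ g′)
  connected-output g = connected g _ _ λ g′ g′≡g → mk⇔
    (λ eq → let p , q = ∧-true {tagOf g} eq in Fin.toℕ-injective (begin
      toℕ output                    ≡⟨ toℕ-number (true ∷ zeros T) ⟩
      val (true ∷ zeros T)          ≡⟨ cong₂ (λ t v → val (t ∷ v)) p (eqV-sound (payloadOf g) (zeros T) q) ⟨
      val (tagOf g ∷ payloadOf g)   ≡⟨ val-number g (subst (_< 2 ^ suc T) g′≡g (Fin.toℕ<n g′)) ⟩
      g                             ≡⟨ g′≡g ⟨
      toℕ g′                        ∎))
    (λ { refl → subst (λ g → tagOf g ∧ eqV (payloadOf g) (zeros T) ≡ true) g′≡g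
           (true-∧ (tag-number true (zeros T)) (trans (cong (λ v → eqV v (zeros T)) (payload-number true (zeros T))) (eqV-refl (zeros T)))) })
    where open ≡-Reasoning

  connected-type : ∀ g b τ → (b ≡ true ⇔ gateType (if tagOf g then oracle children else leafOf (payloadOf g)) ≡ τ) →
                   InRange g ∧ b ≡ true ⇔ Connected g (λ g′ → gateType (gate g′) ≡ τ)
  connected-type g b τ h = connected g b _ λ g′ g′≡g →
    subst (λ g → b ≡ true ⇔ gateType (if tagOf g then oracle children else leafOf (payloadOf g)) ≡ τ) (sym g′≡g) h

  Points : ℕ → ℕ → List (Fin (2 ^ suc T)) → Set
  Points p h hs = Σ[ i ∈ Fin (length hs) ] toℕ i ≡ p × toℕ (List.lookup hs i) ≡ h

  WireHolds : ℕ → ℕ → Bool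
  WireHolds p h = isEmpty (List.drop T (bin p)) ∧ (InRange h ∧ (not (tagOf h) ∧ eqV (pad T (bin p)) (payloadOf h)))

  -- The words are listed in the order of their values, so the child with index `p` has payload `p`
  -- and tag `false`. A wire is thus recognised by comparing two binary words.
  points-children : ∀ p h → WireHolds p h ≡ true ⇔ Points p h children
  points-children p h = mk⇔ forth back′
    where
    open ≡-Reasoning
    forth : WireHolds p h ≡ true → Points p h children
    forth eq = i , toℕ-i , (begin
        toℕ (List.lookup children i)              ≡⟨ cong toℕ (proj₂ (proj₂ found)) ⟩
        toℕ (number (false ∷ List.lookup (allVecs T) j)) ≡⟨ toℕ-number (false ∷ List.lookup (allVecs T) j) ⟩
        val (false ∷ List.lookup (allVecs T) j)   ≡⟨ cong (λ v → val (false ∷ v)) (lookup-allVecs T j) ⟩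
        val (false ∷ pad T (bin (toℕ j)))         ≡⟨ cong (λ m → val (false ∷ pad T (bin m))) (trans (proj₁ (proj₂ found)) toℕ-i) ⟩
        val (false ∷ pad T (bin p))               ≡⟨ cong₂ (λ t v → val (t ∷ v)) (sym (not-true (proj₁ eq₃))) (eqV-sound (pad T (bin p)) _ (proj₂ eq₃)) ⟩
        val (tagOf h ∷ payloadOf h)               ≡⟨ val-number h (Equivalence.to (inRange h) (proj₁ eq₂)) ⟩
        h                                         ∎)
      where
      eq₁ = ∧-true {isEmpty (List.drop T (bin p))} eq
      eq₂ = ∧-true {InRange h} (proj₂ eq₁)
      eq₃ = ∧-true {not (tagOf h)} (proj₂ eq₂)
      p< : p < length children
      p< = subst (p <_) (sym (trans (List.length-map _ (allVecs T)) (length-allVecs T))) (Equivalence.to (isEmpty-bin T p) (proj₁ eq₁))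
      i = Fin.fromℕ< p<
      toℕ-i : toℕ i ≡ p
      toℕ-i = Fin.toℕ-fromℕ< p<
      found = map-index (λ v → number (false ∷ v)) (allVecs T) i
      j = proj₁ found
    back′ : Points p h children → WireHolds p h ≡ true
    back′ (i , toℕ-i , eq) =
      true-∧ (Equivalence.from (isEmpty-bin T p) p<)
        (true-∧ (Equivalence.from (inRange h) (subst (_< 2 ^ suc T) eq (Fin.toℕ<n (List.lookup children i))))
          (true-∧ (cong not (trans (cong tagOf (sym h≡)) (tag-number false (pad T (bin p)))))
            (trans (cong (eqV (pad T (bin p))) (trans (cong payloadOf (sym h≡)) (payload-number false (pad T (bin p))))) (eqV-refl (pad T (bin p))))))
      where
      p< : p < 2 ^ T
      p< = subst₂ _<_ toℕ-i (trans (List.length-map _ (allVecs T)) (length-allVecs T)) (Fin.toℕ<n i)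
      found = map-index (λ v → number (false ∷ v)) (allVecs T) i
      h≡ : toℕ (number (false ∷ pad T (bin p))) ≡ h
      h≡ = begin
        toℕ (number (false ∷ pad T (bin p)))                          ≡⟨ cong (λ m → toℕ (number (false ∷ pad T (bin m)))) (trans (proj₁ (proj₂ found)) toℕ-i) ⟨
        toℕ (number (false ∷ pad T (bin (toℕ (proj₁ found)))))        ≡⟨ cong (λ v → toℕ (number (false ∷ v))) (lookup-allVecs T (proj₁ found)) ⟨
        toℕ (number (false ∷ List.lookup (allVecs T) (proj₁ found)))  ≡⟨ cong toℕ (proj₂ (proj₂ found)) ⟨
        toℕ (List.lookup children i)                                  ≡⟨ eq ⟩
        h                                                             ∎

  connected-wire : ∀ g p h → InRange g ∧ (tagOf g ∧ WireHolds p h) ≡ true ⇔ Connected g (λ g′ → Points p h (predecessors (gate g′)))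
  connected-wire g p h = connected g (tagOf g ∧ WireHolds p h) (λ g′ → Points p h (predecessors (gate g′))) λ g′ g′≡g →
    subst (λ m → tagOf g ∧ WireHolds p h ≡ true ⇔ Points p h (predecessors (if tagOf m then oracle children else leafOf (payloadOf m)))) (sym g′≡g) (byTag g)
    where
    byTag : ∀ g → tagOf g ∧ WireHolds p h ≡ true ⇔ Points p h (predecessors (if tagOf g then oracle children else leafOf (payloadOf g)))
    byTag g with tagOf g
    ... | true  = points-children p h
    ... | false = mk⇔ (λ ()) (λ ps → case subst (Points p h) (leafOf-predecessors (payloadOf g)) ps of λ { (() , _) })

input-injective : ∀ {m n} → _≡_ {A = GateType} (input m) (input n) → m ≡ n
input-injective refl = refl

-- The argument enters only where an input is asked about; for all other types no argument has been
-- read, so `F` is true.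
verdict-type : ∀ {n s} (k : Kind n) (hs : List (Fin s)) t z b₁ b₀ F A τ →
  (b₀ ≡ true → b₁ ≡ true) → (∀ i → τ ≡ input i → ∀ j → k ≡ atLetter j → F ∧ A ≡ true ⇔ toℕ j ≡ i) → ((∀ i → τ ≢ input i) → F ≡ true) →
  verdict (query (hasType τ)) F t z (isLetter k) b₁ b₀ A ≡ true ⇔ gateType (if t then oracle hs else leaf k b₁ b₀) ≡ τ
verdict-type k hs t z b₁ b₀ F A neg mono h f with f (λ _ ())
verdict-type k hs t z b₁ b₀ .true A neg mono h f | refl = mk⇔ (λ ()) (λ eq → ⊥-elim (no-neg t k b₁ b₀ eq))
  where
  no-neg : ∀ t k b₁ b₀ → gateType (if t then oracle hs else leaf k b₁ b₀) ≢ neg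
  no-neg false (atLetter i) true  true  ()
  no-neg false (atLetter i) true  false ()
  no-neg false (atLetter i) false b₀    ()
  no-neg false atLeft       true  b₀    ()
  no-neg false atLeft       false b₀    ()
  no-neg false atRight      true  b₀    ()
  no-neg false atRight      false b₀    ()
verdict-type k hs t z b₁ b₀ F A and mono h f with f (λ _ ())
verdict-type k hs t z b₁ b₀ .true A and mono h f | refl = go t k b₁ b₀ mono
  where
  go : ∀ t k b₁ b₀ → (b₀ ≡ true → b₁ ≡ true) → (not t ∧ (if isLetter k then b₀ else b₁)) ≡ true ⇔ gateType (if t then oracle hs else leaf k b₁ b₀) ≡ and
  go true  k            b₁    b₀    m = mk⇔ (λ ()) (λ ())
  go false (atLetter i) true  true  m = mk⇔ (λ _ → refl) (λ _ → refl)
  go false (atLetter i) true  false m = mk⇔ (λ ()) (λ ())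
  go false (atLetter i) false true  m = case m refl of λ ()
  go false (atLetter i) false false m = mk⇔ (λ ()) (λ ())
  go false atLeft       true  b₀    m = mk⇔ (λ _ → refl) (λ _ → refl)
  go false atLeft       false b₀    m = mk⇔ (λ ()) (λ ())
  go false atRight      true  b₀    m = mk⇔ (λ _ → refl) (λ _ → refl)
  go false atRight      false b₀    m = mk⇔ (λ ()) (λ ())
verdict-type k hs t z b₁ b₀ F A or mono h f with f (λ _ ())
verdict-type k hs t z b₁ b₀ .true A or mono h f | refl = go t k b₁ b₀
  where
  go : ∀ t k b₁ b₀ → (not t ∧ not b₁) ≡ true ⇔ gateType (if t then oracle hs else leaf k b₁ b₀) ≡ or
  go true  k            b₁    b₀    = mk⇔ (λ ()) (λ ())
  go false (atLetter i) true  true  = mk⇔ (λ ()) (λ ())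
  go false (atLetter i) true  false = mk⇔ (λ ()) (λ ())
  go false (atLetter i) false b₀    = mk⇔ (λ _ → refl) (λ _ → refl)
  go false atLeft       true  b₀    = mk⇔ (λ ()) (λ ())
  go false atLeft       false b₀    = mk⇔ (λ _ → refl) (λ _ → refl)
  go false atRight      true  b₀    = mk⇔ (λ ()) (λ ())
  go false atRight      false b₀    = mk⇔ (λ _ → refl) (λ _ → refl)
verdict-type k hs t z b₁ b₀ F A oracle mono h f with f (λ _ ())
verdict-type k hs t z b₁ b₀ .true A oracle mono h f | refl = go t k b₁ b₀
  where
  go : ∀ t k b₁ b₀ → t ≡ true ⇔ gateType (if t then oracle hs else leaf k b₁ b₀) ≡ oracle
  go true  k            b₁    b₀    = mk⇔ (λ _ → refl) (λ _ → refl)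
  go false (atLetter i) true  true  = mk⇔ (λ ()) (λ ())
  go false (atLetter i) true  false = mk⇔ (λ ()) (λ ())
  go false (atLetter i) false b₀    = mk⇔ (λ ()) (λ ())
  go false atLeft       true  b₀    = mk⇔ (λ ()) (λ ())
  go false atLeft       false b₀    = mk⇔ (λ ()) (λ ())
  go false atRight      true  b₀    = mk⇔ (λ ()) (λ ())
  go false atRight      false b₀    = mk⇔ (λ ()) (λ ())
verdict-type k hs t z b₁ b₀ F A (input i) mono h f = go t k b₁ b₀ (h i refl)
  where
  never : ∀ {X : Set} → (X → ⊥) → F ∧ false ≡ true ⇔ X
  never ¬x = mk⇔ (λ eq → case trans (sym eq) (Bool.∧-zeroʳ F) of λ ()) (⊥-elim ∘ ¬x)
  go : ∀ t k b₁ b₀ → (∀ j → k ≡ atLetter j → F ∧ A ≡ true ⇔ toℕ j ≡ i) →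
       F ∧ (not t ∧ (isLetter k ∧ (b₁ ∧ (not b₀ ∧ A)))) ≡ true ⇔ gateType (if t then oracle hs else leaf k b₁ b₀) ≡ input i
  go true  k            b₁    b₀    h = never λ ()
  go false (atLetter j) true  true  h = never λ ()
  go false (atLetter j) true  false h = mk⇔ (cong input ∘ Equivalence.to (h j refl)) (Equivalence.from (h j refl) ∘ input-injective)
  go false (atLetter j) false b₀    h = never λ ()
  go false atLeft       true  b₀    h = never λ ()
  go false atLeft       false b₀    h = never λ ()
  go false atRight      true  b₀    h = never λ ()
  go false atRight      false b₀    h = never λ ()

kindOf-letter : ∀ n i j → kindOf n i ≡ atLetter j → i ≡ suc (toℕ j)
kindOf-letter n (suc i) j eq with i <? n
kindOf-letter n (suc i) .(Fin.fromℕ< i<n) refl | yes i<n = cong suc (sym (Fin.toℕ-fromℕ< i<n))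

-- The letter `j` is scanned at position `suc j`, which is compared with the incremented argument.
-- Incrementing is injective even modulo `2 ^ suc l`, since `decV` undoes it.
argument-correct : ∀ n l (pos : Vec Bool (suc l)) i j → n < 2 ^ suc l → kindOf n (val pos) ≡ atLetter j →
  isEmpty (List.drop (suc l) (bin i)) ∧ check inc true (pad (suc l) (bin i)) pos ≡ true ⇔ toℕ j ≡ i
argument-correct n l pos i j n< eq = mk⇔
  (λ t → let p , q = ∧-true {isEmpty (List.drop (suc l) (bin i))} t in begin
    toℕ j                             ≡⟨ val-pad-bin (suc l) (toℕ j) j< ⟨
    val (pad (suc l) (bin (toℕ j)))   ≡⟨ cong val (begin
      pad (suc l) (bin (toℕ j))              ≡⟨ decV-incV _ ⟨
      decV (incV (pad (suc l) (bin (toℕ j)))) ≡⟨ cong decV position ⟨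
      decV pos                               ≡⟨ cong decV (eqV-sound pos _ (trans (sym (check-apply inc (pad (suc l) (bin i)) pos)) q)) ⟩
      decV (incV (pad (suc l) (bin i)))      ≡⟨ decV-incV _ ⟩
      pad (suc l) (bin i)                    ∎) ⟩
    val (pad (suc l) (bin i))         ≡⟨ val-pad-bin (suc l) i (Equivalence.to (isEmpty-bin (suc l) i) p) ⟩
    i                                 ∎)
  (λ { refl → true-∧ (Equivalence.from (isEmpty-bin (suc l) (toℕ j)) j<)
       (trans (check-apply inc (pad (suc l) (bin (toℕ j))) pos) (trans (cong (λ v → eqV v (incV (pad (suc l) (bin (toℕ j))))) position) (eqV-refl (incV (pad (suc l) (bin (toℕ j))))))) })
  where
  open ≡-Reasoning
  j< : toℕ j < 2 ^ suc l
  j< = <-trans (Fin.toℕ<n j) n<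
  position : pos ≡ incV (pad (suc l) (bin (toℕ j)))
  position = trans (sym (pad-bin-val pos)) (trans (cong (pad (suc l) ∘ bin) (kindOf-letter n (val pos) j eq)) (pad-bin-suc (suc l) (toℕ j)))

isBitSymbol : TupleSymbol → Bool
isBitSymbol (bit _) = true
isBitSymbol _       = false

bits-marked : ∀ n → All (λ s → isBitSymbol s ≡ true) (bits n)
bits-marked n = All.map⁺ (All.universal (λ _ → refl) (bin n))

not-wire : ∀ τ → isWire (query (hasType τ)) ≡ false
not-wire (input i) = refl
not-wire neg       = refl
not-wire and       = refl
not-wire or        = refl
not-wire oracle    = refl

only-inputs-argue : ∀ l τ → (∀ i → τ ≢ input i) → isEmpty (List.drop (suc l) (argumentBits (hasType τ))) ≡ true
only-inputs-argue l (input i) p = ⊥-elim (p i refl)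
only-inputs-argue l neg       p = refl
only-inputs-argue l and       p = refl
only-inputs-argue l or        p = refl
only-inputs-argue l oracle    p = refl

+-linear : ∀ {a b} S A B → a ≤ S * A → b ≤ S * B → a + b ≤ S * (A + B)
+-linear S A B p q = ≤-trans (+-mono-≤ p q) (≤-reflexive (sym (*-distribˡ-+ S A B)))

*-linear : ∀ {a} S A k → a ≤ S * A → k * a ≤ S * (k * A)
*-linear S A k p = ≤-trans (*-monoʳ-≤ k p) (≤-reflexive (x∙yz≈y∙xz k S A))

-- With `S = suc L`, each phase takes at most `S` times a constant, and such bounds add up; the
-- constants appear in the order of the phases.
time-linear : ∀ m P L D → D ≤ P * (suc (suc L * suc m) + suc (suc L * suc m)) →
  (suc L * suc m) + (suc L + (suc (suc L * suc m) + suc D)) ≤ suc L * (suc m + (1 + ((1 + suc m) + (1 + P * ((1 + suc m) + (1 + suc m))))))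
time-linear m P L D D≤ = +-linear S (suc m) _ ≤-refl (+-linear S 1 _ unit (+-linear S (1 + suc m) _ cells (+-linear S 1 _ (≤-trans (s≤s z≤n) unit)
  (≤-trans D≤ (*-linear S _ P (+-linear S (1 + suc m) (1 + suc m) cells cells))))))
  where
  S = suc L
  unit : S ≤ S * 1
  unit = ≤-reflexive (sym (*-identityʳ S))
  cells : suc (S * suc m) ≤ S * (1 + suc m)
  cells = +-linear S 1 (suc m) (≤-trans (s≤s z≤n) unit) ≤-refl

module Uniformity (M : TM Bool) (m : ℕ) where

  open Family M m
  open Deciding M using (program; answer; x₀; c₀; Cell; tracks; duration-bound; outcome)

  abstract

    finiteCell : Finite Cell
    finiteCell = finiteVec (finiteVec finiteBool tracks) 5

  module Connection = Programs.Machine {TupleSymbol} {Memory} {Cell} finiteMemory finiteCell x₀ c₀ isBitSymbol m program answer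

  cells : ∀ n → Vec Cell (suc (extent n))
  cells n = Vec.replicate (suc (extent n)) c₀

  reply : ℕ → ℕ → Query → Bool
  reply n g q = outcome program answer x₀ (cells n) ⟨ n , g , q ⟩

  -- The marked letters are the bits of `n`, with which the tuple begins. So the row has
  -- `suc (extent n)` cells, and the time depends on `n` only, however long `g` and the operands of
  -- the question are.
  connection-run : ∀ n g q → Run Connection.machine ⟨ n , g , q ⟩ (λ _ → ⊤) (initial Connection.machine)
                                 (Connection.totalTime (length (bin n))) (reply n g q)
  connection-run n g q = Connection.machine-answers ⟨ n , g , q ⟩ {length (bin n)} {`#} {bits g ++ `# ∷ writeQuery q}
    (bits n) (List.length-map bit (bin n)) refl (bits-marked n) refl

  slope : ℕ
  slope = suc m + (1 + ((1 + suc m) + (1 + length program * ((1 + suc m) + (1 + suc m)))))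

  connection-time : ∀ n → Connection.totalTime (length (bin n)) ≤ (2 * slope) * suc ⌊log₂ n ⌋
  connection-time n = begin
    Connection.totalTime L         ≤⟨ time-linear m (length program) L _ (duration-bound (suc L * suc m) program) ⟩
    suc L * slope                  ≤⟨ *-monoˡ-≤ slope (s≤s (length-bin≤1+⌊log₂⌋ n)) ⟩
    -- `suc L` may exceed the logarithm by 2, one unit for the left marker and one for the length of
    -- `bin n`; this is where the factor 2 comes from.
    (2 + ⌊log₂ n ⌋) * slope        ≤⟨ *-monoˡ-≤ slope (s≤s (s≤s (≤-trans (m≤n+m ⌊log₂ n ⌋ ⌊log₂ n ⌋) (≤-reflexive (cong (⌊log₂ n ⌋ +_) (sym (+-identityʳ ⌊log₂ n ⌋))))))) ⟩
    (2 + 2 * ⌊log₂ n ⌋) * slope    ≡⟨ cong (_* slope) (*-suc 2 ⌊log₂ n ⌋) ⟨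
    (2 * suc ⌊log₂ n ⌋) * slope    ≡⟨ trans (*-assoc 2 (suc ⌊log₂ n ⌋) slope) (trans (cong (2 *_) (*-comm (suc ⌊log₂ n ⌋) slope)) (sym (*-assoc 2 slope (suc ⌊log₂ n ⌋)))) ⟩
    (2 * slope) * suc ⌊log₂ n ⌋    ∎
    where
    open ≤-Reasoning
    L = length (bin n)

  module _ (n : ℕ) where

    open Answers M n (extent n) (n<2^ n) (len≤ n) hiding (program; answer; x₀; c₀; Cell; tracks; duration-bound; outcome)

    blank : track argIx (cells n) ≡ zeros (suc (extent n))
    blank = Vec.map-replicate (get argIx) c₀ (suc (extent n))

    open Connections n T (leafOf n) (λ v → leaf-predecessors (gateKind v) (gateBit v true) (gateBit v false))

    correct-output : ∀ g → reply n g isOutput ≡ true ⇔ DirectConnection circuit n g isOutput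
    correct-output g = subst (λ b → b ≡ true ⇔ DirectConnection circuit n g isOutput) (sym (outcome-type (cells n) blank g isOutput refl)) (connected-output g)

    correct-wire : ∀ g p h → reply n g (wire p h) ≡ true ⇔ DirectConnection circuit n g (wire p h)
    correct-wire g p h = subst (λ b → b ≡ true ⇔ DirectConnection circuit n g (wire p h)) (sym (outcome-wire (cells n) blank g p h)) (connected-wire g p h)

    correct-type : ∀ g τ → reply n g (hasType τ) ≡ true ⇔ DirectConnection circuit n g (hasType τ)
    correct-type g τ = subst (λ b → b ≡ true ⇔ DirectConnection circuit n g (hasType τ)) (sym (outcome-type (cells n) blank g (hasType τ) (not-wire τ)))
      (connected-type g (verdictOn g (hasType τ)) τ
        (verdict-type (gateKind v) _ (tagOf g) (eqV v (zeros T)) (gateBit v true) (gateBit v false) (argumentFits (hasType τ)) _ τ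
          (gateBit-mono v)
          (λ { i refl j eq → argument-correct n (extent n) (positionTrack v) i j (n<2^ n) eq })
          (only-inputs-argue (extent n) τ)))
      where
      v : Payload
      v = payloadOf g

  logtimeUniform : LogtimeUniform circuit
  logtimeUniform = Connection.machine , 2 * slope , λ n g q →
    reply n g q , (Connection.totalTime (length (bin n)) , connection-time n , connection-run n g q) , correct n g q
    where
    correct : ∀ n g q → reply n g q ≡ true ⇔ DirectConnection circuit n g q
    correct n g isOutput    = correct-output n g
    correct n g (hasType τ) = correct-type n g τ
    correct n g (wire p h)  = correct-wire n g p h

lemma4p6 : L-hard MSAT
lemma4p6 A (M , c , h) = circuit , isAC⁰ , Uniformity.logtimeUniform M c , decides A c (n≤1+n c) h
  where open Family M c
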